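{- Let $d\ge 1$ be an integer and let $\sigma$ be a finite relational signature. There is a function $f\in d\text{ - }\mathrm{EXP}$ such that for every order-invariant sentence $\varphi\in\mathrm{FO}[\sigma\cup\{\le\}]$ (i.e. every sentence of ${<}\text{ -inv- }\mathrm{FO}[\sigma]$) there is a sentence $\psi\in\mathrm{FO}[\sigma]$ (not using $\le$) such that 1. $\psi$ is equivalent to $\varphi$ on $\mathrm{Fin}_{\sigma,d}$: for every $\mathfrak A\in \mathrm{Fin}_{\sigma,d}$, $\mathfrak A\models_{\le}\varphi$ if and only if $\mathfrak A\models\psi$; 2. $\|\psi\|\le f(\operatorname{qr}(\varphi))$; 3. $\operatorname{qad}(\psi)\le 3d$.
   Context: All structures are finite. $\mathrm{FO}$ is first-order logic. Tree-depth: for a finite simple graph $G$, $\operatorname{td}(G)=1$ if $|V(G)|=1$; $\operatorname{td}(G)=1+\min_{r\in V(G)}\operatorname{td}(G\setminus r)$ if $G$ is connected and $|V(G)|>1$; $\operatorname{td}(G)=\max_i \operatorname{td}(K_i)$ if $G$ is disconnected with components $K_1,\dots,K_n$. The Gaifman graph of a $\sigma$-structure $\mathfrak A$ has the universe $A$ as vertex set, with an edge between distinct $x,y$ iff they occur together in a tuple of some relation of $\mathfrak A$. The tree-depth of $\mathfrak A$ is that of its Gaifman graph. $\mathrm{Fin}_{\sigma,d}$ is the class of finite $\sigma$-structures of tree-depth at most $d$. Order-invariance: $\le$ is a binary relation symbol not in $\sigma$. An ordered expansion $(\mathfrak A,\preceq)$ of a $\sigma$-structure $\mathfrak A$ is its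 expansion to a $\sigma\cup\{\le\}$-structure interpreting $\le$ by a linear order $\preceq$ on $A$. A sentence $\varphi\in \mathrm{FO}[\sigma\cup\{\le\}]$ is order-invariant (on all finite structures) if for every finite $\sigma$-structure $\mathfrak A$ and any two ordered expansions, $(\mathfrak A,\preceq_1)\models\varphi$ iff $(\mathfrak A,\preceq_2)\models\varphi$. For such $\varphi$, $\mathfrak A\models_{\le}\varphi$ means $(\mathfrak A,\preceq)\models\varphi$ for some (equivalently every) ordered expansion. $\operatorname{qr}(\varphi)$ is the quantifier rank and $\|\varphi\|$ the size (length) of $\varphi$. The quantifier alternation depth $\operatorname{qad}(\varphi)$ of a formula in negation normal form (negations only in front of atoms) is the maximum number of alternations between $\exists$- and $\forall$-quantifiers on directed paths of the syntax tree; for other formulae it is that of an equivalent formula in negation normal form obtained by a fixed conversion procedure. The $d$-fold exponential is $0\text{ - }\exp(n)=n$, $(d+1)\text{ - }\exp(n)=2^{d\text{ - }\exp(n)}$. $d\text{ - }\mathrm{EXP}$ is the class of functions $f:\mathbb N\to\mathbb N$ for which there is $c\in\mathbb N$ with $f(n)\le d\text{ - }\exp(n^c)$ for all $n>c$. -}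

module Defs where

open import Data.Bool using (Bool; T)
open import Data.Fin using (Fin; zero; suc)
open import Data.Fin.Subset using (Subset; _∈_; _⊆_; _-_; ∣_∣; Nonempty; ⊤)
open import Data.Maybe using (Maybe; just; nothing)
open import Data.Nat using (ℕ; zero; suc; _+_; _^_; _⊔_; _≤_; _<_; NonZero)
open import Data.Product using (Σ-syntax; ∃-syntax; _×_; _,_)
open import Data.Sum using (_⊎_)
open import Data.Vec using (Vec; []; _∷_; lookup; map)
import Data.Vec.Membership.Propositional as Vec
open import Function using (_∘_)
open import Function.Bundles using (_⇔_)
open import Relation.Binary.Construct.Closure.ReflexiveTransitive using (Star)
open import Relation.Binary.Definitions using (Symmetric; Irreflexive)
open import Relation.Binary.PropositionalEquality using (_≡_; _≢_; sym)
open import Relation.Binary.Structures using (IsTotalOrder)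
open import Relation.Nullary using (¬_)

record Signature : Set where
  field
    #symbols : ℕ
    arity    : Fin #symbols → ℕ

open Signature public

Symbol : Signature → Set
Symbol σ = Fin (#symbols σ)

-- The symbol ≤ is `zero`; the symbol R of σ becomes `suc R`.
infix 8 _∪≤

_∪≤ : Signature → Signature
#symbols (σ ∪≤)         = suc (#symbols σ)
arity    (σ ∪≤) zero    = 2
arity    (σ ∪≤) (suc R) = arity σ R

-- Universes are nonempty, and are initial segments of ℕ, which costs no
-- generality up to isomorphism.
record Structure (σ : Signature) : Set where
  field
    card             : ℕ
    {{card-nonZero}} : NonZero card
    interp           : (R : Symbol σ) → Vec (Fin card) (arity σ R) → Bool

  Universe : Set
  Universe = Fin card

open Structure public

record LinearOrder (A : Set) : Set where
  field
    leq          : A → A → Bool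
    isTotalOrder : IsTotalOrder _≡_ (λ x y → T (leq x y))

open LinearOrder public

expand : ∀ {σ} (𝔄 : Structure σ) → LinearOrder (Universe 𝔄) → Structure (σ ∪≤)
card         (expand 𝔄 ≼)                    = card 𝔄
card-nonZero (expand 𝔄 ≼)                    = card-nonZero 𝔄
interp       (expand 𝔄 ≼) zero (x ∷ y ∷ [])  = leq ≼ x y
interp       (expand 𝔄 ≼) (suc R) xs         = interp 𝔄 R xs

-- Variables are de Bruijn indices: `Formula σ n` has its free variables
-- among n variables.

infix  9 _≐_
infix  8 ¬′_
infixr 7 _∧′_
infixr 6 _∨′_
infix  5 ∃′_ ∀′_

data Formula (σ : Signature) (n : ℕ) : Set where
  _≐_  : (x y : Fin n) → Formula σ n
  rel  : (R : Symbol σ) → Vec (Fin n) (arity σ R) → Formula σ n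
  ¬′_  : Formula σ n → Formula σ n
  _∧′_ : (φ ψ : Formula σ n) → Formula σ n
  _∨′_ : (φ ψ : Formula σ n) → Formula σ n
  ∃′_  : Formula σ (suc n) → Formula σ n
  ∀′_  : Formula σ (suc n) → Formula σ n

Sentence : Signature → Set
Sentence σ = Formula σ 0

infix 4 _,_⊨_ _⊨_ _⊨≤_

_,_⊨_ : ∀ {σ n} (𝔄 : Structure σ) → Vec (Universe 𝔄) n → Formula σ n → Set
𝔄 , ρ ⊨ x ≐ y    = lookup ρ x ≡ lookup ρ y
𝔄 , ρ ⊨ rel R xs = T (interp 𝔄 R (map (lookup ρ) xs))
𝔄 , ρ ⊨ ¬′ φ     = ¬ (𝔄 , ρ ⊨ φ)
𝔄 , ρ ⊨ φ ∧′ ψ   = (𝔄 , ρ ⊨ φ) × (𝔄 , ρ ⊨ ψ)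
𝔄 , ρ ⊨ φ ∨′ ψ   = (𝔄 , ρ ⊨ φ) ⊎ (𝔄 , ρ ⊨ ψ)
𝔄 , ρ ⊨ ∃′ φ     = Σ[ a ∈ Universe 𝔄 ] (𝔄 , a ∷ ρ ⊨ φ)
𝔄 , ρ ⊨ ∀′ φ     = (a : Universe 𝔄) → 𝔄 , a ∷ ρ ⊨ φ

_⊨_ : ∀ {σ} → Structure σ → Sentence σ → Set
𝔄 ⊨ φ = 𝔄 , [] ⊨ φ

OrderInvariant : ∀ {σ} → Sentence (σ ∪≤) → Set
OrderInvariant {σ} φ =
  (𝔄 : Structure σ) (≼₁ ≼₂ : LinearOrder (Universe 𝔄)) →
  (expand 𝔄 ≼₁ ⊨ φ) ⇔ (expand 𝔄 ≼₂ ⊨ φ)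

_⊨≤_ : ∀ {σ} → Structure σ → Sentence (σ ∪≤) → Set
𝔄 ⊨≤ φ = Σ[ ≼ ∈ LinearOrder (Universe 𝔄) ] (expand 𝔄 ≼ ⊨ φ)

qr : ∀ {σ n} → Formula σ n → ℕ
qr (x ≐ y)    = 0
qr (rel R xs) = 0
qr (¬′ φ)     = qr φ
qr (φ ∧′ ψ)   = qr φ ⊔ qr ψ
qr (φ ∨′ ψ)   = qr φ ⊔ qr ψ
qr (∃′ φ)     = suc (qr φ)
qr (∀′ φ)     = suc (qr φ)

-- The length of the formula as a word, written with the conventions
-- x = y, R x₁ … xₖ, ¬ φ, (φ ∧ ψ), (φ ∨ ψ), ∃ x φ, ∀ x φ, where every
-- variable occurrence counts as one symbol.
∥_∥ : ∀ {σ n} → Formula σ n → ℕ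
∥ x ≐ y ∥            = 3
∥_∥ {σ} (rel R xs)   = suc (arity σ R)
∥ ¬′ φ ∥             = suc ∥ φ ∥
∥ φ ∧′ ψ ∥           = 3 + (∥ φ ∥ + ∥ ψ ∥)
∥ φ ∨′ ψ ∥           = 3 + (∥ φ ∥ + ∥ ψ ∥)
∥ ∃′ φ ∥             = 2 + ∥ φ ∥
∥ ∀′ φ ∥             = 2 + ∥ φ ∥

-- `nnf` is the identity on formulas already in negation normal form;
-- `nnf¬ φ` is a negation normal form of ¬ φ.
mutual
  nnf : ∀ {σ n} → Formula σ n → Formula σ n
  nnf (x ≐ y)    = x ≐ y
  nnf (rel R xs) = rel R xs
  nnf (¬′ φ)     = nnf¬ φ
  nnf (φ ∧′ ψ)   = nnf φ ∧′ nnf ψ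
  nnf (φ ∨′ ψ)   = nnf φ ∨′ nnf ψ
  nnf (∃′ φ)     = ∃′ nnf φ
  nnf (∀′ φ)     = ∀′ nnf φ

  nnf¬ : ∀ {σ n} → Formula σ n → Formula σ n
  nnf¬ (x ≐ y)    = ¬′ (x ≐ y)
  nnf¬ (rel R xs) = ¬′ rel R xs
  nnf¬ (¬′ φ)     = nnf φ
  nnf¬ (φ ∧′ ψ)   = nnf¬ φ ∨′ nnf¬ ψ
  nnf¬ (φ ∨′ ψ)   = nnf¬ φ ∧′ nnf¬ ψ
  nnf¬ (∃′ φ)     = ∀′ nnf¬ φ
  nnf¬ (∀′ φ)     = ∃′ nnf¬ φ

data Quantifier : Set where
  ex all : Quantifier

switch : Maybe Quantifier → Quantifier → ℕ
switch (just ex)  all = 1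
switch (just all) ex  = 1
switch _          _   = 0

-- The maximum number of changes of quantifier on a path of the syntax
-- tree, where the first argument is the last quantifier met above the
-- formula. Only meaningful in negation normal form.
alternations : ∀ {σ n} → Maybe Quantifier → Formula σ n → ℕ
alternations q (x ≐ y)    = 0
alternations q (rel R xs) = 0
alternations q (¬′ φ)     = alternations q φ
alternations q (φ ∧′ ψ)   = alternations q φ ⊔ alternations q ψ
alternations q (φ ∨′ ψ)   = alternations q φ ⊔ alternations q ψ
alternations q (∃′ φ)     = switch q ex  + alternations (just ex)  φ
alternations q (∀′ φ)     = switch q all + alternations (just all) φ

qad : ∀ {σ n} → Formula σ n → ℕ
qad φ = alternations nothing (nnf φ)

record Graph (n : ℕ) : Set₁ where
  field
    Edge        : Fin n → Fin n → Set
    edge-sym    : Symmetric Edge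
    edge-irrefl : Irreflexive _≡_ Edge

open Graph public

-- A vertex set S stands for the subgraph G[S] it induces.
module _ {n} (G : Graph n) where

  EdgeIn : Subset n → Fin n → Fin n → Set
  EdgeIn S x y = x ∈ S × y ∈ S × Edge G x y

  Connected : Subset n → Set
  Connected S = ∀ {x y} → x ∈ S → y ∈ S → Star (EdgeIn S) x y

  record IsComponent (S K : Subset n) : Set where
    field
      nonempty  : Nonempty K
      inside    : K ⊆ S
      connected : Connected K
      maximal   : ∀ {L} → K ⊆ L → L ⊆ S → Connected L → L ⊆ K

IsMinimum IsMaximum : {X : Set} → (X → Set) → (X → ℕ) → ℕ → Set
IsMinimum P t m = (∃[ x ] P x × t x ≡ m) × (∀ x → P x → m ≤ t x)
IsMaximum P t m = (∃[ x ] P x × t x ≡ m) × (∀ x → P x → t x ≤ m)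

-- `TreeDepth G S k` says td(G[S]) = k: it is the graph of the recursively
-- defined function td, with one constructor for each defining equation.
-- In each of the last two, t collects the values of the recursive calls.
data TreeDepth {n} (G : Graph n) (S : Subset n) : ℕ → Set where

  single : ∣ S ∣ ≡ 1 → TreeDepth G S 1

  conn : ∀ {m} → Connected G S → 1 < ∣ S ∣ →
         (t : Fin n → ℕ) →
         (∀ r → r ∈ S → TreeDepth G (S - r) (t r)) →
         IsMinimum (_∈ S) t m →
         TreeDepth G S (suc m)

  disconn : ∀ {m} → ¬ Connected G S →
            (t : Subset n → ℕ) →
            (∀ K → IsComponent G S K → TreeDepth G K (t K)) →
            IsMaximum (IsComponent G S) t m →
            TreeDepth G S m

gaifman : ∀ {σ} (𝔄 : Structure σ) → Graph (card 𝔄)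
Edge (gaifman {σ} 𝔄) x y =
  x ≢ y × (Σ[ R ∈ Symbol σ ] Σ[ xs ∈ Vec (Universe 𝔄) (arity σ R) ]
             T (interp 𝔄 R xs) × x Vec.∈ xs × y Vec.∈ xs)
edge-sym (gaifman 𝔄) (x≢y , R , xs , Rxs , x∈ , y∈) =
  x≢y ∘ sym , R , xs , Rxs , y∈ , x∈
edge-irrefl (gaifman 𝔄) x≡y (x≢y , _) = x≢y x≡y

infix 4 _∈Fin_

_∈Fin_ : ∀ {σ} → Structure σ → ℕ → Set
𝔄 ∈Fin d = ∃[ k ] TreeDepth (gaifman 𝔄) ⊤ k × k ≤ d

infix 8 _-exp_

_-exp_ : ℕ → ℕ → ℕ
zero  -exp n = n
suc d -exp n = 2 ^ (d -exp n)

infix 4 _∈_-EXP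

_∈_-EXP : (ℕ → ℕ) → ℕ → Set
f ∈ d -EXP = ∃[ c ] (∀ n → c < n → f n ≤ d -exp (n ^ c))

{-# OPTIONS --safe #-}
module Submission where

-- By order-invariance φ may be evaluated with any order, in particular with one
-- that is adapted to an elimination forest of the structure 𝔄: roots come first
-- and subtrees are sorted by their types. The type of a tree of height k records
-- the atomic type of its root and, for each type of height k - 1, the number of
-- its subtrees of that type, where all numbers ≥ 2 ^ qr φ are identified. An
-- Ehrenfeucht–Fraïssé game on ordered sums shows that the types determine the
-- truth of φ, so φ can be tested on one canonical forest for each type.
--
-- ψ is the disjunction, over the finitely many types on whose canonical forest φ
-- holds, of sentences stating that 𝔄 has an elimination forest of that type. Such
-- a sentence asserts that there are roots for the counted subtrees and that the
-- component of every other element has a root of a type counted as "many"; each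
-- level of the forest costs two quantifier alternations, as connectedness is
-- existential: bounded tree-depth bounds the lengths of shortest walks. The number
-- of types grows by one exponential per level.

open import Defs
open import Data.Bool using (Bool; T; false; if_then_else_; true)
open import Data.Bool.Properties using (T-≡; T?)
open import Data.Empty using (⊥; ⊥-elim)
open import Data.Fin
  using (Fin; _↑ʳ_; _↑ˡ_; combine; finToFun; fromℕ; fromℕ<; funToFin; quotient; remainder; suc;
    toℕ; zero)
open import Data.Fin.Properties
  using (_≟_; all?; any?; combine-injective; combine-remQuot; finToFun-funToFin; funToFin-finToFin;
    remQuot-combine; suc-injective; toℕ-fromℕ; toℕ-fromℕ<; toℕ-injective; toℕ≤pred[n])
open import Data.Fin.Subset.Induction using (Acc; acc; ⊃-wellFounded)
open import Data.Fin.Subset.Properties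
  using (_∈?_; p⊆p∪q; p⊆q⇒∣p∣≤∣q∣; p─q⊆p; q⊆p∪q; x∈p⇒∣p-x∣<∣p∣; x∈p∧x≢y⇒x∈p-y; x∈p∪q⁻; x∈⁅x⁆;
    x∈⁅y⁆⇒x≡y; ∈⊤; ∣⁅x⁆∣≡1)
open import Data.List
  using (List; []; _++_; _∷_; allFin; concat; concatMap; drop; filter; foldr; length; lookup; map;
    replicate; tabulate; take)
open import Data.List.Membership.Propositional using (_∈_; find; lose)
open import Data.List.Membership.Propositional.Properties
  using (∈-++⁺ʳ; ∈-++⁺ˡ; ∈-allFin; ∈-concatMap⁺; ∈-filter⁺; ∈-filter⁻; ∈-map⁺; ∈-map⁻)
open import Data.List.Properties
  using (++-assoc; ++-identityʳ; concat-map; drop-all; filter-++; filter-accept; filter-all;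
    filter-none; filter-reject; length-++; length-filter; length-map; length-replicate;
    length-tabulate; length-take; map-cong; map-id; map-tabulate; map-∘; tabulate-cong;
    take++drop≡id)
open import Data.List.Relation.Binary.Permutation.Propositional
  using (_↭_; module PermutationReasoning; prep; ↭-refl; ↭-reflexive; ↭-sym; ↭-trans; ↭⇒↭ₛ)
open import Data.List.Relation.Binary.Permutation.Propositional.Properties
  using (++⁺ˡ; All-resp-↭; Any-resp-↭; shift; shifts)
open import Data.List.Relation.Unary.All using (All; []; _∷_)
open import Data.List.Relation.Unary.AllPairs using (AllPairs; []; _∷_)
open import Data.List.Relation.Unary.Any using (Any; here; index; there)
open import Data.List.Relation.Unary.Any.Properties using (lookup-index)
open import Data.Maybe using (just; nothing)
open import Data.Nat
  using (_*_; _+_; _<_; _^_; _∸_; _≤?_; _≤_; _⊓_; _⊔_; suc; s≤s; s≤s⁻¹; zero; z≤n; ℕ)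
open import Data.Nat.ListAction using (sum)
open import Data.Product using (_,_; _×_; proj₁; proj₂; swap; uncurry; Σ-syntax; ∃-syntax)
open import Data.Product.Function.NonDependent.Propositional using (_×-⇔_)
open import Data.Sum using ([_,_]′; _⊎_; inj₁; inj₂)
open import Data.Sum.Function.Propositional using (_⊎-⇔_)
open import Data.Vec using (Vec; []; _∷_; there)
open import Function using (_∘_; id)
open import Function.Bundles using (Equivalence; _⇔_; mk⇔)
open import Relation.Binary.Construct.Closure.ReflexiveTransitive using (Star; _◅_; ε)
open import Relation.Binary.PropositionalEquality
  using (_≡_; _≢_; cong; cong₂; isEquivalence; module ≡-Reasoning; refl; resp₂; setoid; subst; sym;
    trans)
open import Relation.Nullary using (Dec; no; yes; ¬_)
open import Relation.Nullary.Decidable using (_×-dec_; _⊎-dec_; decidable-stable; map′; ¬?)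
open import Data.Fin.Subset using (Subset; inside; outside; ⁅_⁆; _∪_; _⊃_) renaming (_∈_ to _∈ˢ_; _-_ to _-ˢ_)
open import Data.Nat.Properties hiding (_≟_; suc-injective)
open import Data.Unit using (tt) renaming (⊤ to Unit)
import Data.List.Relation.Binary.Permutation.Setoid.Properties as Perm
import Data.List.Relation.Unary.All as All
import Data.List.Relation.Unary.All.Properties as All
import Data.List.Relation.Unary.Any as Any
import Data.List.Relation.Unary.Any.Properties as AnyP
import Data.Nat.Properties as ℕ
import Data.Vec as Vec
import Data.Vec.Membership.DecPropositional as VecDec
import Data.Vec.Membership.Propositional as VecMem
import Data.Vec.Membership.Propositional.Properties as VecMemP
import Data.Vec.Properties as Vec
import Data.Vec.Relation.Unary.Any as VecAny
import Data.Vec.Relation.Unary.Any.Properties as VecAnyP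

-- Growth of iterated exponentials

-- A type need not belong to any structure, since the labels along a branch may contradict each
-- other. Hence canonical forests are not turned into structures: `⊩` evaluates φ on labelled
-- ordered forests and looks a tuple up in the label of its lowest entry. For the forest of a
-- structure this is faithful, because the entries of a related tuple are pairwise equal or adjacent
-- in the Gaifman graph and so lie on one branch. The disjuncts of contradictory types are false on
-- the structures considered. A component may be rooted in several ways, so a structure may have
-- forests of many types and the disjuncts may overlap. No uniqueness is required: any single forest
-- of 𝔄 with a given type fixes an order, and φ under that order agrees with φ on the canonical
-- forest. The threshold comes from linear orders: r rounds cannot tell apart lengths of at least 2
-- ^ r - 1. The exponentials fit because the number of types of trees of height 1 does not depend on
-- `qr φ`: height k + 1 costs k exponentials, and only the forest on top reaches d.

n≤2^n : ∀ n → n ≤ 2 ^ n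
n≤2^n zero    = z≤n
n≤2^n (suc n) = begin
  suc n           ≤⟨ s≤s (n≤2^n n) ⟩
  1 + 2 ^ n       ≤⟨ +-monoˡ-≤ (2 ^ n) (m^n>0 2 n) ⟩
  2 ^ n + 2 ^ n   ≡⟨ cong (2 ^ n +_) (sym (+-identityʳ (2 ^ n))) ⟩
  2 ^ suc n       ∎
  where open ≤-Reasoning

2≤exp : ∀ d {x} → 2 ≤ x → 2 ≤ d -exp x
2≤exp zero    2≤x = 2≤x
2≤exp (suc d) 2≤x = ≤-trans (2≤exp d 2≤x) (n≤2^n _)

+≤* : ∀ {x y} → 2 ≤ x → 2 ≤ y → x + y ≤ x * y
+≤* {suc (suc x)} {suc (suc y)} (s≤s (s≤s _)) (s≤s (s≤s _)) = begin
  2 + x + (2 + y)                    ≤⟨ m≤m+n _ (x + y + x * y) ⟩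
  2 + x + (2 + y) + (x + y + x * y)  ≡⟨ solve 2 (λ x y → con 2 :+ x :+ (con 2 :+ y) :+ (x :+ y :+ x :* y) := (con 2 :+ x) :* (con 2 :+ y)) refl x y ⟩
  (2 + x) * (2 + y)                  ∎
  where
  open ≤-Reasoning
  open import Data.Nat.Solver
  open +-*-Solver

-- One level up, the product is a power of 2 with a sum as exponent; `+≤*` bounds this sum by a
-- product, to which the induction hypothesis applies.
exp-* : ∀ d {x y} → 2 ≤ x → 2 ≤ y → (d -exp x) * (d -exp y) ≤ d -exp (x * y)
exp-* zero    2≤x 2≤y = ≤-refl
exp-* (suc d) {x} {y} 2≤x 2≤y = begin
  2 ^ (d -exp x) * 2 ^ (d -exp y)  ≡⟨ sym (^-distribˡ-+-* 2 (d -exp x) (d -exp y)) ⟩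
  2 ^ (d -exp x + d -exp y)        ≤⟨ ^-monoʳ-≤ 2 (+≤* (2≤exp d 2≤x) (2≤exp d 2≤y)) ⟩
  2 ^ (d -exp x * d -exp y)        ≤⟨ ^-monoʳ-≤ 2 (exp-* d 2≤x 2≤y) ⟩
  2 ^ (d -exp (x * y))             ∎
  where open ≤-Reasoning

exp-monoʳ : ∀ d {x y} → x ≤ y → d -exp x ≤ d -exp y
exp-monoʳ zero    x≤y = x≤y
exp-monoʳ (suc d) x≤y = ^-monoʳ-≤ 2 (exp-monoʳ d x≤y)

-- The exponent is made positive and the threshold at least 1, so that
-- n ^ c ≥ 2 from the threshold on.
normalise : ∀ d {f} → f ∈ d -EXP →
            ∃[ c ] (∀ n → suc c < n → 2 ≤ n ^ suc c × f n ≤ d -exp (n ^ suc c))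
normalise d (c , f≤) = c , λ
  { (suc (suc n)) 1+c<n →
      ≤-trans (s≤s (s≤s z≤n)) (m≤m*n (suc (suc n)) (suc (suc n) ^ c) {{m^n≢0 (suc (suc n)) c}}) ,
      ≤-trans (f≤ _ (<-trans (n<1+n c) 1+c<n)) (exp-monoʳ d (^-monoʳ-≤ (suc (suc n)) (n≤1+n c)))
  ; (suc zero) (s≤s ()) }

EXP-≤ : ∀ d {f g} → (∀ n → f n ≤ g n) → g ∈ d -EXP → f ∈ d -EXP
EXP-≤ d f≤g (c , g≤) = c , λ n c<n → ≤-trans (f≤g n) (g≤ n c<n)

EXP-id : id ∈ 0 -EXP
EXP-id = 1 , λ n _ → ≤-reflexive (sym (*-identityʳ n))

-- The same exponent serves both operations: beyond the threshold a sum of the two bounds is at most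
-- their product, and `exp-*` merges n ^ a and n ^ b into n ^ (a + b).
EXP-+* : ∀ d {f g} → f ∈ d -EXP → g ∈ d -EXP →
         (λ n → f n + g n) ∈ d -EXP × (λ n → f n * g n) ∈ d -EXP
EXP-+* d {f} {g} f∈ g∈ with normalise d f∈ | normalise d g∈
... | a , f≤ | b , g≤ =
  (suc a + suc b , λ n c<n →
    let 2≤x , fn≤ = f≤′ n c<n
        2≤y , gn≤ = g≤′ n c<n
    in ≤-trans (≤-trans (+-mono-≤ fn≤ gn≤) (+≤* (2≤exp d 2≤x) (2≤exp d 2≤y))) (merge n 2≤x 2≤y)) ,
  (suc a + suc b , λ n c<n →
    let 2≤x , fn≤ = f≤′ n c<n
        2≤y , gn≤ = g≤′ n c<n
    in ≤-trans (*-mono-≤ fn≤ gn≤) (merge n 2≤x 2≤y))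
  where
  f≤′ : ∀ n → suc a + suc b < n → 2 ≤ n ^ suc a × f n ≤ d -exp (n ^ suc a)
  f≤′ n c<n = f≤ n (≤-trans (s≤s (m≤m+n (suc a) (suc b))) c<n)
  g≤′ : ∀ n → suc a + suc b < n → 2 ≤ n ^ suc b × g n ≤ d -exp (n ^ suc b)
  g≤′ n c<n = g≤ n (≤-trans (s≤s (m≤n+m (suc b) (suc a))) c<n)
  merge : ∀ n → 2 ≤ n ^ suc a → 2 ≤ n ^ suc b →
          d -exp (n ^ suc a) * d -exp (n ^ suc b) ≤ d -exp (n ^ (suc a + suc b))
  merge n 2≤x 2≤y = ≤-trans (exp-* d 2≤x 2≤y)
    (≤-reflexive (cong (d -exp_) (sym (^-distribˡ-+-* n (suc a) (suc b)))))

EXP-+ : ∀ d {f g} → f ∈ d -EXP → g ∈ d -EXP → (λ n → f n + g n) ∈ d -EXP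
EXP-+ d f∈ g∈ = proj₁ (EXP-+* d f∈ g∈)

EXP-* : ∀ d {f g} → f ∈ d -EXP → g ∈ d -EXP → (λ n → f n * g n) ∈ d -EXP
EXP-* d f∈ g∈ = proj₂ (EXP-+* d f∈ g∈)

EXP-2^ : ∀ d {f} → f ∈ d -EXP → (λ n → 2 ^ f n) ∈ suc d -EXP
EXP-2^ d (c , f≤) = c , λ n c<n → ^-monoʳ-≤ 2 (f≤ n c<n)

EXP-suc : ∀ d {f} → f ∈ d -EXP → f ∈ suc d -EXP
EXP-suc d f∈ = EXP-≤ (suc d) (λ n → n≤2^n _) (EXP-2^ d f∈)

EXP-raise : ∀ d {f} → f ∈ 0 -EXP → f ∈ d -EXP
EXP-raise zero    f∈ = f∈
EXP-raise (suc d) f∈ = EXP-suc d (EXP-raise d f∈)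

EXP-const : ∀ d k → (λ _ → k) ∈ d -EXP
EXP-const d k = EXP-raise d (suc k , bound)
  where
  bound : ∀ n → suc k < n → k ≤ n ^ suc k
  bound (suc n) k<n = ≤-trans (≤-trans (n≤1+n k) (<⇒≤ k<n))
                              (m≤m*n (suc n) (suc n ^ k) {{m^n≢0 (suc n) k}})

-- The base adds only a factor n + 1 to the exponent, so a single exponential is spent. With f the
-- number of tree types, this counts forest types for the threshold 2 ^ n.
EXP-suc2^^ : ∀ d {f} → f ∈ d -EXP → (λ n → suc (2 ^ n) ^ f n) ∈ suc d -EXP
EXP-suc2^^ d {f} f∈ =
  EXP-≤ (suc d) bound (EXP-2^ d (EXP-* d (EXP-+ d (EXP-const d 1) (EXP-raise d EXP-id)) f∈))
  where
  bound : ∀ n → suc (2 ^ n) ^ f n ≤ 2 ^ (suc n * f n)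
  bound n = begin
    suc (2 ^ n) ^ f n        ≤⟨ ^-monoˡ-≤ (f n) (+-monoˡ-≤ (2 ^ n) (m^n>0 2 n)) ⟩
    (2 ^ n + 2 ^ n) ^ f n    ≡⟨ cong (λ z → (2 ^ n + z) ^ f n) (sym (+-identityʳ (2 ^ n))) ⟩
    (2 ^ suc n) ^ f n        ≡⟨ ^-*-assoc 2 (suc n) (f n) ⟩
    2 ^ (suc n * f n)        ∎
    where open ≤-Reasoning

-- Ordered forests and the Ehrenfeucht–Fraïssé game

-- `elt` is extra decoration (the element of a σ-structure that a node
-- stands for); it plays no role in the game.
record OForest (Λ E : Set) : Set₁ where
  field
    Node       : Set
    elt        : Node → E
    label      : Node → Λ
    anc le     : Node → Node → Bool
    search     : {P : Node → Set} → (∀ x → Dec (P x)) → Dec (Σ[ x ∈ Node ] P x)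
    anc-refl   : ∀ x → T (anc x x)
    anc-trans  : ∀ x y z → T (anc x y) → T (anc y z) → T (anc x z)
    le-refl    : ∀ x → T (le x x)
    le-antisym : ∀ x y → T (le x y) → T (le y x) → x ≡ y
    le-trans   : ∀ x y z → T (le x y) → T (le y z) → T (le x z)
    le-total   : ∀ x y → T (le x y) ⊎ T (le y x)

open OForest

emptyForest : ∀ {Λ E} → OForest Λ E
emptyForest = record
  { Node = ⊥ ; elt = λ () ; label = λ () ; anc = λ () ; le = λ () ; search = λ _ → no λ ()
  ; anc-refl = λ () ; anc-trans = λ () ; le-refl = λ () ; le-antisym = λ ()
  ; le-trans = λ () ; le-total = λ () }

singleNode : ∀ {Λ E} → Λ → E → OForest Λ E
singleNode λ₀ e = record
  { Node = Unit ; elt = λ _ → e ; label = λ _ → λ₀ ; anc = λ _ _ → true ; le = λ _ _ → true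
  ; search = λ P? → map′ (tt ,_) proj₂ (P? tt)
  ; anc-refl = _ ; anc-trans = _ ; le-refl = _ ; le-antisym = λ _ _ _ _ → refl
  ; le-trans = _ ; le-total = λ _ _ → inj₁ tt }

-- M ⊕[ true ] N puts every node of M above all nodes of N in the forest,
-- M ⊕[ false ] N is the disjoint union; in both cases M precedes N.
module _ {Λ E : Set} (b : Bool) (M N : OForest Λ E) where

  ⊕-anc ⊕-le : Node M ⊎ Node N → Node M ⊎ Node N → Bool
  ⊕-anc (inj₁ x) (inj₁ y) = anc M x y
  ⊕-anc (inj₁ x) (inj₂ y) = b
  ⊕-anc (inj₂ x) (inj₁ y) = false
  ⊕-anc (inj₂ x) (inj₂ y) = anc N x y
  ⊕-le (inj₁ x) (inj₁ y) = le M x y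
  ⊕-le (inj₁ x) (inj₂ y) = true
  ⊕-le (inj₂ x) (inj₁ y) = false
  ⊕-le (inj₂ x) (inj₂ y) = le N x y

  ⊕-search : {P : Node M ⊎ Node N → Set} → (∀ x → Dec (P x)) → Dec (Σ[ x ∈ Node M ⊎ Node N ] P x)
  ⊕-search P? = map′
    [ (λ (x , p) → inj₁ x , p) , (λ (x , p) → inj₂ x , p) ]′
    (λ { (inj₁ x , p) → inj₁ (x , p) ; (inj₂ x , p) → inj₂ (x , p) })
    (search M (P? ∘ inj₁) ⊎-dec search N (P? ∘ inj₂))

  ⊕-anc-trans : ∀ x y z → T (⊕-anc x y) → T (⊕-anc y z) → T (⊕-anc x z)
  ⊕-anc-trans (inj₁ x) (inj₁ y) (inj₁ z) p q = anc-trans M x y z p q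
  ⊕-anc-trans (inj₁ x) (inj₁ y) (inj₂ z) p q = q
  ⊕-anc-trans (inj₁ x) (inj₂ y) (inj₂ z) p q = p
  ⊕-anc-trans (inj₂ x) (inj₂ y) (inj₂ z) p q = anc-trans N x y z p q

  ⊕-le-trans : ∀ x y z → T (⊕-le x y) → T (⊕-le y z) → T (⊕-le x z)
  ⊕-le-trans (inj₁ x) (inj₁ y) (inj₁ z) p q = le-trans M x y z p q
  ⊕-le-trans (inj₁ x) y        (inj₂ z) p q = tt
  ⊕-le-trans (inj₂ x) (inj₂ y) (inj₂ z) p q = le-trans N x y z p q

  orderedSum : OForest Λ E
  orderedSum = record
    { Node = Node M ⊎ Node N ; elt = [ elt M , elt N ]′ ; label = [ label M , label N ]′
    ; anc = ⊕-anc ; le = ⊕-le ; search = ⊕-search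
    ; anc-refl = λ { (inj₁ x) → anc-refl M x ; (inj₂ x) → anc-refl N x }
    ; anc-trans = ⊕-anc-trans
    ; le-refl = λ { (inj₁ x) → le-refl M x ; (inj₂ x) → le-refl N x }
    ; le-antisym = λ { (inj₁ x) (inj₁ y) p q → cong inj₁ (le-antisym M x y p q)
                     ; (inj₂ x) (inj₂ y) p q → cong inj₂ (le-antisym N x y p q) }
    ; le-trans = ⊕-le-trans
    ; le-total = λ { (inj₁ x) (inj₁ y) → le-total M x y ; (inj₁ x) (inj₂ y) → inj₁ tt
                   ; (inj₂ x) (inj₁ y) → inj₂ tt ; (inj₂ x) (inj₂ y) → le-total N x y } }

infixr 5 _⊕[_]_

_⊕[_]_ : ∀ {Λ E} → OForest Λ E → Bool → OForest Λ E → OForest Λ E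
M ⊕[ b ] N = orderedSum b M N

-- Sums presented up to isomorphism, so that associativity of ⊕ comes for free.
record IsSum {Λ E : Set} (b : Bool) (M N K : OForest Λ E) : Set where
  field
    inl      : Node M → Node K
    inr      : Node N → Node K
    cover    : ∀ k → (Σ[ x ∈ Node M ] k ≡ inl x) ⊎ (Σ[ y ∈ Node N ] k ≡ inr y)
    label-l  : ∀ x → label K (inl x) ≡ label M x
    label-r  : ∀ y → label K (inr y) ≡ label N y
    anc-ll   : ∀ x y → anc K (inl x) (inl y) ≡ anc M x y
    anc-lr   : ∀ x y → anc K (inl x) (inr y) ≡ b
    anc-rl   : ∀ x y → anc K (inr x) (inl y) ≡ false
    anc-rr   : ∀ x y → anc K (inr x) (inr y) ≡ anc N x y
    le-ll    : ∀ x y → le K (inl x) (inl y) ≡ le M x y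
    le-lr    : ∀ x y → le K (inl x) (inr y) ≡ true
    le-rl    : ∀ x y → le K (inr x) (inl y) ≡ false
    le-rr    : ∀ x y → le K (inr x) (inr y) ≡ le N x y

open IsSum

⊕-isSum : ∀ {Λ E b} (M N : OForest Λ E) → IsSum b M N (M ⊕[ b ] N)
⊕-isSum M N = record
  { inl = inj₁ ; inr = inj₂ ; cover = λ { (inj₁ x) → inj₁ (x , refl) ; (inj₂ y) → inj₂ (y , refl) }
  ; label-l = λ _ → refl ; label-r = λ _ → refl
  ; anc-ll = λ _ _ → refl ; anc-lr = λ _ _ → refl ; anc-rl = λ _ _ → refl ; anc-rr = λ _ _ → refl
  ; le-ll = λ _ _ → refl ; le-lr = λ _ _ → refl ; le-rl = λ _ _ → refl ; le-rr = λ _ _ → refl }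

module _ {Λ E : Set} {X : Set} (p : X → OForest Λ E) where

  ⨁ : List X → OForest Λ E
  ⨁ []       = emptyForest
  ⨁ (x ∷ xs) = p x ⊕[ false ] ⨁ xs

  ⨁-++ : ∀ xs ys → IsSum false (⨁ xs) (⨁ ys) (⨁ (xs ++ ys))
  ⨁-++ [] ys = record
    { inl = λ () ; inr = id ; cover = λ k → inj₂ (k , refl)
    ; label-l = λ () ; label-r = λ _ → refl
    ; anc-ll = λ () ; anc-lr = λ () ; anc-rl = λ _ () ; anc-rr = λ _ _ → refl
    ; le-ll = λ () ; le-lr = λ () ; le-rl = λ _ () ; le-rr = λ _ _ → refl }
  ⨁-++ (x ∷ xs) ys = record
    { inl = [ inj₁ , inj₂ ∘ inl s ]′ ; inr = inj₂ ∘ inr s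
    ; cover = λ { (inj₁ k) → inj₁ (inj₁ k , refl)
                ; (inj₂ k) → [ (λ (y , eq) → inj₁ (inj₂ y , cong inj₂ eq))
                             , (λ (y , eq) → inj₂ (y , cong inj₂ eq)) ]′ (cover s k) }
    ; label-l = λ { (inj₁ _) → refl ; (inj₂ y) → label-l s y }
    ; label-r = label-r s
    ; anc-ll = λ { (inj₁ _) (inj₁ _) → refl ; (inj₁ _) (inj₂ _) → refl
                 ; (inj₂ _) (inj₁ _) → refl ; (inj₂ y) (inj₂ z) → anc-ll s y z }
    ; anc-lr = λ { (inj₁ _) _ → refl ; (inj₂ y) z → anc-lr s y z }
    ; anc-rl = λ { _ (inj₁ _) → refl ; y (inj₂ z) → anc-rl s y z }
    ; anc-rr = anc-rr s
    ; le-ll = λ { (inj₁ _) (inj₁ _) → refl ; (inj₁ _) (inj₂ _) → refl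
                ; (inj₂ _) (inj₁ _) → refl ; (inj₂ y) (inj₂ z) → le-ll s y z }
    ; le-lr = λ { (inj₁ _) _ → refl ; (inj₂ y) z → le-lr s y z }
    ; le-rl = λ { _ (inj₁ _) → refl ; y (inj₂ z) → le-rl s y z }
    ; le-rr = le-rr s }
    where
    s : IsSum false (⨁ xs) (⨁ ys) (⨁ (xs ++ ys))
    s = ⨁-++ xs ys

-- `EF M M′ r P`: Duplicator survives r more rounds from the position P, the
-- list of the pairs chosen so far.
module _ {Λ E E′ : Set} (M : OForest Λ E) (M′ : OForest Λ E′) where

  -- Equality is left out because antisymmetry makes it the conjunction of `le` in both directions.
  Compatible : Node M × Node M′ → Node M × Node M′ → Set
  Compatible (a , a′) (b , b′) =
    label M a ≡ label M′ a′ × anc M a b ≡ anc M′ a′ b′ × le M a b ≡ le M′ a′ b′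

  PartialIso : List (Node M × Node M′) → Set
  PartialIso P = ∀ {p q} → p ∈ P → q ∈ P → Compatible p q

  EF : ℕ → List (Node M × Node M′) → Set
  EF zero    P = PartialIso P
  EF (suc r) P = PartialIso P
    × (∀ a  → Σ[ a′ ∈ Node M′ ] EF r ((a , a′) ∷ P))
    × (∀ a′ → Σ[ a ∈ Node M ] EF r ((a , a′) ∷ P))

  EF⇒PartialIso : ∀ r {P} → EF r P → PartialIso P
  EF⇒PartialIso zero    ef        = ef
  EF⇒PartialIso (suc r) (iso , _) = iso

  EF-pred : ∀ r {P} → EF (suc r) P → EF r P
  EF-pred zero    (iso , _) = iso
  EF-pred (suc r) (iso , forth , back) = iso ,
    (λ a → let a′ , ef = forth a in a′ , EF-pred r ef) ,
    (λ a′ → let a , ef = back a′ in a , EF-pred r ef)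

module _ {Λ E E′ : Set} {M : OForest Λ E} {M′ : OForest Λ E′} where

  EF-sym : ∀ r {P Q} → (∀ {p} → p ∈ Q → swap p ∈ P) → EF M M′ r P → EF M′ M r Q
  EF-sym zero    sub iso p∈ q∈ =
    let l , a , o = iso (sub p∈) (sub q∈) in sym l , sym a , sym o
  EF-sym (suc r) {P} {Q} sub (iso , forth , back) =
    (λ p∈ q∈ → let l , a , o = iso (sub p∈) (sub q∈) in sym l , sym a , sym o) ,
    (λ a′ → let a , ef = back a′ in a , EF-sym r (extend sub) ef) ,
    (λ a → let a′ , ef = forth a in a′ , EF-sym r (extend sub) ef)
    where
    extend : ∀ {P Q a a′} → (∀ {p} → p ∈ Q → swap p ∈ P) →
             ∀ {p} → p ∈ (a′ , a) ∷ Q → swap p ∈ (a , a′) ∷ P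
    extend sub (here refl) = here refl
    extend sub (there p∈)  = there (sub p∈)

module _ {Λ E E′ : Set} {M : OForest Λ E} {M′ : OForest Λ E′} where

  -- Duplicator answers in the summand that Spoiler has chosen and lets the round pass in the other
  -- one. Pairs from different summands are always compatible, as `anc` and `le` are constant
  -- between the summands. The last hypothesis says that the position in the sum is made up of the
  -- positions in the summands.
  EF-sum : ∀ {b} {N K : OForest Λ E} {N′ K′ : OForest Λ E′} →
           (s : IsSum b M N K) (s′ : IsSum b M′ N′ K′) → ∀ r {P Q S} →
           EF M M′ r P → EF N N′ r Q →
           (∀ {k} → k ∈ S → (Σ[ p ∈ Node M × Node M′ ] p ∈ P × k ≡ (inl s (proj₁ p) , inl s′ (proj₂ p)))
                          ⊎ (Σ[ q ∈ Node N × Node N′ ] q ∈ Q × k ≡ (inr s (proj₁ q) , inr s′ (proj₂ q)))) →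
           EF K K′ r S
  EF-sum {b} {N} {K} {N′} {K′} s s′ = go
    where
    Split : List (Node M × Node M′) → List (Node N × Node N′) → List (Node K × Node K′) → Set
    Split P Q S = ∀ {k} → k ∈ S →
        (Σ[ p ∈ Node M × Node M′ ] p ∈ P × k ≡ (inl s (proj₁ p) , inl s′ (proj₂ p)))
      ⊎ (Σ[ q ∈ Node N × Node N′ ] q ∈ Q × k ≡ (inr s (proj₁ q) , inr s′ (proj₂ q)))

    extendˡ : ∀ {P Q S a a′} → Split P Q S → Split ((a , a′) ∷ P) Q ((inl s a , inl s′ a′) ∷ S)
    extendˡ split (here refl) = inj₁ (_ , here refl , refl)
    extendˡ split (there k∈) with split k∈
    ... | inj₁ (p , p∈ , eq) = inj₁ (p , there p∈ , eq)
    ... | inj₂ found         = inj₂ found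

    extendʳ : ∀ {P Q S a a′} → Split P Q S → Split P ((a , a′) ∷ Q) ((inr s a , inr s′ a′) ∷ S)
    extendʳ split (here refl) = inj₂ (_ , here refl , refl)
    extendʳ split (there k∈) with split k∈
    ... | inj₁ found         = inj₁ found
    ... | inj₂ (p , p∈ , eq) = inj₂ (p , there p∈ , eq)

    iso : ∀ {P Q S} → PartialIso M M′ P → PartialIso N N′ Q → Split P Q S → PartialIso K K′ S
    iso isoM isoN split p∈ q∈ with split p∈ | split q∈
    ... | inj₁ ((a , a′) , a∈ , refl) | inj₁ ((c , c′) , c∈ , refl) =
      let l , n , o = isoM a∈ c∈ in
      trans (label-l s a) (trans l (sym (label-l s′ a′))) ,
      trans (anc-ll s a c) (trans n (sym (anc-ll s′ a′ c′))) ,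
      trans (le-ll s a c) (trans o (sym (le-ll s′ a′ c′)))
    ... | inj₁ ((a , a′) , a∈ , refl) | inj₂ ((c , c′) , c∈ , refl) =
      let l , _ = isoM a∈ a∈ in
      trans (label-l s a) (trans l (sym (label-l s′ a′))) ,
      trans (anc-lr s a c) (sym (anc-lr s′ a′ c′)) ,
      trans (le-lr s a c) (sym (le-lr s′ a′ c′))
    ... | inj₂ ((a , a′) , a∈ , refl) | inj₁ ((c , c′) , c∈ , refl) =
      let l , _ = isoN a∈ a∈ in
      trans (label-r s a) (trans l (sym (label-r s′ a′))) ,
      trans (anc-rl s a c) (sym (anc-rl s′ a′ c′)) ,
      trans (le-rl s a c) (sym (le-rl s′ a′ c′))
    ... | inj₂ ((a , a′) , a∈ , refl) | inj₂ ((c , c′) , c∈ , refl) =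
      let l , n , o = isoN a∈ c∈ in
      trans (label-r s a) (trans l (sym (label-r s′ a′))) ,
      trans (anc-rr s a c) (trans n (sym (anc-rr s′ a′ c′))) ,
      trans (le-rr s a c) (trans o (sym (le-rr s′ a′ c′)))

    go : ∀ r {P Q S} → EF M M′ r P → EF N N′ r Q → Split P Q S → EF K K′ r S
    go zero    efM efN split = iso efM efN split
    go (suc r) efM@(isoM , forthM , backM) efN@(isoN , forthN , backN) split =
      iso isoM isoN split , forth , back
      where
      forth : ∀ k → Σ[ k′ ∈ Node K′ ] EF K K′ r ((k , k′) ∷ _)
      forth k with cover s k
      ... | inj₁ (a , refl) = let a′ , ef = forthM a in
        inl s′ a′ , go r ef (EF-pred N N′ r efN) (extendˡ split)
      ... | inj₂ (a , refl) = let a′ , ef = forthN a in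
        inr s′ a′ , go r (EF-pred M M′ r efM) ef (extendʳ split)
      back : ∀ k′ → Σ[ k ∈ Node K ] EF K K′ r ((k , k′) ∷ _)
      back k′ with cover s′ k′
      ... | inj₁ (a′ , refl) = let a , ef = backM a′ in
        inl s a , go r ef (EF-pred N N′ r efN) (extendˡ split)
      ... | inj₂ (a′ , refl) = let a , ef = backN a′ in
        inr s a , go r (EF-pred M M′ r efM) ef (extendʳ split)

EF-empty : ∀ {Λ E E′} r → EF (emptyForest {Λ} {E}) (emptyForest {Λ} {E′}) r []
EF-empty zero    = λ ()
EF-empty (suc r) = (λ ()) , (λ ()) , (λ ())

EF-single : ∀ {Λ E E′ l} {e : E} {e′ : E′} r {P} → EF (singleNode {Λ} l e) (singleNode l e′) r P
EF-single zero    = λ _ _ → refl , refl , refl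
EF-single (suc r) = (λ _ _ → refl , refl , refl) , (λ _ → tt , EF-single r) , (λ _ → tt , EF-single r)

-- Lengths of sequences that r rounds of the game cannot tell apart.
Similar : ℕ → ℕ → ℕ → Set
Similar r m m′ = m ≡ m′ ⊎ (2 ^ r ≤ suc m × 2 ^ r ≤ suc m′)

Similar-sym : ∀ r {m m′} → Similar r m m′ → Similar r m′ m
Similar-sym r (inj₁ eq)      = inj₁ (sym eq)
Similar-sym r (inj₂ (p , q)) = inj₂ (q , p)

private
  large-complement : ∀ r {i j} → 2 ^ suc r ≤ suc i + suc j → suc i ≤ 2 ^ r → 2 ^ r ≤ suc j
  large-complement r {i} {j} big small = +-cancelˡ-≤ (2 ^ r) _ _ (begin
    2 ^ r + 2 ^ r    ≡⟨ cong (2 ^ r +_) (sym (+-identityʳ (2 ^ r))) ⟩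
    2 ^ suc r        ≤⟨ big ⟩
    suc i + suc j    ≤⟨ +-monoˡ-≤ (suc j) small ⟩
    2 ^ r + suc j    ∎)
    where open ≤-Reasoning

  subtract : ∀ {i m} → i < m → Σ[ j ∈ ℕ ] m ≡ i + suc j
  subtract {i} {m} i<m = m ∸ suc i , trans (sym (m+[n∸m]≡n i<m)) (sym (+-suc i (m ∸ suc i)))

  exceeds : ∀ r {a m} → 2 ^ suc r ≤ suc m → a ≤ 2 ^ r → a ≤ m
  exceeds r {a} {m} big a≤ = s≤s⁻¹ (begin
    suc a            ≤⟨ s≤s a≤ ⟩
    1 + 2 ^ r        ≤⟨ +-monoˡ-≤ (2 ^ r) (m^n>0 2 r) ⟩
    2 ^ r + 2 ^ r    ≡⟨ cong (2 ^ r +_) (sym (+-identityʳ (2 ^ r))) ⟩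
    2 ^ suc r        ≤⟨ big ⟩
    suc m            ∎)
    where open ≤-Reasoning

  predecessor : ∀ {n} → 0 < n → Σ[ h ∈ ℕ ] n ≡ suc h
  predecessor {suc h} _ = h , refl

  swap-suc : ∀ j i → j + suc i ≡ i + suc j
  swap-suc j i = trans (+-suc j i) (trans (cong suc (+-comm j i)) (sym (+-suc i j)))

-- Spoiler marks a point with i points before and j after it. If one side has fewer than 2 ^ r
-- points, it is copied exactly, and what remains on the other side is long in both sequences.
Similar-split : ∀ r i j m′ → Similar (suc r) (i + suc j) m′ →
  Σ[ i′ ∈ ℕ ] Σ[ j′ ∈ ℕ ] m′ ≡ i′ + suc j′ × Similar r i i′ × Similar r j j′
Similar-split r i j m′ (inj₁ eq) = i , j , sym eq , inj₁ refl , inj₁ refl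
Similar-split r i j m′ (inj₂ (big , big′)) with suc i ≤? 2 ^ r | suc j ≤? 2 ^ r
... | yes i≤ | _ with j′ , refl ← subtract (exceeds r big′ i≤) =
  i , j′ , refl , inj₁ refl , inj₂ (large-complement r {i} big i≤ , large-complement r {i} big′ i≤)
... | no i≰ | yes j≤ with i′ , refl ← subtract (exceeds r big′ j≤) =
  i′ , j , swap-suc j i′ ,
  inj₂ (large-complement r {j} (subst (2 ^ suc r ≤_) (+-comm (suc i) (suc j)) big) j≤ ,
        large-complement r {j} big′ j≤) ,
  inj₁ refl
... | no i≰ | no j≰ with h , eq ← predecessor (m^n>0 2 r)
  with j′ , refl ← subtract (exceeds r {suc h} big′ (≤-reflexive (sym eq))) =
  -- Both sides are long: h = 2 ^ r - 1, the least length that counts as long, is cut off on the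
  -- left.
  h , j′ , refl , inj₂ (<⇒≤ (≰⇒> i≰) , ≤-reflexive eq) ,
  inj₂ (<⇒≤ (≰⇒> j≰) , large-complement r {h} big′ (≤-reflexive (sym eq)))

module _ {Λ E : Set} {X : Set} (p : X → OForest Λ E) where

  data Located : (xs : List X) → Node (⨁ p xs) → Set where
    located : ∀ xs x ys (a : Node (p x)) → Located (xs ++ x ∷ ys) (inr (⨁-++ p xs (x ∷ ys)) (inj₁ a))

  locate : ∀ xs k → Located xs k
  locate (x ∷ xs) (inj₁ a) = located [] x xs a
  locate (x ∷ xs) (inj₂ k) with locate xs k
  ... | located ys y zs a = located (x ∷ ys) y zs a

split-length : ∀ {X : Set} i {j} (xs : List X) → length xs ≡ i + suc j →
  Σ[ ys ∈ List X ] Σ[ y ∈ X ] Σ[ zs ∈ List X ] xs ≡ ys ++ y ∷ zs × length ys ≡ i × length zs ≡ j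
split-length zero    (x ∷ xs) eq = [] , x , xs , refl , refl , ℕ.suc-injective eq
split-length (suc i) (x ∷ xs) eq with split-length i xs (ℕ.suc-injective eq)
... | ys , y , zs , refl , eq₁ , eq₂ = x ∷ ys , y , zs , refl , cong suc eq₁ , eq₂

-- Spoiler's move splits the list of blocks into those before, the block entered and those after.
-- `Similar-split` finds a block to answer in, and the rest of the game is a sum of three games with
-- r rounds. The induction hypothesis is an argument so that `EF-block` can use the lemma in both
-- directions.
EF-block-forth : ∀ {Λ E E′ X X′ : Set} (p : X → OForest Λ E) (p′ : X′ → OForest Λ E′) r →
  (∀ xs xs′ → Similar r (length xs) (length xs′) →
    (∀ {x x′} → x ∈ xs → x′ ∈ xs′ → EF (p x) (p′ x′) r []) → EF (⨁ p xs) (⨁ p′ xs′) r []) →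
  ∀ xs xs′ → Similar (suc r) (length xs) (length xs′) →
    (∀ {x x′} → x ∈ xs → x′ ∈ xs′ → EF (p x) (p′ x′) (suc r) []) →
  ∀ k → Σ[ k′ ∈ Node (⨁ p′ xs′) ] EF (⨁ p xs) (⨁ p′ xs′) r ((k , k′) ∷ [])
EF-block-forth p p′ r IH xs xs′ sim equiv k with locate p xs k
... | located ys y zs a
  with i , j , eq , simˡ , simʳ ← Similar-split r (length ys) (length zs) (length xs′)
         (subst (λ m → Similar (suc r) m (length xs′)) (length-++ ys) sim)
  with ys′ , y′ , zs′ , refl , refl , refl ← split-length i xs′ eq
  with a′ , ef ← proj₁ (proj₂ (equiv (∈-++⁺ʳ ys (here refl)) (∈-++⁺ʳ ys′ (here refl)))) a =
  inr (⨁-++ p′ ys′ (y′ ∷ zs′)) (inj₁ a′) ,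
  EF-sum (⨁-++ p ys (y ∷ zs)) (⨁-++ p′ ys′ (y′ ∷ zs′)) r {[]} {(inj₁ a , inj₁ a′) ∷ []}
    (IH ys ys′ simˡ (λ x∈ x′∈ → EF-pred _ _ r (equiv (∈-++⁺ˡ x∈) (∈-++⁺ˡ x′∈))))
    (EF-sum (⊕-isSum (p y) (⨁ p zs)) (⊕-isSum (p′ y′) (⨁ p′ zs′)) r {(a , a′) ∷ []} {[]} ef
      (IH zs zs′ simʳ (λ x∈ x′∈ → EF-pred _ _ r (equiv (∈-++⁺ʳ ys (there x∈)) (∈-++⁺ʳ ys′ (there x′∈)))))
      (λ { (here refl) → inj₁ (_ , here refl , refl) }))
    (λ { (here refl) → inj₂ (_ , here refl , refl) })

EF-block : ∀ {Λ E E′ X X′ : Set} (p : X → OForest Λ E) (p′ : X′ → OForest Λ E′) r xs xs′ →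
  Similar r (length xs) (length xs′) →
  (∀ {x x′} → x ∈ xs → x′ ∈ xs′ → EF (p x) (p′ x′) r []) →
  EF (⨁ p xs) (⨁ p′ xs′) r []
EF-block p p′ zero    xs xs′ sim equiv = λ ()
EF-block p p′ (suc r) xs xs′ sim equiv =
  (λ ()) ,
  EF-block-forth p p′ r (EF-block p p′ r) xs xs′ sim equiv ,
  (λ k′ → let k , ef = EF-block-forth p′ p r (EF-block p′ p r) xs′ xs (Similar-sym (suc r) sim)
                         (λ x′∈ x∈ → EF-sym (suc r) (λ ()) (equiv x∈ x′∈)) k′
          in k , EF-sym r (λ { (here refl) → here refl }) ef)

-- Atomic types and first-order logic on ordered forests

funToFin-cong : ∀ {m n} {f g : Fin m → Fin n} → (∀ i → f i ≡ g i) → funToFin f ≡ funToFin g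
funToFin-cong {zero}  eq = refl
funToFin-cong {suc m} eq = cong₂ combine (eq zero) (funToFin-cong (eq ∘ suc))

module _ {X : Set} {m : ℕ} (key : X → Fin m) where

  withKey : Fin m → List X → List X
  withKey κ = filter (λ x → key x ≟ κ)

  groupBy : List X → List X
  groupBy xs = concat (tabulate (λ κ → withKey κ xs))

  length-withKey : ∀ κ xs → length (withKey κ xs) ≡ length (filter (_≟ κ) (map key xs))
  length-withKey κ []       = refl
  length-withKey κ (x ∷ xs) with key x ≟ κ
  ... | yes _ = cong suc (length-withKey κ xs)
  ... | no  _ = length-withKey κ xs

-- The inductive step of `groupBy-↭`: a new element changes only the group of its own key.
concat-tabulate-∷ : ∀ {X : Set} {m} {x : X} (F F′ : Fin m → List X) (κ : Fin m) →
  F′ κ ≡ x ∷ F κ → (∀ i → κ ≢ i → F′ i ≡ F i) → concat (tabulate F′) ↭ x ∷ concat (tabulate F)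
concat-tabulate-∷ F F′ zero eq other = ↭-reflexive
  (cong₂ _++_ eq (cong concat (tabulate-cong (λ i → other (suc i) λ ()))))
concat-tabulate-∷ F F′ (suc κ) eq other = ↭-trans
  (↭-reflexive (cong (_++ concat (tabulate (F′ ∘ suc))) (other zero λ ())))
  (↭-trans (++⁺ˡ (F zero) (concat-tabulate-∷ (F ∘ suc) (F′ ∘ suc) κ eq
                             (λ i κ≢i → other (suc i) (κ≢i ∘ suc-injective))))
           (shift _ (F zero) _))

groupBy-↭ : ∀ {X : Set} {m} (key : X → Fin m) xs → groupBy key xs ↭ xs
groupBy-↭ {m = m} key [] = ↭-reflexive (concat-[] m)
  where
  concat-[] : ∀ {X : Set} m → concat (tabulate {n = m} (λ _ → [] {A = X})) ≡ []
  concat-[] zero    = refl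
  concat-[] (suc m) = concat-[] m
groupBy-↭ key (x ∷ xs) = ↭-trans
  (concat-tabulate-∷ (λ κ → withKey key κ xs) (λ κ → withKey key κ (x ∷ xs)) (key x)
    (filter-accept (λ y → key y ≟ key x) refl)
    (λ i κ≢i → filter-reject (λ y → key y ≟ i) κ≢i))
  (prep x (groupBy-↭ key xs))

multiset : ∀ {m} → (Fin m → ℕ) → List (Fin m)
multiset f = concat (tabulate (λ κ → replicate (f κ) κ))

count-multiset : ∀ {m} (f : Fin m → ℕ) κ → length (filter (_≟ κ) (multiset f)) ≡ f κ
count-multiset f κ = count f id id κ
  where
  replicate-none : ∀ {M} {x y : Fin M} k → x ≢ y → filter (_≟ y) (replicate k x) ≡ []
  replicate-none {y = y} k x≢y = filter-none (_≟ y) (All.replicate⁺ k x≢y)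

  none : ∀ {m M} (f : Fin m → ℕ) (g : Fin m → Fin M) κ → (∀ i → g i ≢ κ) →
         filter (_≟ κ) (concat (tabulate (λ i → replicate (f i) (g i)))) ≡ []
  none {zero}  f g κ ≢κ = refl
  none {suc m} f g κ ≢κ = trans (filter-++ (_≟ κ) (replicate (f zero) (g zero)) _)
    (cong₂ _++_ (replicate-none (f zero) (≢κ zero)) (none (f ∘ suc) (g ∘ suc) κ (≢κ ∘ suc)))

  -- Generalised to an injection `g` into a fixed `Fin M`, since the recursion on m replaces the
  -- identity by shifts.
  count : ∀ {m M} (f : Fin m → ℕ) (g : Fin m → Fin M) → (∀ {i j} → g i ≡ g j → i ≡ j) → ∀ κ →
          length (filter (_≟ g κ) (concat (tabulate (λ i → replicate (f i) (g i))))) ≡ f κ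
  count f g inj zero = begin
    length (filter (_≟ g zero) (replicate (f zero) (g zero) ++ rest))
      ≡⟨ cong length (filter-++ (_≟ g zero) (replicate (f zero) (g zero)) rest) ⟩
    length (filter (_≟ g zero) (replicate (f zero) (g zero)) ++ filter (_≟ g zero) rest)
      ≡⟨ cong length (cong₂ _++_ (filter-all (_≟ g zero) (All.replicate⁺ (f zero) refl))
                                 (none (f ∘ suc) (g ∘ suc) (g zero) (λ i eq → case-suc (inj eq)))) ⟩
    length (replicate (f zero) (g zero) ++ [])
      ≡⟨ cong length (++-identityʳ (replicate (f zero) (g zero))) ⟩
    length (replicate (f zero) (g zero))
      ≡⟨ length-replicate (f zero) ⟩
    f zero ∎
    where
    open ≡-Reasoning
    rest = concat (tabulate (λ i → replicate (f (suc i)) (g (suc i))))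
    case-suc : ∀ {n} {i : Fin n} → suc i ≢ zero
    case-suc ()
  count f g inj (suc κ) = begin
    length (filter (_≟ g (suc κ)) (replicate (f zero) (g zero) ++ rest))
      ≡⟨ cong length (filter-++ (_≟ g (suc κ)) (replicate (f zero) (g zero)) rest) ⟩
    length (filter (_≟ g (suc κ)) (replicate (f zero) (g zero)) ++ filter (_≟ g (suc κ)) rest)
      ≡⟨ cong (λ z → length (z ++ filter (_≟ g (suc κ)) rest)) (replicate-none (f zero) (λ eq → case-zero (inj eq))) ⟩
    length (filter (_≟ g (suc κ)) rest)
      ≡⟨ count (f ∘ suc) (g ∘ suc) (suc-injective ∘ inj) κ ⟩
    f (suc κ) ∎
    where
    open ≡-Reasoning
    rest = concat (tabulate (λ i → replicate (f (suc i)) (g (suc i))))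
    case-zero : ∀ {n} {i : Fin n} → zero ≢ suc i
    case-zero ()

allVecs : ∀ n k → List (Vec (Fin n) k)
allVecs n zero    = [] ∷ []
allVecs n (suc k) = concatMap (λ x → map (x ∷_) (allVecs n k)) (allFin n)

∈-allVecs : ∀ {n k} (xs : Vec (Fin n) k) → xs ∈ allVecs n k
∈-allVecs []       = here refl
∈-allVecs (x ∷ xs) = ∈-concatMap⁺ _ (Any.map (λ { refl → ∈-map⁺ (x ∷_) (∈-allVecs xs) }) (∈-allFin x))

extend : ∀ {A B : Set} {n} {P : List (A × B)} {a b} {ρ : Vec A n} {ρ′ : Vec B n} →
         (∀ i → (Vec.lookup ρ i , Vec.lookup ρ′ i) ∈ P) →
         ∀ i → (Vec.lookup (a ∷ ρ) i , Vec.lookup (b ∷ ρ′) i) ∈ (a , b) ∷ P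
extend ∈P zero    = here refl
extend ∈P (suc i) = there (∈P i)

-- Truncation makes indices total, so that `position` can be computed from two labels without a
-- proof that one node lies above the other.
clamp : ∀ n → ℕ → Fin (suc n)
clamp n       zero    = zero
clamp zero    (suc i) = zero
clamp (suc n) (suc i) = suc (clamp n i)

module _ (σ : Signature) where

  Atom : ℕ → Set
  Atom n = Σ[ R ∈ Symbol σ ] Vec (Fin n) (arity σ R)

  allAtoms : ∀ n → List (Atom n)
  allAtoms n = concatMap (λ R → map (R ,_) (allVecs n (arity σ R))) (allFin (#symbols σ))

  #atoms : ℕ → ℕ
  #atoms n = length (allAtoms n)

  -- Types are coded as numbers: enumeration, decidable equality and the count that bounds the size
  -- of ψ then come with `Fin`.
  AtomicType : ℕ → Set
  AtomicType n = Fin (2 ^ #atoms n)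

module _ {σ : Signature} where

  ∈-allAtoms : ∀ {n} R (xs : Vec (Fin n) (arity σ R)) → (R , xs) ∈ allAtoms σ n
  ∈-allAtoms R xs = ∈-concatMap⁺ _ (Any.map (λ { refl → ∈-map⁺ (R ,_) (∈-allVecs xs) }) (∈-allFin R))

  isTrue : Fin 2 → Bool
  isTrue zero    = false
  isTrue (suc _) = true

  truthValue : Bool → Fin 2
  truthValue b = if b then suc zero else zero

  isTrue-truthValue : ∀ b → isTrue (truthValue b) ≡ b
  isTrue-truthValue false = refl
  isTrue-truthValue true  = refl

  holds : ∀ {n} → AtomicType σ n → (R : Symbol σ) → Vec (Fin n) (arity σ R) → Bool
  holds c R xs = isTrue (finToFun c (index (∈-allAtoms R xs)))

  atomicType : ∀ {n} → ((R : Symbol σ) → Vec (Fin n) (arity σ R) → Bool) → AtomicType σ n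
  atomicType f = funToFin (λ i → truthValue (uncurry f (lookup (allAtoms σ _) i)))

  holds-atomicType : ∀ {n} (f : (R : Symbol σ) → Vec (Fin n) (arity σ R) → Bool) R xs →
                     holds (atomicType f) R xs ≡ f R xs
  holds-atomicType f R xs = begin
    isTrue (finToFun (atomicType f) i)                       ≡⟨ cong isTrue (finToFun-funToFin _ i) ⟩
    isTrue (truthValue (uncurry f (lookup (allAtoms σ _) i))) ≡⟨ isTrue-truthValue _ ⟩
    uncurry f (lookup (allAtoms σ _) i)                       ≡⟨ cong (uncurry f) (sym (lookup-index (∈-allAtoms R xs))) ⟩
    f R xs                                                    ∎
    where
    open ≡-Reasoning
    i = index (∈-allAtoms R xs)

  -- The label of a node: the number n of its proper ancestors, and the atomic
  -- type of the n + 1 elements on its branch, the node itself coming first.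
  Label : Set
  Label = Σ[ n ∈ ℕ ] AtomicType σ (suc n)

  -- Branches are listed bottom up, so an ancestor at depth m has index n - m on the branch of a
  -- node at depth n.
  position : (x y : Label) → Fin (suc (proj₁ y))
  position (m , _) (n , _) = clamp n (n ∸ m)

  module _ {E : Set} (c₀ : AtomicType σ 0) (M : OForest Label E) where

    -- A tuple satisfies R iff it lies on the branch of one of its entries, whose
    -- label says so. The first alternative takes care of nullary symbols.
    Holds : (R : Symbol σ) → Vec (Node M) (arity σ R) → Set
    Holds R xs =
        (Σ[ v ∈ Vec (Fin 0) (arity σ R) ] T (holds c₀ R v))
      ⊎ (Σ[ i ∈ Fin (arity σ R) ]
           (∀ j → T (anc M (Vec.lookup xs j) (Vec.lookup xs i)))
         × T (holds (proj₂ (label M (Vec.lookup xs i))) R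
               (Vec.map (λ x → position (label M x) (label M (Vec.lookup xs i))) xs)))

    infix 4 _⊩_

    _⊩_ : ∀ {n} → Vec (Node M) n → Formula (σ ∪≤) n → Set
    ρ ⊩ x ≐ y                 = Vec.lookup ρ x ≡ Vec.lookup ρ y
    ρ ⊩ rel zero (x ∷ y ∷ []) = T (le M (Vec.lookup ρ x) (Vec.lookup ρ y))
    ρ ⊩ rel (suc R) xs        = Holds R (Vec.map (Vec.lookup ρ) xs)
    ρ ⊩ ¬′ φ                  = ¬ (ρ ⊩ φ)
    ρ ⊩ φ ∧′ ψ                = (ρ ⊩ φ) × (ρ ⊩ ψ)
    ρ ⊩ φ ∨′ ψ                = (ρ ⊩ φ) ⊎ (ρ ⊩ ψ)
    ρ ⊩ ∃′ φ                  = Σ[ a ∈ Node M ] (a ∷ ρ ⊩ φ)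
    ρ ⊩ ∀′ φ                  = ∀ a → a ∷ ρ ⊩ φ

    node-≟ : (x y : Node M) → Dec (x ≡ y)
    node-≟ x y = map′ (λ (p , q) → le-antisym M x y p q) (λ { refl → le-refl M x , le-refl M x })
                   (T? (le M x y) ×-dec T? (le M y x))

    nullary? : ∀ k (f : Vec (Fin 0) k → Bool) → Dec (Σ[ v ∈ Vec (Fin 0) k ] T (f v))
    nullary? zero    f = map′ ([] ,_) (λ { ([] , t) → t }) (T? (f []))
    nullary? (suc k) f = no λ { (() ∷ _ , _) }

    ⊩? : ∀ {n} (ρ : Vec (Node M) n) φ → Dec (ρ ⊩ φ)
    ⊩? ρ (x ≐ y)                 = node-≟ _ _
    ⊩? ρ (rel zero (x ∷ y ∷ [])) = T? _
    ⊩? ρ (rel (suc R) xs)        =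
      nullary? (arity σ R) (holds c₀ R) ⊎-dec any? (λ i → all? (λ j → T? _) ×-dec T? _)
    ⊩? ρ (¬′ φ)                  = ¬? (⊩? ρ φ)
    ⊩? ρ (φ ∧′ ψ)                = ⊩? ρ φ ×-dec ⊩? ρ ψ
    ⊩? ρ (φ ∨′ ψ)                = ⊩? ρ φ ⊎-dec ⊩? ρ ψ
    ⊩? ρ (∃′ φ)                  = search M (λ a → ⊩? (a ∷ ρ) φ)
    ⊩? ρ (∀′ φ) with search M (λ a → ¬? (⊩? (a ∷ ρ) φ))
    ... | yes (a , ¬φ) = no λ ∀φ → ¬φ (∀φ a)
    ... | no  ∄        = yes λ a → decidable-stable (⊩? (a ∷ ρ) φ) (λ ¬φ → ∄ (a , ¬φ))

  module _ {E E′ : Set} (c₀ : AtomicType σ 0) (M : OForest Label E) (M′ : OForest Label E′) where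

    Holds-transfer : ∀ {P} → PartialIso M M′ P → ∀ R
      (xs : Vec (Node M) (arity σ R)) (xs′ : Vec (Node M′) (arity σ R)) →
      (∀ i → (Vec.lookup xs i , Vec.lookup xs′ i) ∈ P) → Holds c₀ M R xs → Holds c₀ M′ R xs′
    Holds-transfer iso R xs xs′ ∈P (inj₁ nullary)       = inj₁ nullary
    Holds-transfer iso R xs xs′ ∈P (inj₂ (i , ⊑i , Ri)) = inj₂ (i ,
      (λ j → subst T (proj₁ (proj₂ (iso (∈P j) (∈P i)))) (⊑i j)) ,
      subst T (same-label (proj₁ (iso (∈P i) (∈P i)))) Ri)
      where
      positions : ∀ {k} (l : Label) (ys : Vec (Node M) k) (ys′ : Vec (Node M′) k) →
        (∀ j → label M (Vec.lookup ys j) ≡ label M′ (Vec.lookup ys′ j)) →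
        Vec.map (λ x → position (label M x) l) ys ≡ Vec.map (λ x → position (label M′ x) l) ys′
      positions l []       []         eq = refl
      positions l (y ∷ ys) (y′ ∷ ys′) eq =
        cong₂ _∷_ (cong (λ z → position z l) (eq zero)) (positions l ys ys′ (eq ∘ suc))
      same-label : ∀ {l l′} → l ≡ l′ →
        holds (proj₂ l) R (Vec.map (λ x → position (label M x) l) xs) ≡
        holds (proj₂ l′) R (Vec.map (λ x → position (label M′ x) l′) xs′)
      same-label {l} refl = cong (holds (proj₂ l) R)
        (positions l xs xs′ (λ j → proj₁ (iso (∈P j) (∈P j))))

  module _ {E E′ : Set} (c₀ : AtomicType σ 0) {M : OForest Label E} {M′ : OForest Label E′} where

    EF⇒⊩ : ∀ r {n P} (ρ : Vec (Node M) n) (ρ′ : Vec (Node M′) n) → EF M M′ r P →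
           (∀ i → (Vec.lookup ρ i , Vec.lookup ρ′ i) ∈ P) →
           ∀ φ → qr φ ≤ r → _⊩_ c₀ M ρ φ ⇔ _⊩_ c₀ M′ ρ′ φ
    EF⇒⊩ r ρ ρ′ ef ∈P (x ≐ y) _ = mk⇔
      (λ x≡y → equal M′ (trans (sym le-xy) (le-≡ M x≡y)) (trans (sym le-yx) (le-≡ M (sym x≡y))))
      (λ x≡y → equal M (trans le-xy (le-≡ M′ x≡y)) (trans le-yx (le-≡ M′ (sym x≡y))))
      where
      iso : PartialIso M M′ _
      iso = EF⇒PartialIso M M′ r ef
      le-xy = proj₂ (proj₂ (iso (∈P x) (∈P y)))
      le-yx = proj₂ (proj₂ (iso (∈P y) (∈P x)))
      equal : ∀ {F} (K : OForest Label F) {a b} → le K a b ≡ true → le K b a ≡ true → a ≡ b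
      equal K p q = le-antisym K _ _ (subst T (sym p) tt) (subst T (sym q) tt)
      le-≡ : ∀ {F} (K : OForest Label F) {a b} → a ≡ b → le K a b ≡ true
      le-≡ K {a} refl = Equivalence.to T-≡ (le-refl K a)
    EF⇒⊩ r ρ ρ′ ef ∈P (rel zero (x ∷ y ∷ [])) _ = mk⇔ (subst T eq) (subst T (sym eq))
      where
      eq = proj₂ (proj₂ (EF⇒PartialIso M M′ r ef (∈P x) (∈P y)))
    EF⇒⊩ r {P = P} ρ ρ′ ef ∈P (rel (suc R) xs) _ = mk⇔
      (Holds-transfer c₀ M M′ iso R _ _ (λ i → subst (_∈ P) (sym (lookups i)) (∈P (Vec.lookup xs i))))
      (Holds-transfer c₀ M′ M {P = map swap P} (EF-sym {M = M} {M′} 0 {P} swap∈ iso) R _ _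
        (λ i → ∈-map⁺ swap (subst (_∈ P) (sym (lookups i)) (∈P (Vec.lookup xs i)))))
      where
      iso : PartialIso M M′ P
      iso = EF⇒PartialIso M M′ r ef
      lookups : ∀ i → (Vec.lookup (Vec.map (Vec.lookup ρ) xs) i , Vec.lookup (Vec.map (Vec.lookup ρ′) xs) i)
                    ≡ (Vec.lookup ρ (Vec.lookup xs i) , Vec.lookup ρ′ (Vec.lookup xs i))
      lookups i = cong₂ _,_ (Vec.lookup-map i (Vec.lookup ρ) xs) (Vec.lookup-map i (Vec.lookup ρ′) xs)
      swap∈ : ∀ {p} → p ∈ map swap P → swap p ∈ P
      swap∈ p∈ with _ , q∈ , refl ← ∈-map⁻ swap p∈ = q∈
    EF⇒⊩ r ρ ρ′ ef ∈P (¬′ φ) q≤r = mk⇔ (_∘ from) (_∘ to)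
      where open Equivalence (EF⇒⊩ r ρ ρ′ ef ∈P φ q≤r)
    EF⇒⊩ r ρ ρ′ ef ∈P (φ ∧′ ψ) q≤r =
      EF⇒⊩ r ρ ρ′ ef ∈P φ (m⊔n≤o⇒m≤o _ _ q≤r) ×-⇔ EF⇒⊩ r ρ ρ′ ef ∈P ψ (m⊔n≤o⇒n≤o (qr φ) _ q≤r)
    EF⇒⊩ r ρ ρ′ ef ∈P (φ ∨′ ψ) q≤r =
      EF⇒⊩ r ρ ρ′ ef ∈P φ (m⊔n≤o⇒m≤o _ _ q≤r) ⊎-⇔ EF⇒⊩ r ρ ρ′ ef ∈P ψ (m⊔n≤o⇒n≤o (qr φ) _ q≤r)
    EF⇒⊩ (suc r) ρ ρ′ (_ , forth , back) ∈P (∃′ φ) (s≤s q≤r) = mk⇔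
      (λ (a , t) → let a′ , ef = forth a in a′ , Equivalence.to (EF⇒⊩ r _ _ ef (extend ∈P) φ q≤r) t)
      (λ (a′ , t) → let a , ef = back a′ in a , Equivalence.from (EF⇒⊩ r _ _ ef (extend ∈P) φ q≤r) t)
    EF⇒⊩ (suc r) ρ ρ′ (_ , forth , back) ∈P (∀′ φ) (s≤s q≤r) = mk⇔
      (λ t a′ → let a , ef = back a′ in Equivalence.to (EF⇒⊩ r _ _ ef (extend ∈P) φ q≤r) (t a))
      (λ t a → let a′ , ef = forth a in Equivalence.from (EF⇒⊩ r _ _ ef (extend ∈P) φ q≤r) (t a′))

-- Types of trees

-- Trees of height at most k whose roots have n ancestors outside.
data Tree (σ : Signature) (E : Set) : ℕ → ℕ → Set where
  node : ∀ {n k} → E → AtomicType σ (suc n) → List (Tree σ E (suc n) k) → Tree σ E n (suc k)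

module _ (σ : Signature) (N : ℕ) where

  -- An atomic type of the branch and, for each type of a child, a count between 0 and N. As there
  -- are no trees of height 0, the value for height 1 is independent of N.
  #trees : ℕ → ℕ → ℕ
  #trees n zero    = 0
  #trees n (suc k) = 2 ^ #atoms σ (suc n) * suc N ^ #trees (suc n) k

  TreeType : ℕ → ℕ → Set
  TreeType n k = Fin (#trees n k)

  ForestType : ℕ → ℕ → Set
  ForestType n k = TreeType n k → Fin (suc N)

  rootType : ∀ n k → TreeType n (suc k) → AtomicType σ (suc n)
  rootType n k τ = quotient (suc N ^ #trees (suc n) k) τ

  childrenType : ∀ n k → TreeType n (suc k) → ForestType (suc n) k
  childrenType n k τ = finToFun (remainder {2 ^ #atoms σ (suc n)} (suc N ^ #trees (suc n) k) τ)

  mkType : ∀ n k → AtomicType σ (suc n) → ForestType (suc n) k → TreeType n (suc k)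
  mkType n k c f = combine c (funToFin f)

  mkType-surjective : ∀ n k (τ : TreeType n (suc k)) → mkType n k (rootType n k τ) (childrenType n k τ) ≡ τ
  mkType-surjective n k τ = trans
    (cong (combine (rootType n k τ)) (funToFin-finToFin {#trees (suc n) k} _))
    (combine-remQuot {2 ^ #atoms σ (suc n)} (suc N ^ #trees (suc n) k) τ)

  mkType-injective : ∀ n k {c c′} {f f′ : ForestType (suc n) k} → mkType n k c f ≡ mkType n k c′ f′ →
                     c ≡ c′ × (∀ κ → f κ ≡ f′ κ)
  mkType-injective n k {c} {c′} {f} {f′} eq with combine-injective c (funToFin f) c′ (funToFin f′) eq
  ... | refl , eq′ = refl , λ κ →
    trans (sym (finToFun-funToFin f κ)) (trans (cong (λ z → finToFun z κ) eq′) (finToFun-funToFin f′ κ))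

  mkType-cong : ∀ n k {c} {f f′ : ForestType (suc n) k} → (∀ κ → f κ ≡ f′ κ) → mkType n k c f ≡ mkType n k c f′
  mkType-cong n k {c} eq = cong (combine c) (funToFin-cong eq)

  cut : ℕ → Fin (suc N)
  cut m = fromℕ< (s≤s (m⊓n≤n m N))

  toℕ-cut : ∀ m → toℕ (cut m) ≡ m ⊓ N
  toℕ-cut m = toℕ-fromℕ< (s≤s (m⊓n≤n m N))

  cut-toℕ : ∀ f → cut (toℕ f) ≡ f
  cut-toℕ f = toℕ-injective (trans (toℕ-cut (toℕ f)) (m≤n⇒m⊓n≡m (toℕ≤pred[n] f)))

  cut⇒Similar : ∀ r → 2 ^ r ≤ N → ∀ {m m′} → cut m ≡ cut m′ → Similar r m m′
  cut⇒Similar r 2^r≤N {m} {m′} eq with ≤-total m N | ≤-total m′ N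
    | trans (sym (toℕ-cut m)) (trans (cong toℕ eq) (toℕ-cut m′))
  ... | inj₁ m≤N | inj₁ m′≤N | eq′ = inj₁ (trans (sym (m≤n⇒m⊓n≡m m≤N)) (trans eq′ (m≤n⇒m⊓n≡m m′≤N)))
  ... | inj₁ m≤N | inj₂ N≤m′ | eq′
    with refl ← trans (sym (m≤n⇒m⊓n≡m m≤N)) (trans eq′ (m≥n⇒m⊓n≡n N≤m′)) =
    inj₂ (≤-trans 2^r≤N (n≤1+n N) , ≤-trans 2^r≤N (≤-trans N≤m′ (n≤1+n m′)))
  ... | inj₂ N≤m | inj₁ m′≤N | eq′
    with refl ← trans (sym (m≥n⇒m⊓n≡n N≤m)) (trans eq′ (m≤n⇒m⊓n≡m m′≤N)) =
    inj₂ (≤-trans 2^r≤N (≤-trans N≤m (n≤1+n m)) , ≤-trans 2^r≤N (n≤1+n N))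
  ... | inj₂ N≤m | inj₂ N≤m′ | eq′ =
    inj₂ (≤-trans 2^r≤N (≤-trans N≤m (n≤1+n m)) , ≤-trans 2^r≤N (≤-trans N≤m′ (n≤1+n m′)))

  module _ {E : Set} where

    mutual
      treeType : ∀ n k → Tree σ E n k → TreeType n k
      treeType n (suc k) (node e c ts) = mkType n k c (forestType (suc n) k ts)

      forestType : ∀ n k → List (Tree σ E n k) → ForestType n k
      forestType n k ts τ = cut (length (withKey (treeType n k) τ ts))

    treeForest : ∀ n k → Tree σ E n k → OForest (Label {σ}) E
    treeForest n (suc k) (node e c ts) =
      singleNode (n , c) e ⊕[ true ] ⨁ (treeForest (suc n) k) (groupBy (treeType (suc n) k) ts)

    -- Order-invariance allows the trees to be sorted by type: equal types then form blocks.
    forest : ∀ n k → List (Tree σ E n k) → OForest (Label {σ}) E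
    forest n k ts = ⨁ (treeForest n k) (groupBy (treeType n k) ts)

  module _ {E E′ : Set} (r : ℕ) (2^r≤N : 2 ^ r ≤ N) where

    ⨁-concat-EF : ∀ {Λ X X′ : Set} (p : X → OForest Λ E) (p′ : X′ → OForest Λ E′) {m}
      (F : Fin m → List X) (F′ : Fin m → List X′) →
      (∀ i → EF (⨁ p (F i)) (⨁ p′ (F′ i)) r []) →
      EF (⨁ p (concat (tabulate F))) (⨁ p′ (concat (tabulate F′))) r []
    ⨁-concat-EF p p′ {zero}  F F′ ef = EF-empty r
    ⨁-concat-EF p p′ {suc m} F F′ ef =
      EF-sum (⨁-++ p (F zero) _) (⨁-++ p′ (F′ zero) _) r
        (ef zero) (⨁-concat-EF p p′ (F ∘ suc) (F′ ∘ suc) (ef ∘ suc)) λ ()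

    mutual
      treeForest-EF : ∀ n k (t : Tree σ E n k) (t′ : Tree σ E′ n k) → treeType n k t ≡ treeType n k t′ →
                      EF (treeForest n k t) (treeForest n k t′) r []
      treeForest-EF n (suc k) (node e c ts) (node e′ c′ ts′) eq with mkType-injective n k {c} {c′} eq
      ... | refl , eq′ = EF-sum (⊕-isSum (singleNode (n , c) e) (forest (suc n) k ts))
                              (⊕-isSum (singleNode (n , c) e′) (forest (suc n) k ts′)) r {[]} {[]}
              (EF-single r) (forest-EF (suc n) k ts ts′ eq′) λ ()

      -- After sorting, both forests are ordered sums with one block for each type. Inside a block
      -- all trees are equivalent by induction on the height, and equal truncated counts make the
      -- two blocks similar in length.
      forest-EF : ∀ n k (ts : List (Tree σ E n k)) (ts′ : List (Tree σ E′ n k)) →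
                  (∀ τ → forestType n k ts τ ≡ forestType n k ts′ τ) → EF (forest n k ts) (forest n k ts′) r []
      forest-EF n k ts ts′ eq =
        ⨁-concat-EF (treeForest n k) (treeForest n k) (λ τ → withKey (treeType n k) τ ts) (λ τ → withKey (treeType n k) τ ts′)
          λ τ → EF-block (treeForest n k) (treeForest n k) r _ _ (cut⇒Similar r 2^r≤N (eq τ))
            λ t∈ t′∈ → treeForest-EF n k _ _
              (trans (proj₂ (∈-filter⁻ (λ t → treeType n k t ≟ τ) {xs = ts} t∈))
                     (sym (proj₂ (∈-filter⁻ (λ t → treeType n k t ≟ τ) {xs = ts′} t′∈))))

  typeList : ∀ n k → ForestType n k → List (TreeType n k)
  typeList n k f = multiset (toℕ ∘ f)

  mutual
    canonicalTree : ∀ n k → TreeType n k → Tree σ Unit n k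
    canonicalTree n (suc k) τ = node tt (rootType n k τ) (canonicalForest (suc n) k (childrenType n k τ))

    canonicalForest : ∀ n k → ForestType n k → List (Tree σ Unit n k)
    canonicalForest n k f = map (canonicalTree n k) (typeList n k f)

  forestType-typeList : ∀ {E} n k (f : ForestType n k) (ts : List (Tree σ E n k)) →
    map (treeType n k) ts ≡ typeList n k f → ∀ τ → forestType n k ts τ ≡ f τ
  forestType-typeList n k f ts eq τ = trans
    (cong cut (trans (length-withKey (treeType n k) τ ts)
                (trans (cong (length ∘ filter (_≟ τ)) eq) (count-multiset (toℕ ∘ f) τ))))
    (cut-toℕ (f τ))

  mutual
    canonicalTree-type : ∀ n k τ → treeType n k (canonicalTree n k τ) ≡ τ
    canonicalTree-type n (suc k) τ = trans
      (mkType-cong n k (canonicalForest-type (suc n) k (childrenType n k τ)))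
      (mkType-surjective n k τ)

    canonicalForest-type : ∀ n k (f : ForestType n k) τ → forestType n k (canonicalForest n k f) τ ≡ f τ
    canonicalForest-type n k f = forestType-typeList n k f (canonicalForest n k f)
      (trans (sym (map-∘ (typeList n k f))) (trans (map-cong (canonicalTree-type n k) (typeList n k f)) (map-id _)))

-- Walks and tree-depth

x∉p-x : ∀ {n} (p : Subset n) x → ¬ (x ∈ˢ p -ˢ x)
x∉p-x (inside  ∷ p) zero    ()
x∉p-x (outside ∷ p) zero    ()
x∉p-x (s ∷ p)       (suc x) (there x∈) = x∉p-x p x x∈

-- A walk through the root consists of two walks one level down, each with one more edge to the
-- root. The closed form is 2 ^ (d + 1) - 2.
walkBound : ℕ → ℕ
walkBound zero    = 0
walkBound (suc d) = suc (walkBound d) + suc (walkBound d)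

module _ {n : ℕ} (G : Graph n) where

  data Walk (S : Fin n → Set) : Fin n → Fin n → Set where
    here : ∀ {x} → S x → Walk S x x
    step : ∀ {x y z} → S x → Edge G x y → Walk S y z → Walk S x z

  module _ {S : Fin n → Set} where

    Walk-start : ∀ {x y} → Walk S x y → S x
    Walk-start (here Sx)     = Sx
    Walk-start (step Sx _ _) = Sx

    Walk-end : ∀ {x y} → Walk S x y → S y
    Walk-end (here Sx)    = Sx
    Walk-end (step _ _ w) = Walk-end w

    Walk-trans : ∀ {x y z} → Walk S x y → Walk S y z → Walk S x z
    Walk-trans (here _)      v = v
    Walk-trans (step Sx e w) v = step Sx e (Walk-trans w v)

    Walk-edge : ∀ {x y} → S x → Edge G x y → S y → Walk S x y
    Walk-edge Sx e Sy = step Sx e (here Sy)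

    Walk-sym : ∀ {x y} → Walk S x y → Walk S y x
    Walk-sym (here Sx)     = here Sx
    Walk-sym (step Sx e w) = Walk-trans (Walk-sym w) (Walk-edge (Walk-start w) (edge-sym G e) Sx)

  Walk-map : ∀ {S S′ : Fin n → Set} → (∀ {y} → S y → S′ y) → ∀ {x y} → Walk S x y → Walk S′ x y
  Walk-map S⊆S′ (here Sx)     = here (S⊆S′ Sx)
  Walk-map S⊆S′ (step Sx e w) = step (S⊆S′ Sx) e (Walk-map S⊆S′ w)

  -- A walk visits only vertices that its own initial segments reach from the start, so `S′` has to
  -- contain just the part of `S` reachable from `x`.
  Walk-restrict : ∀ {S S′ : Fin n → Set} {x y} → (∀ {z} → Walk S x z → S′ z) → Walk S x y → Walk S′ x y
  Walk-restrict reach (here Sx)     = here (reach (here Sx))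
  Walk-restrict reach (step Sx e w) =
    step (reach (here Sx)) e (Walk-restrict (λ v → reach (step Sx e v)) w)

  Star⇒Walk : ∀ {S x y} → x ∈ˢ S → Star (EdgeIn G S) x y → Walk (_∈ˢ S) x y
  Star⇒Walk x∈ ε                  = here x∈
  Star⇒Walk x∈ ((_ , y∈ , e) ◅ w) = step x∈ e (Star⇒Walk y∈ w)

  Walk⇒Star : ∀ {S x y} → Walk (_∈ˢ S) x y → Star (EdgeIn G S) x y
  Walk⇒Star (here _)      = ε
  Walk⇒Star (step x∈ e w) = (x∈ , Walk-start w , e) ◅ Walk⇒Star w

  -- A step may stand still, so that exactly ℓ steps account for every length up to ℓ. This is the
  -- recursion that `connF` follows.
  Walk≤ : (Fin n → Set) → ℕ → Fin n → Fin n → Set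
  Walk≤ S zero    x y = S x × x ≡ y
  Walk≤ S (suc ℓ) x y = S x × Σ[ z ∈ Fin n ] (x ≡ z ⊎ Edge G x z) × Walk≤ S ℓ z y

  module _ {S : Fin n → Set} where

    Walk≤⇒Walk : ∀ ℓ {x y} → Walk≤ S ℓ x y → Walk S x y
    Walk≤⇒Walk zero    (Sx , refl)            = here Sx
    Walk≤⇒Walk (suc ℓ) (Sx , _ , inj₁ refl , w) = Walk≤⇒Walk ℓ w
    Walk≤⇒Walk (suc ℓ) (Sx , _ , inj₂ e , w)    = step Sx e (Walk≤⇒Walk ℓ w)

    Walk≤-start : ∀ ℓ {x y} → Walk≤ S ℓ x y → S x
    Walk≤-start zero    (Sx , _) = Sx
    Walk≤-start (suc ℓ) (Sx , _) = Sx

    Walk≤-refl : ∀ ℓ {x} → S x → Walk≤ S ℓ x x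
    Walk≤-refl zero    Sx = Sx , refl
    Walk≤-refl (suc ℓ) Sx = Sx , _ , inj₁ refl , Walk≤-refl ℓ Sx

    Walk≤-trans : ∀ ℓ m {x y z} → Walk≤ S ℓ x y → Walk≤ S m y z → Walk≤ S (ℓ + m) x z
    Walk≤-trans zero    m (_ , refl)       v = v
    Walk≤-trans (suc ℓ) m (Sx , _ , e , w) v = Sx , _ , e , Walk≤-trans ℓ m w v

    Walk≤-suc : ∀ ℓ {x y} → Walk≤ S ℓ x y → Walk≤ S (suc ℓ) x y
    Walk≤-suc ℓ w = Walk≤-start ℓ w , _ , inj₁ refl , w

    Walk≤-snoc : ∀ ℓ {x y z} → Walk≤ S ℓ x y → y ≡ z ⊎ Edge G y z → S z → Walk≤ S (suc ℓ) x z
    Walk≤-snoc zero    (Sx , refl)      e Sz = Sx , _ , e , Sz , refl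
    Walk≤-snoc (suc ℓ) (Sx , _ , e′ , w) e Sz = Sx , _ , e′ , Walk≤-snoc ℓ w e Sz

    Walk≤-sym : ∀ ℓ {x y} → Walk≤ S ℓ x y → Walk≤ S ℓ y x
    Walk≤-sym zero    (Sx , refl)           = Sx , refl
    Walk≤-sym (suc ℓ) (Sx , _ , inj₁ refl , w) = Walk≤-suc ℓ (Walk≤-sym ℓ w)
    Walk≤-sym (suc ℓ) (Sx , _ , inj₂ e , w)    = Walk≤-snoc ℓ (Walk≤-sym ℓ w) (inj₂ (edge-sym G e)) Sx

  Walk≤-map : ∀ {S S′ : Fin n → Set} → (∀ {y} → S y → S′ y) → ∀ ℓ {x y} → Walk≤ S ℓ x y → Walk≤ S′ ℓ x y
  Walk≤-map S⊆S′ zero    (Sx , eq)        = S⊆S′ Sx , eq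
  Walk≤-map S⊆S′ (suc ℓ) (Sx , _ , e , w) = S⊆S′ Sx , _ , e , Walk≤-map S⊆S′ ℓ w

  -- Tree-depth at most d, where S may be empty or disconnected.
  HasDepth : (Fin n → Set) → ℕ → Set
  HasDepth S zero    = ∀ x → ¬ S x
  HasDepth S (suc d) = ∀ x → S x → Σ[ r ∈ Fin n ] Walk S x r × HasDepth (λ y → Walk S x y × y ≢ r) d

  HasDepth-resp : ∀ d {S S′} → (∀ {x} → S x → S′ x) → (∀ {x} → S′ x → S x) → HasDepth S d → HasDepth S′ d
  HasDepth-resp zero    S⊆S′ S′⊆S h x S′x = h x (S′⊆S S′x)
  HasDepth-resp (suc d) S⊆S′ S′⊆S h x S′x with h x (S′⊆S S′x)
  ... | r , w , h′ = r , Walk-map S⊆S′ w ,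
    HasDepth-resp d (λ (v , y≢r) → Walk-map S⊆S′ v , y≢r) (λ (v , y≢r) → Walk-map S′⊆S v , y≢r) h′

  -- A walk either avoids the root r of its component, or can be cut at its
  -- first and last visit to r; the pieces avoid r.
  HasDepth⇒short : ∀ d {S S′ : Fin n → Set} → HasDepth S d → (∀ {y} → S′ y → S y) →
                   ∀ {x y} → Walk S′ x y → Walk≤ S′ (walkBound d) x y
  HasDepth⇒short zero    h S′⊆S w = ⊥-elim (h _ (S′⊆S (Walk-start w)))
  HasDepth⇒short (suc d) {S} {S′} h S′⊆S {x} {y} w with h x (S′⊆S (Walk-start w))
  ... | r , _ , h′ = conclude (toRoot w) (toRoot (Walk-sym w))
    where
    Avoid : Fin n → Set
    Avoid y = S′ y × y ≢ r

    toRoot : ∀ {y z} → Walk S′ y z → Walk Avoid y z ⊎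
             (y ≡ r ⊎ (Σ[ v ∈ Fin n ] Walk Avoid y v × Edge G v r)) × S′ r
    toRoot {y} (here S′y) with y ≟ r
    ... | yes refl = inj₂ (inj₁ refl , S′y)
    ... | no  y≢r  = inj₁ (here (S′y , y≢r))
    toRoot {y} (step S′y e w) with y ≟ r
    ... | yes refl = inj₂ (inj₁ refl , S′y)
    ... | no  y≢r with toRoot w
    ...   | inj₁ v                             = inj₁ (step (S′y , y≢r) e v)
    ...   | inj₂ (inj₁ refl , S′r)             = inj₂ (inj₂ (y , here (S′y , y≢r) , e) , S′r)
    ...   | inj₂ (inj₂ (v , w′ , e′) , S′r)    = inj₂ (inj₂ (v , step (S′y , y≢r) e w′ , e′) , S′r)

    short : ∀ {y z} → Walk S x y → Walk Avoid y z → Walk≤ S′ (walkBound d) y z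
    short w v = Walk≤-map (proj₁ ∘ proj₁) (walkBound d)
      (HasDepth⇒short d h′ proj₂
        (Walk-restrict {S′ = λ z → Avoid z × Walk S x z × z ≢ r} (λ v′ → Walk-end v′ ,
          Walk-trans w (Walk-map (S′⊆S ∘ proj₁) v′) , proj₂ (Walk-end v′)) v))

    shortToRoot : ∀ {y} → Walk S x y →
      (y ≡ r ⊎ (Σ[ v ∈ Fin n ] Walk Avoid y v × Edge G v r)) × S′ r → Walk≤ S′ (suc (walkBound d)) y r
    shortToRoot w (inj₁ refl , S′r)          = Walk≤-refl (suc (walkBound d)) S′r
    shortToRoot w (inj₂ (v , w′ , e) , S′r) = Walk≤-snoc (walkBound d) (short w w′) (inj₂ e) S′r

    wS : Walk S x y
    wS = Walk-map S′⊆S w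

    pad : ∀ {x y} → Walk≤ S′ (walkBound d) x y → Walk≤ S′ (walkBound (suc d)) x y
    pad u = Walk≤-trans (suc (walkBound d)) (suc (walkBound d)) (Walk≤-suc (walkBound d) u)
              (Walk≤-refl (suc (walkBound d)) (Walk-end (Walk≤⇒Walk (walkBound d) u)))

    conclude : Walk Avoid x y ⊎ (x ≡ r ⊎ (Σ[ v ∈ Fin n ] Walk Avoid x v × Edge G v r)) × S′ r →
               Walk Avoid y x ⊎ (y ≡ r ⊎ (Σ[ v ∈ Fin n ] Walk Avoid y v × Edge G v r)) × S′ r →
               Walk≤ S′ (walkBound (suc d)) x y
    conclude (inj₂ to) (inj₂ from) =
      Walk≤-trans (suc (walkBound d)) (suc (walkBound d)) (shortToRoot (here (Walk-start wS)) to)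
        (Walk≤-sym (suc (walkBound d)) (shortToRoot wS from))
    conclude (inj₁ v) _        = pad (short (here (Walk-start wS)) v)
    conclude (inj₂ to) (inj₁ v) = pad (short (here (Walk-start wS)) (Walk-sym v))

  module _ (edge? : ∀ x y → Dec (Edge G x y)) where

    component : {S : Fin n → Set} → (∀ x → Dec (S x)) → ∀ x → S x →
                Σ[ K ∈ Subset n ] (∀ {y} → y ∈ˢ K ⇔ Walk S x y)
    component {S} S? x Sx = grow ⁅ x ⁆ (⊃-wellFounded ⁅ x ⁆) (x∈⁅x⁆ x)
        (λ y∈ → subst (Walk S x) (sym (x∈⁅y⁆⇒x≡y x y∈)) (here Sx))
      where
      grow : ∀ K → Acc _⊃_ K → x ∈ˢ K → (∀ {y} → y ∈ˢ K → Walk S x y) →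
             Σ[ K ∈ Subset n ] (∀ {y} → y ∈ˢ K ⇔ Walk S x y)
      grow K (acc rec) x∈K sound
        with any? (λ y → any? (λ z → (y ∈? K) ×-dec ¬? (z ∈? K) ×-dec edge? y z ×-dec S? z))
      ... | yes (y , z , y∈K , z∉K , e , Sz) =
        grow (K ∪ ⁅ z ⁆) (rec (p⊆p∪q ⁅ z ⁆ , z , q⊆p∪q K ⁅ z ⁆ (x∈⁅x⁆ z) , z∉K)) (p⊆p∪q ⁅ z ⁆ x∈K)
          ([ sound , (λ u∈ → subst (Walk S x) (sym (x∈⁅y⁆⇒x≡y z u∈))
                               (Walk-trans (sound y∈K) (Walk-edge (Walk-end (sound y∈K)) e Sz))) ]′
           ∘ x∈p∪q⁻ K ⁅ z ⁆)
      ... | no closed = K , mk⇔ sound (complete x∈K)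
        where
        complete : ∀ {y z} → y ∈ˢ K → Walk S y z → z ∈ˢ K
        complete y∈K (here _)     = y∈K
        complete {y} y∈K (step {y = z} _ e w) with z ∈? K
        ... | yes z∈K = complete z∈K w
        ... | no  z∉K = ⊥-elim (closed (y , z , y∈K , z∉K , e , Walk-start w))

    walk? : {S : Fin n → Set} → (∀ x → Dec (S x)) → ∀ x y → Dec (Walk S x y)
    walk? S? x y with S? x
    ... | no ¬Sx = no (¬Sx ∘ Walk-start)
    ... | yes Sx with K , K⇔ ← component S? x Sx with y ∈? K
    ...   | yes y∈K = yes (Equivalence.to K⇔ y∈K)
    ...   | no  y∉K = no (y∉K ∘ Equivalence.from K⇔)

    inside-S : ∀ {S K : Subset n} {x} → (∀ {y} → y ∈ˢ K ⇔ Walk (_∈ˢ S) x y) → ∀ {y} → y ∈ˢ K → y ∈ˢ S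
    inside-S K⇔ = Walk-end ∘ Equivalence.to K⇔

    isComponent : ∀ {S K : Subset n} {x} → (∀ {y} → y ∈ˢ K ⇔ Walk (_∈ˢ S) x y) → x ∈ˢ S → IsComponent G S K
    isComponent {S} {K} {x} K⇔ x∈S = record
      { nonempty  = x , from (here x∈S)
      ; inside    = inside-S K⇔
      ; connected = λ y∈ z∈ → Walk⇒Star (Walk-trans (Walk-sym (within (to y∈))) (within (to z∈)))
      ; maximal   = λ K⊆L L⊆S conn-L y∈L →
          from (Walk-map L⊆S (Star⇒Walk (K⊆L (from (here x∈S))) (conn-L (K⊆L (from (here x∈S))) y∈L)))
      }
      where
      open module K⇔ {y} = Equivalence (K⇔ {y})
      within : ∀ {y} → Walk (_∈ˢ S) x y → Walk (_∈ˢ K) x y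
      within = Walk-restrict from

    -- In the connected case the minimiser is a root for every vertex. In the disconnected case the
    -- component of `x` supplies the root; its value may be smaller than the maximum, which is why
    -- an upper bound `d` is carried along.
    TreeDepth⇒HasDepth : ∀ {S k d} → TreeDepth G S k → k ≤ d → HasDepth (_∈ˢ S) d
    TreeDepth⇒HasDepth {S} {d = suc d} (single ∣S∣≡1) (s≤s z≤n) x x∈S =
      x , here x∈S , empty d λ y (w , y≢x) →
        n≮n 0 (≤-trans (≤-trans (≤-reflexive (sym (∣⁅x⁆∣≡1 y))) (p⊆q⇒∣p∣≤∣q∣ {p = ⁅ y ⁆} {S -ˢ x}
                  (λ z∈ → subst (_∈ˢ S -ˢ x) (sym (x∈⁅y⁆⇒x≡y y z∈)) (x∈p∧x≢y⇒x∈p-y (Walk-end w) y≢x))))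
                (small (≤-trans (x∈p⇒∣p-x∣<∣p∣ x∈S) (≤-reflexive ∣S∣≡1))))
      where
      small : ∀ {m} → suc m ≤ 1 → m ≤ 0
      small (s≤s m≤0) = m≤0
      empty : ∀ d {S : Fin n → Set} → (∀ x → ¬ S x) → HasDepth S d
      empty zero    ∅ = ∅
      empty (suc d) ∅ x Sx = ⊥-elim (∅ x Sx)
    TreeDepth⇒HasDepth {S} {d = suc d} (conn connected _ t td ((r , r∈S , tr≡m) , _)) (s≤s m≤d) x x∈S =
      r , walk r∈S , HasDepth-resp d
        (λ y∈ → walk (p─q⊆p S ⁅ r ⁆ y∈) , λ { refl → x∉p-x S r y∈ })
        (λ (w , y≢r) → x∈p∧x≢y⇒x∈p-y (Walk-end w) y≢r)
        (TreeDepth⇒HasDepth (td r r∈S) (≤-trans (≤-reflexive tr≡m) m≤d))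
      where
      walk : ∀ {y} → y ∈ˢ S → Walk (_∈ˢ S) x y
      walk y∈S = Star⇒Walk x∈S (connected x∈S y∈S)
    -- The component of `x` would have depth 0 although it contains `x`; the induction hypothesis
    -- refutes this.
    TreeDepth⇒HasDepth {S} {d = zero} (disconn _ t td (_ , t≤m)) z≤n x x∈S
      with K , K⇔ ← component (_∈? S) x x∈S =
      TreeDepth⇒HasDepth (td K (isComponent K⇔ x∈S)) (t≤m K (isComponent K⇔ x∈S)) x
        (Equivalence.from K⇔ (here x∈S))
    TreeDepth⇒HasDepth {S} {d = suc d} (disconn _ t td (_ , t≤m)) m≤d x x∈S
      with K , K⇔ ← component (_∈? S) x x∈S
      with r , w , h ← TreeDepth⇒HasDepth (td K (isComponent K⇔ x∈S))
                         (≤-trans (t≤m K (isComponent K⇔ x∈S)) m≤d) x (Equivalence.from K⇔ (here x∈S)) =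
      r , Walk-map (inside-S K⇔) w , HasDepth-resp d
        (λ (v , y≢r) → Walk-map (inside-S K⇔) v , y≢r)
        (λ (v , y≢r) → Walk-restrict (Equivalence.from K⇔) v , y≢r) h

-- Elimination forests of a structure

anyVec? : ∀ {n} k {P : Vec (Fin n) k → Set} → (∀ xs → Dec (P xs)) → Dec (Σ[ xs ∈ Vec (Fin n) k ] P xs)
anyVec? zero    P? = map′ ([] ,_) (λ { ([] , p) → p }) (P? [])
anyVec? (suc k) P? = map′ (λ (x , xs , p) → x ∷ xs , p) (λ { (x ∷ xs , p) → x , xs , p })
  (any? λ x → anyVec? k λ xs → P? (x ∷ xs))

gaifman? : ∀ {σ} (𝔄 : Structure σ) x y → Dec (Edge (gaifman 𝔄) x y)
gaifman? {σ} 𝔄 x y = ¬? (x ≟ y) ×-dec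
  any? λ R → anyVec? (arity σ R) λ xs → T? (interp 𝔄 R xs) ×-dec (x ∈ᵛ? xs) ×-dec (y ∈ᵛ? xs)
  where open VecDec (_≟_ {card 𝔄}) using () renaming (_∈?_ to _∈ᵛ?_)

data Extends {A : Set} {n} (ρ : Vec A n) : ∀ {m} → Vec A m → Set where
  same : Extends ρ ρ
  more : ∀ {m x} {β : Vec A m} → Extends ρ β → Extends ρ (x ∷ β)

Extends-tail : ∀ {A : Set} {n m x} {ρ : Vec A n} {β : Vec A m} → Extends (x ∷ ρ) β → Extends ρ β
Extends-tail same     = more same
Extends-tail (more e) = more (Extends-tail e)

Extends-≤ : ∀ {A : Set} {n m} {ρ : Vec A n} {β : Vec A m} → Extends ρ β → n ≤ m
Extends-≤ same     = ≤-refl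
Extends-≤ (more e) = ≤-trans (Extends-≤ e) (n≤1+n _)

-- Branches grow at the front: an element with n entries behind it keeps them, so its index in a
-- branch of length m + 1 is m - n, in agreement with `position`.
Extends-lookup : ∀ {A : Set} {n m x} {ρ : Vec A n} {β : Vec A (suc m)} → Extends (x ∷ ρ) β →
                 Vec.lookup β (clamp m (m ∸ n)) ≡ x
Extends-lookup {n = n} same rewrite n∸n≡0 n = refl
Extends-lookup {n = n} {suc m} (more e) rewrite +-∸-assoc 1 {m} {n} (s≤s⁻¹ (Extends-≤ e)) = Extends-lookup e
Extends-lookup {m = zero} (more e) with () ← Extends-≤ e

module _ {σ : Signature} (𝔄 : Structure σ) where

  private
    U = Universe 𝔄
    G = gaifman 𝔄

  Outside : ∀ {n} → Vec U n → U → Set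
  Outside ρ y = ∀ i → y ≢ Vec.lookup ρ i

  Conn : ∀ {n} → Vec U n → U → U → Set
  Conn ρ = Walk G (Outside ρ)

  -- The vertices lying below all of ρ when ρ is a branch of an elimination
  -- forest, listed from the bottom to the top.
  Region : ∀ {n} → Vec U n → U → Set
  Region []      y = Unit
  Region (r ∷ ρ) y = Conn ρ r y × y ≢ r

  outside? : ∀ {n} (ρ : Vec U n) y → Dec (Outside ρ y)
  outside? ρ y = all? λ i → ¬? (y ≟ Vec.lookup ρ i)

  conn? : ∀ {n} (ρ : Vec U n) x y → Dec (Conn ρ x y)
  conn? ρ = walk? G (gaifman? 𝔄) (outside? ρ)

  region? : ∀ {n} (ρ : Vec U n) y → Dec (Region ρ y)
  region? []      y = yes tt
  region? (r ∷ ρ) y = conn? ρ r y ×-dec ¬? (y ≟ r)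

  Region⇒Outside : ∀ {n} (ρ : Vec U n) {y} → Region ρ y → Outside ρ y
  Region⇒Outside (r ∷ ρ) (w , y≢r) zero    = y≢r
  Region⇒Outside (r ∷ ρ) (w , y≢r) (suc i) = Walk-end G w i

  Conn-weaken : ∀ {n} (ρ : Vec U n) {r x y} → Conn (r ∷ ρ) x y → Conn ρ x y
  Conn-weaken ρ = Walk-map G (_∘ suc)

  Region-Conn : ∀ {n} (ρ : Vec U n) {x y} → Region ρ x → Conn ρ x y → Region ρ y
  Region-Conn []      _       w = tt
  Region-Conn (r ∷ ρ) (v , _) w = Walk-trans G v (Conn-weaken ρ w) , Walk-end G w zero

  atomicTypeOf : ∀ {n} → Vec U n → AtomicType σ n
  atomicTypeOf ρ = atomicType λ R xs → interp 𝔄 R (Vec.map (Vec.lookup ρ) xs)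

  -- D is the set of elements that M represents, inside the region of ρ.
  record Represents {n} (ρ : Vec U n) (D : U → Set) (M : OForest (Label {σ}) U) : Set where
    field
      sound      : ∀ x → D (elt M x)
      onto       : ∀ {a} → D a → Σ[ x ∈ Node M ] elt M x ≡ a
      injective  : ∀ x y → elt M x ≡ elt M y → x ≡ y
      comparable : ∀ x y → Edge G (elt M x) (elt M y) → T (anc M x y) ⊎ T (anc M y x)
      branch     : ∀ y → Σ[ β ∈ Vec U (suc (proj₁ (label M y))) ]
                     Extends ρ β × proj₂ (label M y) ≡ atomicTypeOf β ×
                     (∀ x → T (anc M x y) → Vec.lookup β (position {σ} (label M x) (label M y)) ≡ elt M x)

  open Represents

  Represents-resp : ∀ {n} {ρ : Vec U n} {D D′ : U → Set} {M} → (∀ {a} → D a → D′ a) → (∀ {a} → D′ a → D a) →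
                    Represents ρ D M → Represents ρ D′ M
  Represents-resp D⊆D′ D′⊆D rep = record
    { sound = D⊆D′ ∘ sound rep ; onto = onto rep ∘ D′⊆D ; injective = injective rep
    ; comparable = comparable rep ; branch = branch rep }

  Represents-empty : ∀ {n} {ρ : Vec U n} {D : U → Set} → (∀ {a} → ¬ D a) → Represents ρ D emptyForest
  Represents-empty ¬D = record
    { sound = λ () ; onto = λ Da → ⊥-elim (¬D Da) ; injective = λ () ; comparable = λ () ; branch = λ () }

  Represents-⊕ : ∀ {n} {ρ : Vec U n} {D D′ : U → Set} {M M′} →
    Represents ρ D M → Represents ρ D′ M′ → (∀ {a b} → D a → D′ b → a ≢ b × ¬ Edge G a b) →
    Represents ρ (λ a → D a ⊎ D′ a) (M ⊕[ false ] M′)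
  Represents-⊕ rep rep′ apart = record
    { sound = λ { (inj₁ x) → inj₁ (sound rep x) ; (inj₂ x) → inj₂ (sound rep′ x) }
    ; onto = λ { (inj₁ Da) → let x , eq = onto rep Da in inj₁ x , eq
               ; (inj₂ Da) → let x , eq = onto rep′ Da in inj₂ x , eq }
    ; injective = λ { (inj₁ x) (inj₁ y) eq → cong inj₁ (injective rep x y eq)
                    ; (inj₁ x) (inj₂ y) eq → ⊥-elim (proj₁ (apart (sound rep x) (sound rep′ y)) eq)
                    ; (inj₂ x) (inj₁ y) eq → ⊥-elim (proj₁ (apart (sound rep y) (sound rep′ x)) (sym eq))
                    ; (inj₂ x) (inj₂ y) eq → cong inj₂ (injective rep′ x y eq) }
    ; comparable = λ { (inj₁ x) (inj₁ y) e → comparable rep x y e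
                     ; (inj₁ x) (inj₂ y) e → ⊥-elim (proj₂ (apart (sound rep x) (sound rep′ y)) e)
                     ; (inj₂ x) (inj₁ y) e → ⊥-elim (proj₂ (apart (sound rep y) (sound rep′ x)) (edge-sym G e))
                     ; (inj₂ x) (inj₂ y) e → comparable rep′ x y e }
    ; branch = λ { (inj₁ y) → let β , ext , c≡ , look = branch rep y in
                     β , ext , c≡ , λ { (inj₁ x) → look x }
                 ; (inj₂ y) → let β , ext , c≡ , look = branch rep′ y in
                     β , ext , c≡ , λ { (inj₂ x) → look x } } }

  Represents-root : ∀ {n} {ρ : Vec U n} {r} {D : U → Set} {M} → Represents (r ∷ ρ) D M → ¬ D r →
    Represents ρ (λ a → r ≡ a ⊎ D a) (singleNode (n , atomicTypeOf (r ∷ ρ)) r ⊕[ true ] M)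
  Represents-root {n} {ρ} {r} {D} rep ¬Dr = record
    { sound = λ { (inj₁ _) → inj₁ refl ; (inj₂ x) → inj₂ (sound rep x) }
    ; onto = λ { (inj₁ eq) → inj₁ tt , eq ; (inj₂ Da) → let x , eq = onto rep Da in inj₂ x , eq }
    ; injective = λ { (inj₁ _) (inj₁ _) _ → refl
                    ; (inj₁ _) (inj₂ y) eq → ⊥-elim (¬Dr (subst D (sym eq) (sound rep y)))
                    ; (inj₂ x) (inj₁ _) eq → ⊥-elim (¬Dr (subst D eq (sound rep x)))
                    ; (inj₂ x) (inj₂ y) eq → cong inj₂ (injective rep x y eq) }
    ; comparable = λ { (inj₁ _) (inj₁ _) _ → inj₁ tt
                     ; (inj₁ _) (inj₂ _) _ → inj₁ tt
                     ; (inj₂ x) (inj₁ _) _ → inj₂ tt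
                     ; (inj₂ x) (inj₂ y) e → comparable rep x y e }
    ; branch = λ { (inj₁ _) → r ∷ ρ , more same , refl ,
                     λ { (inj₁ _) _ → cong (Vec.lookup (r ∷ ρ)) (cong (clamp n) (n∸n≡0 n)) }
                 ; (inj₂ y) → let β , ext , c≡ , look = branch rep y in
                     β , Extends-tail ext , c≡ ,
                     λ { (inj₁ _) _ → Extends-lookup ext ; (inj₂ x) → look x } } }

  module _ (N : ℕ) where

    root : ∀ {n k} → Tree σ U n k → U
    root (node r _ _) = r

    Independent : ∀ {n k} → Vec U n → Tree σ U n k → Tree σ U n k → Set
    Independent ρ s t = ¬ Conn ρ (root s) (root t)

    Covered : ∀ {n k} → Vec U n → List (Tree σ U n k) → U → Set
    Covered ρ ts y = Any (λ t → Conn ρ (root t) y) ts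

    -- ts is the part below ρ of an elimination forest of 𝔄, with correct labels.
    mutual
      GoodTree : ∀ {n k} → Vec U n → Tree σ U n k → Set
      GoodTree ρ (node r c ts) =
        Region ρ r × c ≡ atomicTypeOf (r ∷ ρ) × GoodForest (r ∷ ρ) ts

      GoodForest : ∀ {n k} → Vec U n → List (Tree σ U n k) → Set
      GoodForest ρ ts = All (GoodTree ρ) ts × AllPairs (Independent ρ) ts
                        × (∀ y → Region ρ y → Covered ρ ts y)

    good-region : ∀ {n k} (ρ : Vec U n) (t : Tree σ U n k) → GoodTree ρ t → Region ρ (root t)
    good-region ρ (node r c ts) (reg , _) = reg

    independent-sym : ∀ {n k} (ρ : Vec U n) {s t : Tree σ U n k} → Independent ρ s t → Independent ρ t s
    independent-sym ρ ¬w = ¬w ∘ Walk-sym G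

    -- Needed twice: `forest` sorts the trees by type, and `select` separates the surplus trees from
    -- the counted ones.
    good-↭ : ∀ {n k} (ρ : Vec U n) {ts ts′ : List (Tree σ U n k)} → ts ↭ ts′ → GoodForest ρ ts → GoodForest ρ ts′
    good-↭ ρ p (good , indep , cover) =
      All-resp-↭ p good , Perm.AllPairs-resp-↭ (setoid _) (λ {s} {t} → independent-sym ρ {s} {t}) (resp₂ _) (↭⇒↭ₛ p) indep ,
      λ y reg → Any-resp-↭ p (cover y reg)

    mutual
      -- The component of the root consists of the root and the region below it, and the forest of
      -- the children represents that region.
      represents-tree : ∀ {n k} (ρ : Vec U n) (t : Tree σ U n k) → GoodTree ρ t →
                        Represents ρ (Conn ρ (root t)) (treeForest σ N n k t)
      represents-tree ρ (node r c ts) (reg , refl , good) =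
        Represents-resp
          (λ { (inj₁ refl) → here (Region⇒Outside ρ reg) ; (inj₂ (w , _)) → w })
          (λ {a} w → below a w (a ≟ r))
          (Represents-root (represents (r ∷ ρ) ts good) (λ (_ , r≢r) → r≢r refl))
        where
        below : ∀ a → Conn ρ r a → Dec (a ≡ r) → r ≡ a ⊎ Region (r ∷ ρ) a
        below a w (yes refl) = inj₁ refl
        below a w (no a≢r)   = inj₂ (w , a≢r)

      represents : ∀ {n k} (ρ : Vec U n) (ts : List (Tree σ U n k)) → GoodForest ρ ts → Represents ρ (Region ρ) (forest σ N n k ts)
      represents {n} {k} ρ ts good =
        let good′ , indep , cover = good-↭ ρ (↭-sym (groupBy-↭ (treeType σ N n k) ts)) good
        in Represents-resp (λ covered → covered⇒region good′ covered) (cover _)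
             (represents-list ρ _ good′ indep)
        where
        covered⇒region : ∀ {ts a} → All (GoodTree ρ) ts → Covered ρ ts a → Region ρ a
        covered⇒region (g ∷ _)  (here w)  = Region-Conn ρ (good-region ρ _ g) w
        covered⇒region (_ ∷ gs) (there c) = covered⇒region gs c

      -- Trees with unconnected roots fill different components of the graph without `ρ`; hence they
      -- are disjoint and no edge joins them.
      represents-list : ∀ {n k} (ρ : Vec U n) (ts : List (Tree σ U n k)) → All (GoodTree ρ) ts → AllPairs (Independent ρ) ts →
                        Represents ρ (Covered ρ ts) (⨁ (treeForest σ N n k) ts)
      represents-list ρ []       []       []             = Represents-empty λ ()
      represents-list ρ (t ∷ ts) (g ∷ gs) (ind ∷ indep) = Represents-resp
        (λ { (inj₁ w) → here w ; (inj₂ c) → there c })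
        (λ { (here w) → inj₁ w ; (there c) → inj₂ c })
        (Represents-⊕ (represents-tree ρ t g) (represents-list ρ ts gs indep)
          λ w c → (λ { refl → apart ind (here (Walk-end G w)) w c }) ,
                  (λ e → apart ind (Walk-edge G (Walk-end G w) e (covered-outside c)) w c))
        where
        covered-outside : ∀ {ts a} → Covered ρ ts a → Outside ρ a
        covered-outside (here w)  = Walk-end G w
        covered-outside (there c) = covered-outside c
        apart : ∀ {ts a b} → All (Independent ρ t) ts → Conn ρ a b →
                Conn ρ (root t) a → ¬ Covered ρ ts b
        apart (ind ∷ _)  v w (here w′)  = ind (Walk-trans G w (Walk-trans G v (Walk-sym G w′)))
        apart (_ ∷ inds) v w (there c) = apart inds v w c

    -- A family of pairwise unconnected trees is completed greedily: an
    -- uncovered vertex supplies the tree of its component.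
    complete : ∀ {n k} (ρ : Vec U n) (P : Tree σ U n k → Set) ts →
      All (GoodTree ρ) ts → AllPairs (Independent ρ) ts →
      (∀ y → Region ρ y → Covered ρ ts y ⊎ (Σ[ t ∈ Tree σ U n k ] Conn ρ (root t) y × GoodTree ρ t × P t)) →
      Σ[ es ∈ List (Tree σ U n k) ] All P es × GoodForest ρ (es ++ ts)
    complete {n} {k} ρ P ts good indep supply =
      let es , ps , gs , ind , cov = sweep (allFin (card 𝔄))
      in es , ps , gs , ind , λ y → cov (∈-allFin y)
      where
      sweep : (ys : List U) → Σ[ es ∈ List (Tree σ U n k) ] All P es ×
        All (GoodTree ρ) (es ++ ts) × AllPairs (Independent ρ) (es ++ ts) ×
        (∀ {y} → y ∈ ys → Region ρ y → Covered ρ (es ++ ts) y)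
      sweep []       = [] , [] , good , indep , λ ()
      sweep (y ∷ ys) with sweep ys | region? ρ y
      ... | es , ps , gs , ind , cov | no ¬reg =
        es , ps , gs , ind , λ { (here refl) reg → ⊥-elim (¬reg reg) ; (there y∈) → cov y∈ }
      ... | es , ps , gs , ind , cov | yes reg with Any.any? (λ t → conn? ρ (root t) y) (es ++ ts) | supply y reg
      ...   | yes covered | _ = es , ps , gs , ind , λ { (here refl) _ → covered ; (there y∈) → cov y∈ }
      ...   | no uncovered | inj₁ covered = ⊥-elim (uncovered (AnyP.++⁺ʳ es covered))
      ...   | no uncovered | inj₂ (t , w , g , p) = t ∷ es , p ∷ ps , g ∷ gs ,
        All.map (λ ¬w w′ → ¬w (Walk-trans G (Walk-sym G w′) w)) (All.¬Any⇒All¬ (es ++ ts) uncovered) ∷ ind ,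
        λ { (here refl) _ → here w ; (there y∈) reg → there (cov y∈ reg) }

    -- `HasDepth` offers a root for the component of every vertex; `complete`, started from no trees
    -- at all, keeps one root for each component.
    good-exists : ∀ {n} k (ρ : Vec U n) → HasDepth G (Region ρ) k → Σ[ ts ∈ List (Tree σ U n k) ] GoodForest ρ ts
    good-exists zero    ρ h = [] , [] , [] , λ y reg → ⊥-elim (h y reg)
    good-exists (suc k) ρ h =
      let es , _ , good = complete ρ (λ _ → Unit) [] [] [] (λ y reg → inj₂ (tree y reg))
      in es ++ [] , good
      where
      outer : ∀ {x y} → Walk G (Region ρ) x y → Conn ρ x y
      outer = Walk-map G (Region⇒Outside ρ)
      inner : ∀ {y z} → Region ρ y → Conn ρ y z → Walk G (Region ρ) y z
      inner reg = Walk-restrict G (Region-Conn ρ reg)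
      tree : ∀ y → Region ρ y → Σ[ t ∈ Tree σ U _ (suc k) ] Conn ρ (root t) y × GoodTree ρ t × Unit
      tree y reg with r , w , h′ ← h y reg =
        let ts , good = good-exists k (r ∷ ρ) (HasDepth-resp G k
              (λ (v , z≢r) → Walk-trans G (Walk-sym G (outer w)) (outer v) , z≢r)
              (λ (v , z≢r) → inner reg (Walk-trans G (outer w) v) , z≢r) h′)
        in node r (atomicTypeOf (r ∷ ρ)) ts , Walk-sym G (outer w) ,
           (Region-Conn ρ reg (outer w) , refl , good) , tt

-- The ordered structure and its forest satisfy the same formulas

map-≡ : ∀ {A B : Set} {k} {f g : A → B} (xs : Vec A k) →
        (∀ j → f (Vec.lookup xs j) ≡ g (Vec.lookup xs j)) → Vec.map f xs ≡ Vec.map g xs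
map-≡ []       eq = refl
map-≡ (x ∷ xs) eq = cong₂ _∷_ (eq zero) (map-≡ xs (eq ∘ suc))

module _ {Λ E : Set} (M : OForest Λ E) where

  -- Pairwise comparable nodes form a chain, whose lowest node is found by passing through the
  -- tuple. The other outcome, `Vec (Fin 0) k`, can only occur for k = 0. The two outcomes match the
  -- alternatives of `Holds`.
  lowest : ∀ {k} (xs : Vec (Node M) k) →
    (∀ i j → T (anc M (Vec.lookup xs i) (Vec.lookup xs j)) ⊎ T (anc M (Vec.lookup xs j) (Vec.lookup xs i))) →
    Vec (Fin 0) k ⊎ (Σ[ i ∈ Fin k ] ∀ j → T (anc M (Vec.lookup xs j) (Vec.lookup xs i)))
  lowest []       comp = inj₁ []
  lowest (x ∷ []) comp = inj₂ (zero , λ { zero → anc-refl M x })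
  lowest (x ∷ xs@(_ ∷ _)) comp with lowest xs (λ i j → comp (suc i) (suc j))
  ... | inj₁ (() ∷ _)
  ... | inj₂ (i , below) with comp zero (suc i)
  ...   | inj₁ x⊑ = inj₂ (suc i , λ { zero → x⊑ ; (suc j) → below j })
  ...   | inj₂ ⊑x = inj₂ (zero , λ { zero → anc-refl M x ; (suc j) → anc-trans M _ _ _ (below j) ⊑x })

module _ {σ : Signature} (𝔄 : Structure σ) (M : OForest (Label {σ}) (Universe 𝔄))
         (rep : Represents 𝔄 [] (λ _ → Unit) M) where

  open Represents rep

  private
    U  = Universe 𝔄
    c₀ = atomicTypeOf 𝔄 []

  nodeOf : U → Node M
  nodeOf a = proj₁ (onto {a} tt)

  elt-nodeOf : ∀ a → elt M (nodeOf a) ≡ a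
  elt-nodeOf a = proj₂ (onto tt)

  nodeOf-elt : ∀ x → nodeOf (elt M x) ≡ x
  nodeOf-elt x = injective _ _ (elt-nodeOf (elt M x))

  forestOrder : LinearOrder U
  leq forestOrder a b = le M (nodeOf a) (nodeOf b)
  isTotalOrder forestOrder = record
    { isPartialOrder = record
        { isPreorder = record
            { isEquivalence = isEquivalence
            ; reflexive     = λ { {a} refl → le-refl M (nodeOf a) }
            ; trans         = le-trans M _ _ _ }
        ; antisym = λ {a} {b} p q →
            trans (sym (elt-nodeOf a)) (trans (cong (elt M) (le-antisym M _ _ p q)) (elt-nodeOf b)) }
    ; total = λ a b → le-total M (nodeOf a) (nodeOf b) }

  holds-atomicTypeOf : ∀ {n} (ρ : Vec U n) R v →
    holds {σ} (atomicTypeOf 𝔄 ρ) R v ≡ interp 𝔄 R (Vec.map (Vec.lookup ρ) v)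
  holds-atomicTypeOf ρ = holds-atomicType {σ} (λ R v → interp 𝔄 R (Vec.map (Vec.lookup ρ) v))

  nullary-correct : ∀ R (v : Vec (Fin 0) (arity σ R)) xs → holds {σ} c₀ R v ≡ interp 𝔄 R (Vec.map (elt M) xs)
  nullary-correct R v xs = trans (holds-atomicTypeOf [] R v) (cong (interp 𝔄 R) (nullary v))
    where
    nullary : ∀ {k} (v : Vec (Fin 0) k) {ys zs : Vec U k} → ys ≡ zs
    nullary [] {[]} {[]} = refl

  -- Every entry lies above the `i`-th one, so `look` finds all of them on the branch `β` whose
  -- atomic type is the label of that entry.
  branch-correct : ∀ R xs i → (∀ j → T (anc M (Vec.lookup xs j) (Vec.lookup xs i))) →
    holds (proj₂ (label M (Vec.lookup xs i))) R
      (Vec.map (λ x → position {σ} (label M x) (label M (Vec.lookup xs i))) xs)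
    ≡ interp 𝔄 R (Vec.map (elt M) xs)
  branch-correct R xs i ⊑i with β , _ , c≡ , look ← branch (Vec.lookup xs i) = begin
    holds (proj₂ l) R (Vec.map (λ x → position {σ} (label M x) l) xs)
      ≡⟨ cong (λ c → holds {σ} c R (Vec.map (λ x → position {σ} (label M x) l) xs)) c≡ ⟩
    holds (atomicTypeOf 𝔄 β) R (Vec.map (λ x → position {σ} (label M x) l) xs)
      ≡⟨ holds-atomicTypeOf β R _ ⟩
    interp 𝔄 R (Vec.map (Vec.lookup β) (Vec.map (λ x → position {σ} (label M x) l) xs))
      ≡⟨ cong (interp 𝔄 R) (sym (Vec.map-∘ (Vec.lookup β) _ xs)) ⟩
    interp 𝔄 R (Vec.map (λ x → Vec.lookup β (position {σ} (label M x) l)) xs)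
      ≡⟨ cong (interp 𝔄 R) (map-≡ xs (λ j → look (Vec.lookup xs j) (⊑i j))) ⟩
    interp 𝔄 R (Vec.map (elt M) xs) ∎
    where
    open ≡-Reasoning
    l = label M (Vec.lookup xs i)

  -- Distinct entries of a related tuple are adjacent in the Gaifman graph and therefore comparable
  -- in the forest; the lowest entry then has all the others on its branch.
  interp⇔Holds : ∀ R xs → T (interp 𝔄 R (Vec.map (elt M) xs)) ⇔ Holds c₀ M R xs
  interp⇔Holds R xs = mk⇔ to
    λ { (inj₁ (v , t)) → subst T (nullary-correct R v xs) t
      ; (inj₂ (i , ⊑i , t)) → subst T (branch-correct R xs i ⊑i) t }
    where
    ∈xs : ∀ i → elt M (Vec.lookup xs i) VecMem.∈ Vec.map (elt M) xs
    ∈xs i = VecMemP.∈-map⁺ (elt M) (VecMemP.∈-lookup i xs)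
    comp : T (interp 𝔄 R (Vec.map (elt M) xs)) → ∀ i j →
           T (anc M (Vec.lookup xs i) (Vec.lookup xs j)) ⊎ T (anc M (Vec.lookup xs j) (Vec.lookup xs i))
    comp Rxs i j with elt M (Vec.lookup xs i) ≟ elt M (Vec.lookup xs j)
    ... | yes eq  = inj₁ (subst (T ∘ anc M (Vec.lookup xs i)) (injective _ _ eq) (anc-refl M (Vec.lookup xs i)))
    ... | no  neq = comparable _ _ (neq , R , _ , Rxs , ∈xs i , ∈xs j)
    to : T (interp 𝔄 R (Vec.map (elt M) xs)) → Holds c₀ M R xs
    to Rxs with lowest M xs (comp Rxs)
    ... | inj₁ v        = inj₁ (v , subst T (sym (nullary-correct R v xs)) Rxs)
    ... | inj₂ (i , ⊑i) = inj₂ (i , ⊑i , subst T (sym (branch-correct R xs i ⊑i)) Rxs)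

  ⊨⇔⊩ : ∀ {n} (ρ : Vec (Node M) n) φ →
        (expand 𝔄 forestOrder , Vec.map (elt M) ρ ⊨ φ) ⇔ _⊩_ c₀ M ρ φ
  ⊨⇔⊩ ρ (x ≐ y) = mk⇔
    (λ eq → injective _ _ (trans (sym (Vec.lookup-map x (elt M) ρ)) (trans eq (Vec.lookup-map y (elt M) ρ))))
    (λ eq → trans (Vec.lookup-map x (elt M) ρ) (trans (cong (elt M) eq) (sym (Vec.lookup-map y (elt M) ρ))))
  ⊨⇔⊩ ρ (rel zero (x ∷ y ∷ [])) = mk⇔ (subst T eq) (subst T (sym eq))
    where
    node≡ : ∀ x → nodeOf (Vec.lookup (Vec.map (elt M) ρ) x) ≡ Vec.lookup ρ x
    node≡ x = trans (cong nodeOf (Vec.lookup-map x (elt M) ρ)) (nodeOf-elt _)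
    eq : le M (nodeOf (Vec.lookup (Vec.map (elt M) ρ) x)) (nodeOf (Vec.lookup (Vec.map (elt M) ρ) y))
         ≡ le M (Vec.lookup ρ x) (Vec.lookup ρ y)
    eq = cong₂ (le M) (node≡ x) (node≡ y)
  ⊨⇔⊩ ρ (rel (suc R) xs) = subst (λ ys → T (interp 𝔄 R ys) ⇔ Holds c₀ M R (Vec.map (Vec.lookup ρ) xs)) eq
    (interp⇔Holds R (Vec.map (Vec.lookup ρ) xs))
    where
    eq : Vec.map (elt M) (Vec.map (Vec.lookup ρ) xs) ≡ Vec.map (Vec.lookup (Vec.map (elt M) ρ)) xs
    eq = trans (sym (Vec.map-∘ (elt M) (Vec.lookup ρ) xs))
               (Vec.map-cong (λ i → sym (Vec.lookup-map i (elt M) ρ)) xs)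
  ⊨⇔⊩ ρ (¬′ φ) = mk⇔ (_∘ Equivalence.from (⊨⇔⊩ ρ φ)) (_∘ Equivalence.to (⊨⇔⊩ ρ φ))
  ⊨⇔⊩ ρ (φ ∧′ ψ) = ⊨⇔⊩ ρ φ ×-⇔ ⊨⇔⊩ ρ ψ
  ⊨⇔⊩ ρ (φ ∨′ ψ) = ⊨⇔⊩ ρ φ ⊎-⇔ ⊨⇔⊩ ρ ψ
  ⊨⇔⊩ ρ (∃′ φ) = mk⇔
    (λ (a , t) → nodeOf a , Equivalence.to (⊨⇔⊩ (nodeOf a ∷ ρ) φ)
       (subst (λ b → expand 𝔄 forestOrder , b ∷ Vec.map (elt M) ρ ⊨ φ) (sym (elt-nodeOf a)) t))
    (λ (x , t) → elt M x , Equivalence.from (⊨⇔⊩ (x ∷ ρ) φ) t)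
  ⊨⇔⊩ ρ (∀′ φ) = mk⇔
    (λ t x → Equivalence.to (⊨⇔⊩ (x ∷ ρ) φ) (t (elt M x)))
    (λ t a → subst (λ b → expand 𝔄 forestOrder , b ∷ Vec.map (elt M) ρ ⊨ φ) (elt-nodeOf a)
       (Equivalence.from (⊨⇔⊩ (nodeOf a ∷ ρ) φ) (t (nodeOf a))))

-- Formulas

private
  _↑ : ∀ {m n} → Vec (Fin m) n → Vec (Fin (suc m)) n
  _↑ = Vec.map suc

fullTypes : ∀ σ N n k → ForestType σ N n k → List (TreeType σ N n k)
fullTypes σ N n k f = filter (λ τ → f τ ≟ fromℕ N) (allFin _)

module _ {σ : Signature} where

  -- The language has no truth constants. `false′` is existential, so that disjunctions of
  -- existential formulas stay existential; `true′` is universal, so that a conjunction below ∃ may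
  -- cost one alternation.
  false′ true′ : ∀ {m} → Formula σ m
  false′ = ∃′ ¬′ (zero ≐ zero)
  true′  = ∀′ (zero ≐ zero)

  ⋁ ⋀ : ∀ {m} → List (Formula σ m) → Formula σ m
  ⋁ = foldr _∨′_ false′
  ⋀ = foldr _∧′_ true′

  exists : ∀ k {m} → Formula σ (k + m) → Formula σ m
  exists zero    φ = φ
  exists (suc k) φ = exists k (∃′ φ)

  memberF : ∀ k {m} → Fin m → Formula σ (k + m)
  memberF k {m} x = ⋁ (map (λ i → (i ↑ˡ m) ≐ (k ↑ʳ x)) (allFin k))

  tupleF : ∀ {m} → Fin m → Fin m → (R : Symbol σ) → Formula σ (arity σ R + m)
  tupleF {m} x y R =
    rel R (Vec.tabulate (_↑ˡ m)) ∧′ memberF (arity σ R) x ∧′ memberF (arity σ R) y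

  edgeF : ∀ {m} → Fin m → Fin m → Formula σ m
  edgeF x y = ¬′ (x ≐ y) ∧′ ⋁ (map (λ R → exists (arity σ R) (tupleF x y R)) (allFin (#symbols σ)))

  outsideF : ∀ {m n} → Vec (Fin m) n → Fin m → Formula σ m
  outsideF []       x = x ≐ x
  outsideF (v ∷ vs) x = ¬′ (x ≐ v) ∧′ outsideF vs x

  connF : ℕ → ∀ {m n} → Vec (Fin m) n → Fin m → Fin m → Formula σ m
  connF zero    vs x y = outsideF vs x ∧′ x ≐ y
  connF (suc ℓ) vs x y =
    outsideF vs x ∧′ (∃′ (suc x ≐ zero ∨′ edgeF (suc x) zero) ∧′ connF ℓ (vs ↑) zero (suc y))

  atom : ∀ {m n} → Vec (Fin m) n → Fin (#atoms σ n) → Formula σ m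
  atom vs i = let R , xs = lookup (allAtoms σ _) i in rel R (Vec.map (Vec.lookup vs) xs)

  signed : ∀ {m} → Fin 2 → Formula σ m → Formula σ m
  signed b φ = if isTrue {σ} b then φ else ¬′ φ

  atomicF : ∀ {m n} → AtomicType σ n → Vec (Fin m) n → Formula σ m
  atomicF c vs = ⋀ (map (λ i → signed (finToFun c i) (atom vs i)) (allFin _))

  module _ (ℓ : ℕ) where

    regionF : ∀ {m n} → Vec (Fin m) n → Fin m → Formula σ m
    regionF []       y = y ≐ y
    regionF (r ∷ vs) y = connF ℓ vs r y ∧′ ¬′ (y ≐ r)

    apartF coveredF : ∀ {m n} → Vec (Fin m) n → List (Fin m) → Fin m → Formula σ m
    apartF vs ps x   = ⋀ (map (λ p → ¬′ connF ℓ vs p x) ps)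
    coveredF vs ps y = ⋁ (map (λ p → connF ℓ vs p y) ps)

    -- There are trees of the given types with pairwise unconnected roots, also
    -- unconnected to ps, and every other component has a tree of a type in full.
    module _ {n : ℕ} {X : Set} (treeF : ∀ {m} → Vec (Fin m) n → Fin m → X → Formula σ m) (full : List X) where

      restF : ∀ {m} → Vec (Fin m) n → List (Fin m) → Formula σ m
      restF vs ps = ∀′ (¬′ regionF (vs ↑) zero ∨′ coveredF (vs ↑) (map suc ps) zero
        ∨′ (∃′ connF ℓ (vs ↑ ↑) zero (suc zero) ∧′ ⋁ (map (treeF (vs ↑ ↑) zero) full)))

      placeF : ∀ {m} → Vec (Fin m) n → List (Fin m) → List X → Formula σ m
      placeF vs ps []       = restF vs ps
      placeF vs ps (τ ∷ τs) = ∃′ (regionF (vs ↑) zero ∧′ apartF (vs ↑) (map suc ps) zero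
        ∧′ treeF (vs ↑) zero τ ∧′ placeF (vs ↑) (zero ∷ map suc ps) τs)

    module _ (N : ℕ) where

      mutual
        treeF : ∀ n k {m} → Vec (Fin m) n → Fin m → TreeType σ N n k → Formula σ m
        treeF n (suc k) vs r τ =
          atomicF (rootType σ N n k τ) (r ∷ vs) ∧′ forestF (suc n) k (r ∷ vs) (childrenType σ N n k τ)

        forestF : ∀ n k {m} → Vec (Fin m) n → ForestType σ N n k → Formula σ m
        forestF n zero    vs f = ∀′ ¬′ regionF (vs ↑) zero
        forestF n (suc k) vs f = placeF (treeF n (suc k)) (fullTypes σ N n (suc k) f) vs [] (typeList σ N n (suc k) f)

-- Semantics of the basic formulas

module _ {σ : Signature} (𝔄 : Structure σ) where

  private
    U = Universe 𝔄
    G = gaifman 𝔄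

  -- Separates the branch `ρ`, which stays the same, from the variables `vs` naming it, which are
  -- shifted under each quantifier.
  Values : ∀ {m n} → Vec U m → Vec (Fin m) n → Vec U n → Set
  Values e vs ρ = Vec.map (Vec.lookup e) vs ≡ ρ

  Values-suc : ∀ {m n} {e : Vec U m} (vs : Vec (Fin m) n) {ρ a} → Values e vs ρ → Values (a ∷ e) (vs ↑) ρ
  Values-suc vs eq = trans (sym (Vec.map-∘ _ suc vs)) eq

  false′-⊨ : ∀ {m} (e : Vec U m) → ¬ (𝔄 , e ⊨ false′)
  false′-⊨ e (_ , ¬eq) = ¬eq refl

  ⋁-⊨ : ∀ {m} (e : Vec U m) {X : Set} (F : X → Formula σ m) {P : X → Set} →
        (∀ x → (𝔄 , e ⊨ F x) ⇔ P x) → ∀ xs → (𝔄 , e ⊨ ⋁ (map F xs)) ⇔ Any P xs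
  ⋁-⊨ e F F⇔ []       = mk⇔ (⊥-elim ∘ false′-⊨ e) λ ()
  ⋁-⊨ e F F⇔ (x ∷ xs) = mk⇔
    [ here ∘ Equivalence.to (F⇔ x) , there ∘ Equivalence.to (⋁-⊨ e F F⇔ xs) ]′
    (λ { (here p) → inj₁ (Equivalence.from (F⇔ x) p) ; (there p) → inj₂ (Equivalence.from (⋁-⊨ e F F⇔ xs) p) })

  ⋀-⊨ : ∀ {m} (e : Vec U m) {X : Set} (F : X → Formula σ m) {P : X → Set} →
        (∀ x → (𝔄 , e ⊨ F x) ⇔ P x) → ∀ xs → (𝔄 , e ⊨ ⋀ (map F xs)) ⇔ All P xs
  ⋀-⊨ e F F⇔ []       = mk⇔ (λ _ → []) (λ _ _ → refl)
  ⋀-⊨ e F F⇔ (x ∷ xs) = mk⇔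
    (λ (p , ps) → Equivalence.to (F⇔ x) p ∷ Equivalence.to (⋀-⊨ e F F⇔ xs) ps)
    (λ { (p ∷ ps) → Equivalence.from (F⇔ x) p , Equivalence.from (⋀-⊨ e F F⇔ xs) ps })

  ¬-⇔ : ∀ {A B : Set} → A ⇔ B → (¬ A) ⇔ (¬ B)
  ¬-⇔ A⇔B = mk⇔ (_∘ Equivalence.from A⇔B) (_∘ Equivalence.to A⇔B)

  Σ-⇔ : ∀ {A : Set} {P Q : A → Set} → (∀ a → P a ⇔ Q a) → (Σ[ a ∈ A ] P a) ⇔ (Σ[ a ∈ A ] Q a)
  Σ-⇔ P⇔Q = mk⇔ (λ (a , p) → a , Equivalence.to (P⇔Q a) p) (λ (a , q) → a , Equivalence.from (P⇔Q a) q)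

  Π-⇔ : ∀ {A : Set} {P Q : A → Set} → (∀ a → P a ⇔ Q a) → (∀ a → P a) ⇔ (∀ a → Q a)
  Π-⇔ P⇔Q = mk⇔ (λ p a → Equivalence.to (P⇔Q a) (p a)) (λ q a → Equivalence.from (P⇔Q a) (q a))

  ≐-⊨ : ∀ {m} (e : Vec U m) x y {a b} → Vec.lookup e x ≡ a → Vec.lookup e y ≡ b →
        (𝔄 , e ⊨ x ≐ y) ⇔ (a ≡ b)
  ≐-⊨ e x y refl refl = mk⇔ id id

  exists-⊨ : ∀ k {m} (e : Vec U m) φ → (𝔄 , e ⊨ exists k φ) ⇔ (Σ[ xs ∈ Vec U k ] (𝔄 , xs Vec.++ e ⊨ φ))
  exists-⊨ zero    e φ = mk⇔ ([] ,_) (λ { ([] , t) → t })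
  exists-⊨ (suc k) e φ = mk⇔
    (λ t → let xs , x , t′ = Equivalence.to (exists-⊨ k e (∃′ φ)) t in x ∷ xs , t′)
    (λ { (x ∷ xs , t) → Equivalence.from (exists-⊨ k e (∃′ φ)) (xs , x , t) })

  Any-allFin : ∀ {k} {P : Fin k → Set} → Any P (allFin k) ⇔ (Σ[ i ∈ Fin k ] P i)
  Any-allFin = mk⇔ (λ p → lookup (allFin _) (index p) , lookup-index p)
    (λ (i , p) → Any.map (λ { refl → p }) (∈-allFin i))

  All-allFin : ∀ {k} {P : Fin k → Set} → All P (allFin k) ⇔ (∀ i → P i)
  All-allFin = mk⇔ (λ ps i → All.lookup ps (∈-allFin i)) (λ p → All.universal p _)

  memberF-⊨ : ∀ k {m} (e : Vec U m) x xs → (𝔄 , xs Vec.++ e ⊨ memberF k x) ⇔ (Vec.lookup e x VecMem.∈ xs)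
  memberF-⊨ k {m} e x xs = mk⇔
    (λ t → let i , eq = Equivalence.to Any-allFin (Equivalence.to any⇔ t)
           in subst (VecMem._∈ xs) eq (VecMemP.∈-lookup i xs))
    (λ x∈ → Equivalence.from any⇔ (Equivalence.from Any-allFin
              (VecAny.index x∈ , sym (VecAnyP.lookup-index x∈))))
    where
    any⇔ = ⋁-⊨ (xs Vec.++ e) (λ i → (i ↑ˡ m) ≐ (k ↑ʳ x)) {λ i → Vec.lookup xs i ≡ Vec.lookup e x}
             (λ i → ≐-⊨ (xs Vec.++ e) (i ↑ˡ m) (k ↑ʳ x) (Vec.lookup-++ˡ xs e i) (Vec.lookup-++ʳ xs e x)) (allFin k)

  edgeF-⊨ : ∀ {m} (e : Vec U m) x y → (𝔄 , e ⊨ edgeF x y) ⇔ Edge G (Vec.lookup e x) (Vec.lookup e y)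
  edgeF-⊨ {m} e x y = mk⇔ id id ×-⇔ mk⇔
    (λ t → Equivalence.to Any-allFin (Equivalence.to symbols⇔ t))
    (λ t → Equivalence.from symbols⇔ (Equivalence.from Any-allFin t))
    where
    tuple : ∀ {k} (xs : Vec U k) → Vec.map (Vec.lookup (xs Vec.++ e)) (Vec.tabulate (_↑ˡ m)) ≡ xs
    tuple xs = trans (sym (Vec.tabulate-∘ (Vec.lookup (xs Vec.++ e)) (_↑ˡ m)))
      (trans (Vec.tabulate-cong (Vec.lookup-++ˡ xs e)) (Vec.tabulate∘lookup xs))
    symbols⇔ = ⋁-⊨ e (λ R → exists (arity σ R) (tupleF x y R)) {λ R → Σ[ xs ∈ Vec U (arity σ R) ]
        T (interp 𝔄 R xs) × Vec.lookup e x VecMem.∈ xs × Vec.lookup e y VecMem.∈ xs}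
      (λ R → mk⇔
        (λ t → let xs , Rxs , x∈ , y∈ = Equivalence.to (exists-⊨ (arity σ R) e (tupleF x y R)) t in
           xs , subst (T ∘ interp 𝔄 R) (tuple xs) Rxs ,
           Equivalence.to (memberF-⊨ _ e x xs) x∈ , Equivalence.to (memberF-⊨ _ e y xs) y∈)
        (λ (xs , Rxs , x∈ , y∈) → Equivalence.from (exists-⊨ (arity σ R) e (tupleF x y R))
           (xs , subst (T ∘ interp 𝔄 R) (sym (tuple xs)) Rxs ,
           Equivalence.from (memberF-⊨ _ e x xs) x∈ , Equivalence.from (memberF-⊨ _ e y xs) y∈)))
      (allFin (#symbols σ))

  outsideF-⊨ : ∀ {m n} (e : Vec U m) (vs : Vec (Fin m) n) x {ρ} → Values e vs ρ →
               (𝔄 , e ⊨ outsideF vs x) ⇔ Outside 𝔄 ρ (Vec.lookup e x)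
  outsideF-⊨ e []       x refl = mk⇔ (λ _ ()) (λ _ → refl)
  outsideF-⊨ e (v ∷ vs) x refl = mk⇔
    (λ { (p , q) zero → p ; (p , q) (suc i) → Equivalence.to (outsideF-⊨ e vs x refl) q i })
    (λ out → out zero , Equivalence.from (outsideF-⊨ e vs x refl) (out ∘ suc))

  walkF-⊨ : (ℓ : ℕ) → ∀ {m n} (e : Vec U m) (vs : Vec (Fin m) n) x y {ρ} → Values e vs ρ →
            (𝔄 , e ⊨ connF ℓ vs x y) ⇔ Walk≤ G (Outside 𝔄 ρ) ℓ (Vec.lookup e x) (Vec.lookup e y)
  walkF-⊨ zero    e vs x y eq = outsideF-⊨ e vs x eq ×-⇔ mk⇔ id id
  walkF-⊨ (suc ℓ) e vs x y eq = outsideF-⊨ e vs x eq ×-⇔ Σ-⇔ λ z →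
    (mk⇔ id id ⊎-⇔ edgeF-⊨ (z ∷ e) (suc x) zero) ×-⇔ walkF-⊨ ℓ (z ∷ e) (vs ↑) zero (suc y) (Values-suc vs eq)

  signed-⊨ : ∀ {m} (e : Vec U m) φ b v → (𝔄 , e ⊨ φ) ⇔ T v →
             (𝔄 , e ⊨ signed b φ) ⇔ (b ≡ truthValue {σ} v)
  signed-⊨ e φ zero       false φ⇔ = mk⇔ (λ _ → refl) (λ _ → Equivalence.to φ⇔)
  signed-⊨ e φ zero       true  φ⇔ = mk⇔ (λ ¬φ → ⊥-elim (¬φ (Equivalence.from φ⇔ tt))) λ ()
  signed-⊨ e φ (suc zero) false φ⇔ = mk⇔ (⊥-elim ∘ Equivalence.to φ⇔) λ ()
  signed-⊨ e φ (suc zero) true  φ⇔ = mk⇔ (λ _ → refl) (λ _ → Equivalence.from φ⇔ tt)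

  atomicF-⊨ : ∀ {m n} (e : Vec U m) (vs : Vec (Fin m) n) c {ρ} → Values e vs ρ →
              (𝔄 , e ⊨ atomicF c vs) ⇔ (c ≡ atomicTypeOf 𝔄 ρ)
  atomicF-⊨ {n = n} e vs c refl = mk⇔
    (λ t → trans (sym (funToFin-finToFin {#atoms σ n} c)) (funToFin-cong (Equivalence.to All-allFin (Equivalence.to all⇔ t))))
    (λ { refl → Equivalence.from all⇔ (Equivalence.from All-allFin (finToFun-funToFin _)) })
    where
    values : ∀ {k} (xs : Vec (Fin n) k) →
      Vec.map (Vec.lookup e) (Vec.map (Vec.lookup vs) xs) ≡ Vec.map (Vec.lookup (Vec.map (Vec.lookup e) vs)) xs
    values xs = trans (sym (Vec.map-∘ _ _ xs)) (Vec.map-cong (λ i → sym (Vec.lookup-map i _ vs)) xs)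
    value : Fin (#atoms σ n) → Bool
    value i = let R , xs = lookup (allAtoms σ n) i in
              interp 𝔄 R (Vec.map (Vec.lookup (Vec.map (Vec.lookup e) vs)) xs)
    literal⇔ : ∀ i → (𝔄 , e ⊨ signed (finToFun c i) (atom vs i)) ⇔ (finToFun c i ≡ truthValue {σ} (value i))
    literal⇔ i = signed-⊨ e (atom vs i) (finToFun c i) (value i)
      (let R , xs = lookup (allAtoms σ n) i
       in mk⇔ (subst (T ∘ interp 𝔄 R) (values xs)) (subst (T ∘ interp 𝔄 R) (sym (values xs))))
    all⇔ = ⋀-⊨ e (λ i → signed (finToFun c i) (atom vs i)) literal⇔ (allFin _)

-- Types and elimination forests

AllPairs-++⁻ˡ : ∀ {X : Set} {R : X → X → Set} xs {ys} → AllPairs R (xs ++ ys) → AllPairs R xs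
AllPairs-++⁻ˡ []       _         = []
AllPairs-++⁻ˡ (x ∷ xs) (rs ∷ ps) = All.++⁻ˡ xs rs ∷ AllPairs-++⁻ˡ xs ps

module _ {X : Set} {m : ℕ} (key : X → Fin m) (N : ℕ) where

  take-drop-↭ : ∀ {m} (F : Fin m → List X) →
    concat (tabulate F) ↭ concat (tabulate (take N ∘ F)) ++ concat (tabulate (drop N ∘ F))
  take-drop-↭ {zero}  F = ↭-refl
  take-drop-↭ {suc m} F = begin
    F zero ++ concat (tabulate (F ∘ suc))
      ↭⟨ ++⁺ˡ (F zero) (take-drop-↭ (F ∘ suc)) ⟩
    F zero ++ Ts ++ Ds
      ≡⟨ cong (_++ Ts ++ Ds) (sym (take++drop≡id N (F zero))) ⟩
    (a ++ b) ++ Ts ++ Ds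
      ≡⟨ ++-assoc a b (Ts ++ Ds) ⟩
    a ++ b ++ Ts ++ Ds
      ↭⟨ ++⁺ˡ a (shifts b Ts) ⟩
    a ++ Ts ++ b ++ Ds
      ≡⟨ sym (++-assoc a Ts (b ++ Ds)) ⟩
    (a ++ Ts) ++ b ++ Ds ∎
    where
    open PermutationReasoning
    a = take N (F zero)
    b = drop N (F zero)
    Ts = concat (tabulate (take N ∘ F ∘ suc))
    Ds = concat (tabulate (drop N ∘ F ∘ suc))

  constant-keys : ∀ {κ xs} → All (λ x → key x ≡ κ) xs → map key xs ≡ replicate (length xs) κ
  constant-keys []         = refl
  constant-keys (eq ∷ eqs) = cong₂ _∷_ eq (constant-keys eqs)

  -- The first N elements of each class are kept. A class leaves a remainder only if it has more
  -- than N elements, and then f takes the value N on its key.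
  select : ∀ (f : Fin m → ℕ) xs → (∀ κ → f κ ≡ length (withKey key κ xs) ⊓ N) →
    Σ[ ys ∈ List X ] Σ[ zs ∈ List X ] xs ↭ ys ++ zs × map key ys ≡ multiset f × All (λ z → f (key z) ≡ N) zs
  select f xs f≡ = concat (tabulate (take N ∘ F)) , concat (tabulate (drop N ∘ F)) ,
    ↭-trans (↭-sym (groupBy-↭ key xs)) (take-drop-↭ F) ,
    (begin
      map key (concat (tabulate (take N ∘ F)))        ≡⟨ sym (concat-map (tabulate (take N ∘ F))) ⟩
      concat (map (map key) (tabulate (take N ∘ F)))  ≡⟨ cong concat (map-tabulate (take N ∘ F) (map key)) ⟩
      concat (tabulate (map key ∘ take N ∘ F))        ≡⟨ cong concat (tabulate-cong taken) ⟩
      multiset f                                      ∎) ,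
    All.concat⁺ (All.tabulate⁺ dropped)
    where
    open ≡-Reasoning
    F : Fin m → List X
    F κ = withKey key κ xs
    keys : ∀ κ → All (λ x → key x ≡ κ) (F κ)
    keys κ = All.all-filter (λ x → key x ≟ κ) xs
    taken : ∀ κ → map key (take N (F κ)) ≡ replicate (f κ) κ
    taken κ = trans (constant-keys (All.take⁺ N (keys κ)))
      (cong (λ l → replicate l κ) (trans (length-take N (F κ)) (trans (⊓-comm N _) (sym (f≡ κ)))))
    dropped : ∀ κ → All (λ z → f (key z) ≡ N) (drop N (F κ))
    dropped κ with ≤-total (length (F κ)) N
    ... | inj₁ short = subst (All _) (sym (drop-all N (F κ) short)) []
    ... | inj₂ long  = All.map (λ { refl → trans (f≡ κ) (m≥n⇒m⊓n≡n long) }) (All.drop⁺ N (keys κ))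

module _ {σ : Signature} (𝔄 : Structure σ) where

  private
    U = Universe 𝔄
    G = gaifman 𝔄

  module _ {n : ℕ} {X : Set} (ρ : Vec U n) (Real : X → U → Set) (full : List X) where

    -- `Rest`, `Place`, `RealTree` and `RealForest` are the meanings of `restF`, `placeF`, `treeF`
    -- and `forestF`, with genuine connectedness in place of walks of bounded length.
    Rest : List U → Set
    Rest ps = ∀ y → ¬ Region 𝔄 ρ y ⊎ Any (λ p → Conn 𝔄 ρ p y) ps
                  ⊎ (Σ[ r ∈ U ] Conn 𝔄 ρ r y × Any (λ τ → Real τ r) full)

    Place : List U → List X → Set
    Place ps []       = Rest ps
    Place ps (τ ∷ τs) = Σ[ x ∈ U ] Region 𝔄 ρ x × All (λ p → ¬ Conn 𝔄 ρ p x) ps × Real τ x × Place (x ∷ ps) τs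

  module _ (N : ℕ) where

    mutual
      RealTree : ∀ n k → Vec U n → TreeType σ N n k → U → Set
      RealTree n (suc k) ρ τ r =
        rootType σ N n k τ ≡ atomicTypeOf 𝔄 (r ∷ ρ) × RealForest (suc n) k (r ∷ ρ) (childrenType σ N n k τ)

      RealForest : ∀ n k → Vec U n → ForestType σ N n k → Set
      RealForest n zero    ρ f = ∀ y → ¬ Region 𝔄 ρ y
      RealForest n (suc k) ρ f =
        Place ρ (RealTree n (suc k) ρ) (fullTypes σ N n (suc k) f) [] (typeList σ N n (suc k) f)

    full⇔ : ∀ {n k} (f : ForestType σ N n k) {P : TreeType σ N n k → Set} →
            Any P (fullTypes σ N n k f) ⇔ (Σ[ τ ∈ _ ] f τ ≡ fromℕ N × P τ)
    full⇔ {n} {k} f {P} = mk⇔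
      (λ any → let τ , τ∈ , p = find any in τ , proj₂ (∈-filter⁻ (λ τ → f τ ≟ fromℕ N) {xs = allFin _} τ∈) , p)
      (λ (τ , eq , p) → lose (∈-filter⁺ (λ τ → f τ ≟ fromℕ N) (∈-allFin τ) eq) p)

    Status : ∀ {n k} (ρ : Vec U n) (Real : TreeType σ N n k → U → Set) → List (TreeType σ N n k) →
             List U → List (Tree σ U n k) → U → Set
    Status ρ Real full ps ts y = Any (λ p → Conn 𝔄 ρ p y) ps ⊎ Covered 𝔄 N ρ ts y
                               ⊎ (Σ[ r ∈ U ] Conn 𝔄 ρ r y × Any (λ τ → Real τ r) full)

    -- The witnesses of `Place` are turned into trees one by one. Each root is pushed onto `ps` for
    -- the rest of the list, so the apartness of later roots from `ps` becomes pairwise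
    -- independence.
    gather : ∀ {n k} (ρ : Vec U n) (Real : TreeType σ N n k → U → Set) full →
      (∀ τ x → Region 𝔄 ρ x → Real τ x →
        Σ[ t ∈ Tree σ U n k ] GoodTree 𝔄 N ρ t × root 𝔄 N t ≡ x × treeType σ N n k t ≡ τ) →
      ∀ ps τs → Place ρ Real full ps τs → Σ[ ts ∈ List (Tree σ U n k) ]
        map (treeType σ N n k) ts ≡ τs × All (GoodTree 𝔄 N ρ) ts × AllPairs (Independent 𝔄 N ρ) ts ×
        All (λ t → All (λ p → ¬ Conn 𝔄 ρ p (root 𝔄 N t)) ps) ts ×
        (∀ y → Region 𝔄 ρ y → Status ρ Real full ps ts y)
    gather {n} {k} ρ Real full build ps [] rest = [] , refl , [] , [] , [] , λ y reg → status reg (rest y)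
      where
      status : ∀ {y} → Region 𝔄 ρ y → ¬ Region 𝔄 ρ y ⊎ Any (λ p → Conn 𝔄 ρ p y) ps
        ⊎ (Σ[ r ∈ U ] Conn 𝔄 ρ r y × Any (λ τ → Real τ r) full) → Status ρ Real full ps [] y
      status reg (inj₁ ¬reg)         = ⊥-elim (¬reg reg)
      status reg (inj₂ (inj₁ c))     = inj₁ c
      status reg (inj₂ (inj₂ extra)) = inj₂ (inj₂ extra)
    gather {n} {k} ρ Real full build ps (τ ∷ τs) (x , reg , apart , real , place)
      with t , good , refl , refl ← build τ x reg real
      with ts , refl , goods , indep , aparts , cover ← gather ρ Real full build (x ∷ ps) τs place =
      t ∷ ts , refl , good ∷ goods , All.map (λ { (ind ∷ _) → ind }) aparts ∷ indep ,
      apart ∷ All.map (λ { (_ ∷ a) → a }) aparts , λ y reg → status (cover y reg)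
      where
      status : ∀ {y} → Status ρ Real full (root 𝔄 N t ∷ ps) ts y → Status ρ Real full ps (t ∷ ts) y
      status (inj₁ (here w))     = inj₂ (inj₁ (here w))
      status (inj₁ (there c))    = inj₁ c
      status (inj₂ (inj₁ c))     = inj₂ (inj₁ (there c))
      status (inj₂ (inj₂ extra)) = inj₂ (inj₂ extra)

    length-withKey-++ : ∀ {X : Set} {m} (key : X → Fin m) κ xs ys →
      length (withKey key κ (xs ++ ys)) ≡ length (withKey key κ xs) + length (withKey key κ ys)
    length-withKey-++ key κ xs ys =
      trans (cong length (filter-++ (λ x → key x ≟ κ) xs ys)) (length-++ (withKey key κ xs))

    -- The extra trees have types whose count is already N, where truncation absorbs them; all other
    -- counts stay as they were.
    forestType-++ : ∀ {E n k} (f : ForestType σ N n k) (es ts : List (Tree σ E n k)) →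
      map (treeType σ N n k) ts ≡ typeList σ N n k f → All (λ e → f (treeType σ N n k e) ≡ fromℕ N) es →
      ∀ κ → forestType σ N n k (es ++ ts) κ ≡ f κ
    forestType-++ {n = n} {k} f es ts eq full κ with f κ ≟ fromℕ N
    ... | yes fκ≡N = toℕ-injective (begin
      toℕ (forestType σ N n k (es ++ ts) κ)         ≡⟨ toℕ-cut σ N _ ⟩
      length (withKey key κ (es ++ ts)) ⊓ N         ≡⟨ m≥n⇒m⊓n≡n many ⟩
      N                                             ≡⟨ sym (toℕ-fromℕ N) ⟩
      toℕ (fromℕ N)                                 ≡⟨ cong toℕ (sym fκ≡N) ⟩
      toℕ (f κ)                                     ∎)
      where
      open ≡-Reasoning
      key = treeType σ N n k
      count : length (withKey key κ ts) ≡ N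
      count = trans (length-withKey key κ ts) (trans (cong (length ∘ filter (_≟ κ)) eq)
        (trans (count-multiset (toℕ ∘ f) κ) (trans (cong toℕ fκ≡N) (toℕ-fromℕ N))))
      many : N ≤ length (withKey key κ (es ++ ts))
      many = ≤-trans (≤-reflexive (sym count)) (≤-trans (m≤n+m _ (length (withKey key κ es)))
               (≤-reflexive (sym (length-withKey-++ key κ es ts))))
    ... | no fκ≢N = trans
      (cong (cut σ N) (trans (length-withKey-++ key κ es ts) (cong (λ zs → length zs + length (withKey key κ ts)) none)))
      (forestType-typeList σ N n k f ts eq κ)
      where
      key = treeType σ N n k
      none : withKey key κ es ≡ []
      none = filter-none (λ x → key x ≟ κ) (All.map (λ { full refl → fκ≢N full }) full)

    mutual
      real⇒goodTree : ∀ n k (ρ : Vec U n) τ x → Region 𝔄 ρ x → RealTree n k ρ τ x →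
        Σ[ t ∈ Tree σ U n k ] GoodTree 𝔄 N ρ t × root 𝔄 N t ≡ x × treeType σ N n k t ≡ τ
      real⇒goodTree n (suc k) ρ τ x reg (c≡ , real) =
        let ts , good , type≡ = real⇒goodForest (suc n) k (x ∷ ρ) (childrenType σ N n k τ) real
        in node x (rootType σ N n k τ) ts , (reg , c≡ , good) , refl ,
           trans (mkType-cong σ N n k type≡) (mkType-surjective σ N n k τ)

      -- The trees named by the sentence are gathered first. Every component left over has a root of
      -- a full type, so `complete` can add a tree of such a type for it, and `forestType-++` shows
      -- that the forest type is still f.
      real⇒goodForest : ∀ n k (ρ : Vec U n) f → RealForest n k ρ f →
        Σ[ ts ∈ List (Tree σ U n k) ] GoodForest 𝔄 N ρ ts × (∀ κ → forestType σ N n k ts κ ≡ f κ)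
      real⇒goodForest n zero    ρ f ¬reg = [] , ([] , [] , λ y reg → ⊥-elim (¬reg y reg)) , λ ()
      real⇒goodForest n (suc k) ρ f place =
        let ts , types , goods , indep , _ , cover =
              gather ρ (RealTree n (suc k) ρ) (fullTypes σ N n (suc k) f) (real⇒goodTree n (suc k) ρ)
                [] (typeList σ N n (suc k) f) place
            es , full , good = complete 𝔄 N ρ (λ e → f (treeType σ N n (suc k) e) ≡ fromℕ N) ts goods indep
              (λ y reg → supply reg (cover y reg))
        in es ++ ts , good , forestType-++ f es ts types full
        where
        supply : ∀ {ts : List (Tree σ U n (suc k))} {y} → Region 𝔄 ρ y → Status ρ (RealTree n (suc k) ρ) (fullTypes σ N n (suc k) f) [] ts y →
          Covered 𝔄 N ρ ts y ⊎ (Σ[ t ∈ Tree σ U n (suc k) ]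
            Conn 𝔄 ρ (root 𝔄 N t) y × GoodTree 𝔄 N ρ t × f (treeType σ N n (suc k) t) ≡ fromℕ N)
        supply reg (inj₂ (inj₁ c)) = inj₁ c
        supply reg (inj₂ (inj₂ (r , w , any)))
          with τ , fτ≡N , real ← Equivalence.to (full⇔ {n} {suc k} f) any
          with t , good , refl , refl ←
            real⇒goodTree n (suc k) ρ τ r (Region-Conn 𝔄 ρ reg (Walk-sym G w)) real =
          inj₂ (t , w , good , fτ≡N)

    place : ∀ {n k} (ρ : Vec U n) (Real : TreeType σ N n k → U → Set) full ps ts →
      All (λ t → Region 𝔄 ρ (root 𝔄 N t) × Real (treeType σ N n k t) (root 𝔄 N t)) ts →
      AllPairs (Independent 𝔄 N ρ) ts → All (λ t → All (λ p → ¬ Conn 𝔄 ρ p (root 𝔄 N t)) ps) ts →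
      (∀ y → Region 𝔄 ρ y → Status ρ Real full ps ts y) → Place ρ Real full ps (map (treeType σ N n k) ts)
    place ρ Real full ps [] [] [] [] cover y with region? 𝔄 ρ y
    ... | no ¬reg = inj₁ ¬reg
    ... | yes reg with cover y reg
    ...   | inj₁ c            = inj₂ (inj₁ c)
    ...   | inj₂ (inj₂ extra) = inj₂ (inj₂ extra)
    place ρ Real full ps (t ∷ ts) ((reg , real) ∷ reals) (ind ∷ indep) (apart ∷ aparts) cover =
      root 𝔄 N t , reg , apart , real ,
      place ρ Real full (root 𝔄 N t ∷ ps) ts reals indep (All.zipWith (λ (i , a) → i ∷ a) (ind , aparts))
        (λ y reg → status (cover y reg))
      where
      status : ∀ {y} → Status ρ Real full ps (t ∷ ts) y → Status ρ Real full (root 𝔄 N t ∷ ps) ts y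
      status (inj₁ c)                = inj₁ (there c)
      status (inj₂ (inj₁ (here w)))  = inj₁ (here w)
      status (inj₂ (inj₁ (there c))) = inj₂ (inj₁ c)
      status (inj₂ (inj₂ extra))     = inj₂ (inj₂ extra)

    mutual
      good⇒realTree : ∀ n k (ρ : Vec U n) t → GoodTree 𝔄 N ρ t →
        RealTree n k ρ (treeType σ N n k t) (root 𝔄 N t)
      good⇒realTree n (suc k) ρ (node r c ts) (reg , c≡ , good) =
        let c≡′ , f≡ = mkType-injective σ N n k (mkType-surjective σ N n k (treeType σ N n (suc k) (node r c ts)))
        in trans c≡′ c≡ , good⇒realForest (suc n) k (r ∷ ρ) _ ts (sym ∘ f≡) good

      -- The trees kept by `select` witness the existential part, and the roots of the surplus
      -- trees, all of full types, serve the remaining components. The type is compared with `f`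
      -- pointwise because decoding a tree type returns the function only up to pointwise equality.
      good⇒realForest : ∀ n k (ρ : Vec U n) f ts → (∀ κ → forestType σ N n k ts κ ≡ f κ) →
        GoodForest 𝔄 N ρ ts → RealForest n k ρ f
      good⇒realForest n zero    ρ f ts type≡ (_ , _ , cover) y reg = no-tree (cover y reg)
        where
        no-tree : ∀ {ts : List (Tree σ U n 0)} → ¬ Covered 𝔄 N ρ ts y
        no-tree (there c) = no-tree c
      good⇒realForest n (suc k) ρ f ts type≡ good =
        let ys , zs , perm , types , full = select key N (toℕ ∘ f) ts
              (λ κ → trans (cong toℕ (sym (type≡ κ))) (toℕ-cut σ N _))
            goods , indep , cover = good-↭ 𝔄 N ρ perm good
            goodʸ = All.++⁻ˡ ys goods
            goodᶻ = All.++⁻ʳ ys goods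
        in subst (Place ρ (RealTree n (suc k) ρ) (fullTypes σ N n (suc k) f) []) types
             (place ρ _ _ [] ys
               (All.map (λ {t} g → good-region 𝔄 N ρ t g , good⇒realTree n (suc k) ρ t g) goodʸ)
               (AllPairs-++⁻ˡ ys indep) (All.universal (λ _ → []) ys)
               (λ y reg → status (good⇒realTree n (suc k) ρ) ys goodᶻ full (AnyP.++⁻ ys (cover y reg))))
        where
        key = treeType σ N n (suc k)
        status : (∀ t → GoodTree 𝔄 N ρ t → RealTree n (suc k) ρ (key t) (root 𝔄 N t)) → ∀ {zs y} (ys : List (Tree σ U n (suc k))) → All (GoodTree 𝔄 N ρ) zs → All (λ z → toℕ (f (key z)) ≡ N) zs →
          Covered 𝔄 N ρ ys y ⊎ Covered 𝔄 N ρ zs y →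
          Status ρ (RealTree n (suc k) ρ) (fullTypes σ N n (suc k) f) [] ys y
        status real ys gs fs (inj₁ c) = inj₂ (inj₁ c)
        status real ys (g ∷ _) (eq ∷ _) (inj₂ (here {t} w)) = inj₂ (inj₂ (root 𝔄 N t , w ,
          Equivalence.from (full⇔ {n} {suc k} f)
            (key t , toℕ-injective (trans eq (sym (toℕ-fromℕ N))) , real t g)))
        status real ys (_ ∷ gs) (_ ∷ fs) (inj₂ (there c)) = status real ys gs fs (inj₂ c)

-- Semantics of the sentences when walks can be shortened

module _ {σ : Signature} (𝔄 : Structure σ) (ℓ : ℕ)
  (short : ∀ {n} (ρ : Vec (Universe 𝔄) n) {x y} → Conn 𝔄 ρ x y → Walk≤ (gaifman 𝔄) (Outside 𝔄 ρ) ℓ x y) where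

  private
    U = Universe 𝔄
    G = gaifman 𝔄

  -- Soundness holds for every ℓ; completeness is where bounded tree-depth enters, through `short`.
  connF-⊨ : ∀ {m n} (e : Vec U m) (vs : Vec (Fin m) n) x y {ρ} → Values 𝔄 e vs ρ →
            (𝔄 , e ⊨ connF ℓ vs x y) ⇔ Conn 𝔄 ρ (Vec.lookup e x) (Vec.lookup e y)
  connF-⊨ e vs x y {ρ} eq = mk⇔
    (Walk≤⇒Walk G ℓ ∘ Equivalence.to (walkF-⊨ 𝔄 ℓ e vs x y eq))
    (Equivalence.from (walkF-⊨ 𝔄 ℓ e vs x y eq) ∘ short ρ)

  regionF-⊨ : ∀ {m n} (e : Vec U m) (vs : Vec (Fin m) n) y {ρ} → Values 𝔄 e vs ρ →
              (𝔄 , e ⊨ regionF ℓ vs y) ⇔ Region 𝔄 ρ (Vec.lookup e y)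
  regionF-⊨ e []       y refl = mk⇔ _ (λ _ → refl)
  regionF-⊨ e (v ∷ vs) y refl = connF-⊨ e vs v y refl ×-⇔ mk⇔ id id

  map-suc : ∀ {m a} (e : Vec U m) ps {Ps} → map (Vec.lookup e) ps ≡ Ps → map (Vec.lookup (a ∷ e)) (map suc ps) ≡ Ps
  map-suc e ps eq = trans (sym (map-∘ ps)) eq

  module _ {n : ℕ} {X : Set} (formula : ∀ {m} → Vec (Fin m) n → Fin m → X → Formula σ m) (full : List X)
    (ρ : Vec U n) (Real : X → U → Set)
    (formula-⊨ : ∀ {m} (e : Vec U m) vs r τ → Values 𝔄 e vs ρ → (𝔄 , e ⊨ formula vs r τ) ⇔ Real τ (Vec.lookup e r)) where

    apartF-⊨ : ∀ {m} (e : Vec U m) (vs : Vec (Fin m) n) ps x {Ps} → Values 𝔄 e vs ρ → map (Vec.lookup e) ps ≡ Ps →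
      (𝔄 , e ⊨ apartF ℓ vs ps x) ⇔ All (λ p → ¬ Conn 𝔄 ρ p (Vec.lookup e x)) Ps
    apartF-⊨ e vs ps x eq refl = mk⇔ (All.map⁺ ∘ Equivalence.to all⇔) (Equivalence.from all⇔ ∘ All.map⁻)
      where
      all⇔ = ⋀-⊨ 𝔄 e (λ p → ¬′ connF ℓ vs p x) {λ p → ¬ Conn 𝔄 ρ (Vec.lookup e p) (Vec.lookup e x)}
        (λ p → ¬-⇔ 𝔄 (connF-⊨ e vs p x eq)) ps

    coveredF-⊨ : ∀ {m} (e : Vec U m) (vs : Vec (Fin m) n) ps y {Ps} → Values 𝔄 e vs ρ → map (Vec.lookup e) ps ≡ Ps →
      (𝔄 , e ⊨ coveredF ℓ vs ps y) ⇔ Any (λ p → Conn 𝔄 ρ p (Vec.lookup e y)) Ps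
    coveredF-⊨ e vs ps y eq refl = mk⇔ (AnyP.map⁺ ∘ Equivalence.to any⇔) (Equivalence.from any⇔ ∘ AnyP.map⁻)
      where
      any⇔ = ⋁-⊨ 𝔄 e (λ p → connF ℓ vs p y) {λ p → Conn 𝔄 ρ (Vec.lookup e p) (Vec.lookup e y)}
        (λ p → connF-⊨ e vs p y eq) ps

    placeF-⊨ : ∀ {m} (e : Vec U m) (vs : Vec (Fin m) n) ps τs {Ps} → Values 𝔄 e vs ρ → map (Vec.lookup e) ps ≡ Ps →
      (𝔄 , e ⊨ placeF ℓ formula full vs ps τs) ⇔ Place 𝔄 ρ Real full Ps τs
    placeF-⊨ e vs ps [] eq eq′ = Π-⇔ 𝔄 λ y →
      let vsʸ  = Values-suc 𝔄 vs eq
      in ¬-⇔ 𝔄 (regionF-⊨ (y ∷ e) (Vec.map suc vs) zero vsʸ)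
         ⊎-⇔ coveredF-⊨ (y ∷ e) (Vec.map suc vs) (map suc ps) zero vsʸ (map-suc e ps eq′)
         ⊎-⇔ Σ-⇔ 𝔄 λ r →
           let vsʳ = Values-suc 𝔄 (Vec.map suc vs) vsʸ
           in connF-⊨ (r ∷ y ∷ e) (Vec.map suc (Vec.map suc vs)) zero (suc zero) vsʳ
              ×-⇔ ⋁-⊨ 𝔄 (r ∷ y ∷ e) (formula (Vec.map suc (Vec.map suc vs)) zero)
                    (λ τ → formula-⊨ (r ∷ y ∷ e) (Vec.map suc (Vec.map suc vs)) zero τ vsʳ) full
    placeF-⊨ e vs ps (τ ∷ τs) eq eq′ = Σ-⇔ 𝔄 λ x →
      let vsˣ = Values-suc 𝔄 vs eq
      in regionF-⊨ (x ∷ e) (Vec.map suc vs) zero vsˣ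
         ×-⇔ apartF-⊨ (x ∷ e) (Vec.map suc vs) (map suc ps) zero vsˣ (map-suc e ps eq′)
         ×-⇔ formula-⊨ (x ∷ e) (Vec.map suc vs) zero τ vsˣ
         ×-⇔ placeF-⊨ (x ∷ e) (Vec.map suc vs) (zero ∷ map suc ps) τs vsˣ (cong (x ∷_) (map-suc e ps eq′))

  module _ (N : ℕ) where

    mutual
      treeF-⊨ : ∀ n k {m} (e : Vec U m) (vs : Vec (Fin m) n) r τ {ρ} → Values 𝔄 e vs ρ →
        (𝔄 , e ⊨ treeF ℓ N n k vs r τ) ⇔ RealTree 𝔄 N n k ρ τ (Vec.lookup e r)
      treeF-⊨ n (suc k) e vs r τ {ρ} eq =
        atomicF-⊨ 𝔄 e (r ∷ vs) (rootType σ N n k τ) (cong (Vec.lookup e r ∷_) eq)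
        ×-⇔ forestF-⊨ (suc n) k e (r ∷ vs) (childrenType σ N n k τ) (cong (Vec.lookup e r ∷_) eq)

      forestF-⊨ : ∀ n k {m} (e : Vec U m) (vs : Vec (Fin m) n) f {ρ} → Values 𝔄 e vs ρ →
        (𝔄 , e ⊨ forestF ℓ N n k vs f) ⇔ RealForest 𝔄 N n k ρ f
      forestF-⊨ n zero    e vs f eq = Π-⇔ 𝔄 λ y →
        ¬-⇔ 𝔄 (regionF-⊨ (y ∷ e) (Vec.map suc vs) zero (Values-suc 𝔄 vs eq))
      forestF-⊨ n (suc k) e vs f {ρ} eq = placeF-⊨ (treeF ℓ N n (suc k)) (fullTypes σ N n (suc k) f) ρ
        (RealTree 𝔄 N n (suc k) ρ) (λ e vs r τ → treeF-⊨ n (suc k) e vs r τ) e vs [] (typeList σ N n (suc k) f) eq refl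

-- Quantifier alternations

switch≤1 : ∀ q q′ → switch q q′ ≤ 1
switch≤1 (just ex)  ex  = z≤n
switch≤1 (just ex)  all = ≤-refl
switch≤1 (just all) ex  = ≤-refl
switch≤1 (just all) all = z≤n
switch≤1 nothing    _   = z≤n

module _ {σ : Signature} where

  -- The quantifier above a formula influences only the first switch on each path.
  alternations-≤-suc : ∀ q q′ {m} (φ : Formula σ m) → alternations q φ ≤ suc (alternations q′ φ)
  alternations-≤-suc q q′ (x ≐ y)    = z≤n
  alternations-≤-suc q q′ (rel R xs) = z≤n
  alternations-≤-suc q q′ (¬′ φ)     = alternations-≤-suc q q′ φ
  alternations-≤-suc q q′ (φ ∧′ ψ)   = ⊔-mono-≤ (alternations-≤-suc q q′ φ) (alternations-≤-suc q q′ ψ)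
  alternations-≤-suc q q′ (φ ∨′ ψ)   = ⊔-mono-≤ (alternations-≤-suc q q′ φ) (alternations-≤-suc q q′ ψ)
  alternations-≤-suc q q′ (∃′ φ)     = +-mono-≤ (switch≤1 q ex) (m≤n+m _ (switch q′ ex))
  alternations-≤-suc q q′ (∀′ φ)     = +-mono-≤ (switch≤1 q all) (m≤n+m _ (switch q′ all))

  alternations-nothing : ∀ q {m} (φ : Formula σ m) → alternations nothing φ ≤ alternations q φ
  alternations-nothing q (x ≐ y)    = z≤n
  alternations-nothing q (rel R xs) = z≤n
  alternations-nothing q (¬′ φ)     = alternations-nothing q φ
  alternations-nothing q (φ ∧′ ψ)   = ⊔-mono-≤ (alternations-nothing q φ) (alternations-nothing q ψ)
  alternations-nothing q (φ ∨′ ψ)   = ⊔-mono-≤ (alternations-nothing q φ) (alternations-nothing q ψ)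
  alternations-nothing q (∃′ φ)     = m≤n+m _ (switch q ex)
  alternations-nothing q (∀′ φ)     = m≤n+m _ (switch q all)

  -- The negation is tracked as well, because connectedness also occurs negated: in `apartF`, in
  -- `restF` and at the bottom level of `forestF`.
  record Existential {m} (φ : Formula σ m) : Set where
    constructor existential
    field
      positive : alternations (just ex) (nnf φ) ≡ 0
      negative : alternations (just all) (nnf¬ φ) ≡ 0

  open Existential

  -- Counted as if below an ∃, so that prefixing further existential quantifiers is free.
  Alternates≤ : ℕ → ∀ {m} → Formula σ m → Set
  Alternates≤ b φ = alternations (just ex) (nnf φ) ≤ b

  ∧-existential : ∀ {m} {φ ψ : Formula σ m} → Existential φ → Existential ψ → Existential (φ ∧′ ψ)
  ∧-existential (existential p q) (existential p′ q′) =
    existential (cong₂ _⊔_ p p′) (cong₂ _⊔_ q q′)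

  ∨-existential : ∀ {m} {φ ψ : Formula σ m} → Existential φ → Existential ψ → Existential (φ ∨′ ψ)
  ∨-existential (existential p q) (existential p′ q′) =
    existential (cong₂ _⊔_ p p′) (cong₂ _⊔_ q q′)

  ⋁-existential : ∀ {m} {X : Set} (F : X → Formula σ m) → (∀ x → Existential (F x)) →
                  ∀ xs → Existential (⋁ (map F xs))
  ⋁-existential F F-ex []       = existential refl refl
  ⋁-existential F F-ex (x ∷ xs) = ∨-existential (F-ex x) (⋁-existential F F-ex xs)

  ∃-existential : ∀ {m} {φ : Formula σ (suc m)} → Existential φ → Existential (∃′ φ)
  ∃-existential (existential p q) = existential p q

  exists-existential : ∀ k {m} {φ : Formula σ (k + m)} → Existential φ → Existential (exists k φ)
  exists-existential zero    φ-ex = φ-ex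
  exists-existential (suc k) φ-ex = exists-existential k (∃-existential φ-ex)

  memberF-existential : ∀ k {m} (x : Fin m) → Existential (memberF k x)
  memberF-existential k {m} x = ⋁-existential (λ i → (i ↑ˡ m) ≐ (k ↑ʳ x)) (λ _ → existential refl refl) (allFin k)

  edgeF-existential : ∀ {m} (x y : Fin m) → Existential (edgeF x y)
  edgeF-existential x y = ∧-existential (existential refl refl)
    (⋁-existential (λ R → exists (arity σ R) (tupleF x y R))
      (λ R → exists-existential (arity σ R) (∧-existential (existential refl refl)
        (∧-existential (memberF-existential (arity σ R) x) (memberF-existential (arity σ R) y))))
      (allFin _))

  outsideF-existential : ∀ {m n} (vs : Vec (Fin m) n) x → Existential (outsideF vs x)
  outsideF-existential []       x = existential refl refl
  outsideF-existential (v ∷ vs) x = ∧-existential (existential refl refl) (outsideF-existential vs x)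

  connF-existential : ∀ ℓ {m n} (vs : Vec (Fin m) n) x y → Existential (connF ℓ vs x y)
  connF-existential zero vs x y = ∧-existential (outsideF-existential vs x) (existential refl refl)
  connF-existential (suc ℓ) vs x y = ∧-existential (outsideF-existential vs x) (∃-existential
    (∧-existential (∨-existential (existential refl refl) (edgeF-existential (suc x) zero))
      (connF-existential ℓ (Vec.map suc vs) zero (suc y))))

  ⋁-alternates : ∀ {b m} {X : Set} (F : X → Formula σ m) → (∀ x → Alternates≤ b (F x)) →
                 ∀ xs → Alternates≤ b (⋁ (map F xs))
  ⋁-alternates F F≤ []       = z≤n
  ⋁-alternates F F≤ (x ∷ xs) = ⊔-lub (F≤ x) (⋁-alternates F F≤ xs)

  ⋀-alternates : ∀ {m} {X : Set} (F : X → Formula σ m) → (∀ x → Alternates≤ 1 (F x)) →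
                 ∀ xs → Alternates≤ 1 (⋀ (map F xs))
  ⋀-alternates F F≤ []       = ≤-refl
  ⋀-alternates F F≤ (x ∷ xs) = ⊔-lub (F≤ x) (⋀-alternates F F≤ xs)

  atomicF-alternates : ∀ {m n} (c : AtomicType σ n) (vs : Vec (Fin m) n) → Alternates≤ 1 (atomicF c vs)
  atomicF-alternates c vs = ⋀-alternates (λ i → signed (finToFun c i) (atom vs i))
    (λ i → sign (finToFun c i) i) (allFin _)
    where
    sign : ∀ b i → Alternates≤ 1 (signed b (atom vs i))
    sign zero    i = z≤n
    sign (suc _) i = z≤n

  module _ (ℓ : ℕ) where

    regionF-existential : ∀ {m n} (vs : Vec (Fin m) n) y → Existential (regionF ℓ vs y)
    regionF-existential []       y = existential refl refl
    regionF-existential (r ∷ vs) y =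
      ∧-existential (connF-existential ℓ vs r y) (existential refl refl)

    coveredF-existential : ∀ {m n} (vs : Vec (Fin m) n) ps y → Existential (coveredF ℓ vs ps y)
    coveredF-existential vs ps y = ⋁-existential (λ p → connF ℓ vs p y) (λ p → connF-existential ℓ vs p y) ps

    apartF-alternates : ∀ {m n} (vs : Vec (Fin m) n) ps x → Alternates≤ 1 (apartF ℓ vs ps x)
    apartF-alternates vs ps x = ⋀-alternates (λ p → ¬′ connF ℓ vs p x)
      (λ p → ≤-trans (alternations-≤-suc (just ex) (just all) (nnf¬ (connF ℓ vs p x)))
                     (s≤s (≤-reflexive (negative (connF-existential ℓ vs p x))))) ps

    -- The quantifiers that place the roots join the ∃ above. One alternation is paid for the ∀ of
    -- `restF` and one for the ∃ inside it, below which the formulas for the trees contribute `b`.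
    placeF-alternates : ∀ {b n} {X : Set} (formula : ∀ {m} → Vec (Fin m) n → Fin m → X → Formula σ m) full →
      (∀ {m} (vs : Vec (Fin m) n) r τ → Alternates≤ b (formula vs r τ)) →
      ∀ {m} (vs : Vec (Fin m) n) ps τs → Alternates≤ (2 + b) (placeF ℓ formula full vs ps τs)
    placeF-alternates {b} formula full f≤ vs ps [] = s≤s (⊔-lub
      (≤-trans (≤-reflexive (negative (regionF-existential (Vec.map suc vs) zero))) z≤n)
      (⊔-lub (≤-trans (alternations-≤-suc (just all) (just ex) (nnf (coveredF ℓ (Vec.map suc vs) (map suc ps) zero)))
                (s≤s (≤-trans (≤-reflexive (positive (coveredF-existential (Vec.map suc vs) (map suc ps) zero))) z≤n)))
        (s≤s (⊔-lub
          (≤-trans (≤-reflexive (positive (connF-existential ℓ (Vec.map suc (Vec.map suc vs)) zero (suc zero)))) z≤n)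
          (⋁-alternates (formula (Vec.map suc (Vec.map suc vs)) zero) (λ τ → f≤ _ zero τ) full)))))
    placeF-alternates {b} formula full f≤ vs ps (τ ∷ τs) = ⊔-lub
      (≤-trans (≤-reflexive (positive (regionF-existential (Vec.map suc vs) zero))) z≤n)
      (⊔-lub (≤-trans (apartF-alternates (Vec.map suc vs) (map suc ps) zero) (s≤s z≤n))
        (⊔-lub (≤-trans (f≤ (Vec.map suc vs) zero τ) (m≤n+m b 2))
          (placeF-alternates formula full f≤ (Vec.map suc vs) (zero ∷ map suc ps) τs)))

    module _ (N : ℕ) where

      mutual
        treeF-alternates : ∀ n k {m} (vs : Vec (Fin m) n) r τ → Alternates≤ (suc (k * 2)) (treeF ℓ N n (suc k) vs r τ)
        treeF-alternates n k vs r τ =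
          ⊔-lub (≤-trans (atomicF-alternates (rootType σ N n k τ) (r ∷ vs)) (s≤s z≤n)) (forestF-alternates (suc n) k (r ∷ vs) _)

        -- The odd alternation belongs to the bottom level, which says with one ∀ that the region is
        -- empty.
        forestF-alternates : ∀ n k {m} (vs : Vec (Fin m) n) f → Alternates≤ (suc (k * 2)) (forestF ℓ N n k vs f)
        forestF-alternates n zero    vs f = s≤s (≤-reflexive (negative (regionF-existential (Vec.map suc vs) zero)))
        forestF-alternates n (suc k) vs f = placeF-alternates (treeF ℓ N n (suc k)) (fullTypes σ N n (suc k) f)
          (treeF-alternates n k) vs [] (typeList σ N n (suc k) f)

-- Sizes

length-multiset : ∀ {m} (f : Fin m → ℕ) {N} → (∀ κ → f κ ≤ N) → length (multiset f) ≤ m * N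
length-multiset f f≤N = bound f id f≤N
  where
  bound : ∀ {m M N} (f : Fin m → ℕ) (g : Fin m → Fin M) → (∀ κ → f κ ≤ N) →
          length (concat (tabulate (λ κ → replicate (f κ) (g κ)))) ≤ m * N
  bound {zero}  f g f≤N = z≤n
  bound {suc m} f g f≤N = ≤-trans (≤-reflexive (length-++ (replicate (f zero) (g zero))))
    (+-mono-≤ (≤-trans (≤-reflexive (length-replicate (f zero))) (f≤N zero)) (bound (f ∘ suc) (g ∘ suc) (f≤N ∘ suc)))

exchange : ∀ a b → 3 + (a + (6 + b)) ≡ 6 + (3 + a + b)
exchange a b = cong (3 +_) (begin
  a + (6 + b)      ≡⟨ sym (+-assoc a 6 b) ⟩
  a + 6 + b        ≡⟨ cong (_+ b) (+-comm a 6) ⟩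
  3 + (3 + a + b)  ∎)
  where open ≡-Reasoning

module _ {σ : Signature} where

  module _ {m : ℕ} {X : Set} (F : X → Formula σ m) (s : X → ℕ) (F≤s : ∀ x → ∥ F x ∥ ≤ s x) where

    -- 6 is the length of `false′`, and each disjunct brings a connective with two parentheses.
    ⋁-size : ∀ xs → ∥ ⋁ (map F xs) ∥ ≤ 6 + sum (map (λ x → 3 + s x) xs)
    ⋁-size []       = ≤-refl
    ⋁-size (x ∷ xs) = begin
      3 + (∥ F x ∥ + ∥ ⋁ (map F xs) ∥)                       ≤⟨ +-monoʳ-≤ 3 (+-mono-≤ (F≤s x) (⋁-size xs)) ⟩
      3 + (s x + (6 + sum (map (λ x → 3 + s x) xs)))         ≡⟨ exchange (s x) _ ⟩
      6 + (3 + s x + sum (map (λ x → 3 + s x) xs))           ∎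
      where open ≤-Reasoning

    ⋀-size : ∀ xs → ∥ ⋀ (map F xs) ∥ ≤ 6 + sum (map (λ x → 3 + s x) xs)
    ⋀-size []       = n≤1+n 5
    ⋀-size (x ∷ xs) = begin
      3 + (∥ F x ∥ + ∥ ⋀ (map F xs) ∥)                       ≤⟨ +-monoʳ-≤ 3 (+-mono-≤ (F≤s x) (⋀-size xs)) ⟩
      3 + (s x + (6 + sum (map (λ x → 3 + s x) xs)))         ≡⟨ exchange (s x) _ ⟩
      6 + (3 + s x + sum (map (λ x → 3 + s x) xs))           ∎
      where open ≤-Reasoning

  sum-const : ∀ {X : Set} c (xs : List X) → sum (map (λ _ → c) xs) ≡ length xs * c
  sum-const c []       = refl
  sum-const c (x ∷ xs) = cong (c +_) (sum-const c xs)

  exists-size : ∀ k {m} (φ : Formula σ (k + m)) → ∥ exists k φ ∥ ≡ k * 2 + ∥ φ ∥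
  exists-size zero    φ = refl
  exists-size (suc k) φ = trans (exists-size k (∃′ φ)) (trans (sym (+-assoc (k * 2) 2 ∥ φ ∥)) (cong (_+ ∥ φ ∥) (+-comm (k * 2) 2)))

module _ (σ : Signature) where

  memberSize : ℕ → ℕ
  memberSize k = 6 + sum (map (λ _ → 6) (allFin k))

  tupleSize : Symbol σ → ℕ
  tupleSize R = arity σ R * 2 + (3 + (suc (arity σ R) + (3 + (memberSize (arity σ R) + memberSize (arity σ R)))))

  edgeSize : ℕ
  edgeSize = 3 + (4 + (6 + sum (map (λ R → 3 + tupleSize R) (allFin (#symbols σ)))))

  outsideSize : ℕ → ℕ
  outsideSize zero    = 3
  outsideSize (suc n) = 3 + (4 + outsideSize n)

  connSize : ℕ → ℕ → ℕ
  connSize zero    n = 3 + (outsideSize n + 3)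
  connSize (suc ℓ) n = 3 + (outsideSize n + (2 + (3 + (3 + (3 + edgeSize) + connSize ℓ n))))

  regionSize : ℕ → ℕ → ℕ
  regionSize ℓ zero    = 3
  regionSize ℓ (suc n) = 3 + (connSize ℓ n + 4)

  atomicSize : ℕ → ℕ
  atomicSize n = 6 + sum (map (λ i → 3 + (2 + arity σ (proj₁ (lookup (allAtoms σ n) i)))) (allFin (#atoms σ n)))

  -- The sizes of restF and placeF for at most P placed roots, F full types and
  -- formulas of size S for the trees.
  restSize : (ℓ n P F S : ℕ) → ℕ
  restSize ℓ n P F S = 2 + (3 + (suc (regionSize ℓ n) + (3 + ((6 + P * (3 + connSize ℓ n))
    + (2 + (3 + (connSize ℓ n + (6 + F * (3 + S)))))))))

  stepSize : (ℓ n P S : ℕ) → ℕ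
  stepSize ℓ n P S = 2 + (3 + (regionSize ℓ n + (3 + ((6 + P * (3 + suc (connSize ℓ n))) + (3 + S)))))

  placeSize : (ℓ n P F S : ℕ) → ℕ
  placeSize ℓ n P F S = P * stepSize ℓ n P S + restSize ℓ n P F S

  module _ (ℓ N : ℕ) where

    -- Each tree type is named at most N times, so at most `#trees σ N n (suc k) * N` roots are
    -- placed.
    forestSize : ℕ → ℕ → ℕ
    forestSize n zero    = 2 + suc (regionSize ℓ n)
    forestSize n (suc k) = placeSize ℓ n (#trees σ N n (suc k) * N) (#trees σ N n (suc k))
                             (3 + (atomicSize (suc n) + forestSize (suc n) k))

  memberF-size : ∀ k {m} (x : Fin m) → ∥ memberF {σ} k x ∥ ≤ memberSize k
  memberF-size k {m} x = ⋁-size (λ i → (i ↑ˡ m) ≐ (k ↑ʳ x)) (λ _ → 3) (λ _ → ≤-refl) (allFin k)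

  edgeF-size : ∀ {m} (x y : Fin m) → ∥ edgeF {σ} x y ∥ ≤ edgeSize
  edgeF-size x y = +-monoʳ-≤ 7 (⋁-size (λ R → exists (arity σ R) (tupleF x y R)) tupleSize
    (λ R → ≤-trans (≤-reflexive (exists-size (arity σ R) (tupleF x y R)))
      (+-monoʳ-≤ (arity σ R * 2) (+-monoʳ-≤ 3 (+-monoʳ-≤ (suc (arity σ R)) (+-monoʳ-≤ 3
        (+-mono-≤ (memberF-size (arity σ R) x) (memberF-size (arity σ R) y)))))))
    (allFin (#symbols σ)))

  outsideF-size : ∀ {m n} (vs : Vec (Fin m) n) x → ∥ outsideF {σ} vs x ∥ ≤ outsideSize n
  outsideF-size []       x = ≤-refl
  outsideF-size (v ∷ vs) x = +-monoʳ-≤ 7 (outsideF-size vs x)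

  connF-size : ∀ ℓ {m n} (vs : Vec (Fin m) n) x y → ∥ connF {σ} ℓ vs x y ∥ ≤ connSize ℓ n
  connF-size zero    vs x y = +-monoʳ-≤ 3 (+-monoˡ-≤ 3 (outsideF-size vs x))
  connF-size (suc ℓ) vs x y = +-monoʳ-≤ 3 (+-mono-≤ (outsideF-size vs x) (+-monoʳ-≤ 5
    (+-mono-≤ (+-monoʳ-≤ 6 (edgeF-size (suc x) zero)) (connF-size ℓ (Vec.map suc vs) zero (suc y)))))

  regionF-size : ∀ ℓ {m n} (vs : Vec (Fin m) n) y → ∥ regionF {σ} ℓ vs y ∥ ≤ regionSize ℓ n
  regionF-size ℓ []       y = ≤-refl
  regionF-size ℓ (r ∷ vs) y = +-monoʳ-≤ 3 (+-monoˡ-≤ 4 (connF-size ℓ vs r y))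

  atomicF-size : ∀ {m n} (c : AtomicType σ n) (vs : Vec (Fin m) n) → ∥ atomicF {σ} c vs ∥ ≤ atomicSize n
  atomicF-size {n = n} c vs = ⋀-size (λ i → signed (finToFun c i) (atom {σ} vs i))
    (λ i → 2 + arity σ (proj₁ (lookup (allAtoms σ n) i))) (λ i → sign (finToFun c i) i) (allFin _)
    where
    sign : ∀ b i → ∥ signed b (atom {σ} vs i) ∥ ≤ 2 + arity σ (proj₁ (lookup (allAtoms σ n) i))
    sign zero    i = ≤-refl
    sign (suc _) i = n≤1+n _

  module _ (ℓ : ℕ) where

    sum-≤ : ∀ {X : Set} c (xs : List X) {P} → length xs ≤ P → 6 + sum (map (λ _ → c) xs) ≤ 6 + P * c
    sum-≤ c xs len = +-monoʳ-≤ 6 (≤-trans (≤-reflexive (sum-const {σ} c xs)) (*-monoˡ-≤ c len))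

    module _ {n S F P : ℕ} {X : Set} (formula : ∀ {m} → Vec (Fin m) n → Fin m → X → Formula σ m) (full : List X)
      (formula≤ : ∀ {m} (vs : Vec (Fin m) n) r τ → ∥ formula vs r τ ∥ ≤ S) (full≤ : length full ≤ F) where

      -- Each step moves one entry from `τs` to `ps`, so their total length is invariant and P
      -- bounds every conjunction and disjunction over placed roots.
      placeF-size : ∀ {m} (vs : Vec (Fin m) n) ps τs → length ps + length τs ≤ P →
        ∥ placeF ℓ formula full vs ps τs ∥ ≤ length τs * stepSize ℓ n P S + restSize ℓ n P F S
      placeF-size vs ps [] len = +-monoʳ-≤ 5 (+-mono-≤ (s≤s (regionF-size ℓ (Vec.map suc vs) zero)) (+-monoʳ-≤ 3
        (+-mono-≤ covered (+-monoʳ-≤ 5 (+-mono-≤ (connF-size ℓ (Vec.map suc (Vec.map suc vs)) zero (suc zero)) trees)))))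
        where
        covered : ∥ coveredF ℓ (Vec.map suc vs) (map suc ps) zero ∥ ≤ 6 + P * (3 + connSize ℓ n)
        covered = ≤-trans (⋁-size (λ p → connF ℓ (Vec.map suc vs) p zero) (λ _ → connSize ℓ n)
            (λ p → connF-size ℓ (Vec.map suc vs) p zero) (map suc ps))
          (sum-≤ _ (map suc ps) (≤-trans (≤-reflexive (length-map suc ps)) (≤-trans (m≤m+n _ 0) len)))
        trees : ∥ ⋁ (map (formula (Vec.map suc (Vec.map suc vs)) zero) full) ∥ ≤ 6 + F * (3 + S)
        trees = ≤-trans (⋁-size (formula (Vec.map suc (Vec.map suc vs)) zero) (λ _ → S) (formula≤ _ zero) full)
          (sum-≤ _ full full≤)
      placeF-size vs ps (τ ∷ τs) len = begin
        2 + (3 + (∥ regionF {σ} ℓ (Vec.map suc vs) zero ∥ + (3 + (∥ apartF {σ} ℓ (Vec.map suc vs) (map suc ps) zero ∥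
          + (3 + (∥ formula (Vec.map suc vs) zero τ ∥ + ∥ placeF ℓ formula full (Vec.map suc vs) (zero ∷ map suc ps) τs ∥))))))
          ≤⟨ +-monoʳ-≤ 5 (+-mono-≤ (regionF-size ℓ (Vec.map suc vs) zero) (+-monoʳ-≤ 3 (+-mono-≤ apart (+-monoʳ-≤ 3
               (+-mono-≤ (formula≤ (Vec.map suc vs) zero τ) (placeF-size (Vec.map suc vs) (zero ∷ map suc ps) τs len′)))))) ⟩
        2 + (3 + (r + (3 + (a + (3 + (S + z))))))
          ≡⟨ cong (5 +_) (trans (cong (λ w → r + (3 + w)) (sym (+-assoc a (3 + S) z))) (sym (+-assoc r (3 + (a + (3 + S))) z))) ⟩
        stepSize ℓ n P S + z
          ≡⟨ sym (+-assoc (stepSize ℓ n P S) (length τs * stepSize ℓ n P S) (restSize ℓ n P F S)) ⟩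
        suc (length τs) * stepSize ℓ n P S + restSize ℓ n P F S ∎
        where
        open ≤-Reasoning
        r = regionSize ℓ n
        a = 6 + P * (3 + suc (connSize ℓ n))
        z = length τs * stepSize ℓ n P S + restSize ℓ n P F S
        len′ : length (zero ∷ map suc ps) + length τs ≤ P
        len′ = ≤-trans (≤-reflexive (trans (cong (λ l → suc (l + length τs)) (length-map suc ps))
                 (sym (+-suc (length ps) (length τs))))) len
        apart : ∥ apartF {σ} ℓ (Vec.map suc vs) (map suc ps) zero ∥ ≤ a
        apart = ≤-trans (⋀-size (λ p → ¬′ connF ℓ (Vec.map suc vs) p zero) (λ _ → suc (connSize ℓ n))
            (λ p → s≤s (connF-size ℓ (Vec.map suc vs) p zero)) (map suc ps))
          (sum-≤ _ (map suc ps) (≤-trans (≤-reflexive (length-map suc ps)) (≤-trans (m≤m+n _ (suc (length τs))) len)))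

    module _ (N : ℕ) where

      mutual
        treeF-size : ∀ n k {m} (vs : Vec (Fin m) n) r (τ : TreeType σ N n (suc k)) →
          ∥ treeF ℓ N n (suc k) vs r τ ∥ ≤ 3 + (atomicSize (suc n) + forestSize ℓ N (suc n) k)
        treeF-size n k vs r τ = +-monoʳ-≤ 3
          (+-mono-≤ (atomicF-size (rootType σ N n k τ) (r ∷ vs)) (forestF-size (suc n) k (r ∷ vs) _))

        forestF-size : ∀ n k {m} (vs : Vec (Fin m) n) (f : ForestType σ N n k) → ∥ forestF ℓ N n k vs f ∥ ≤ forestSize ℓ N n k
        forestF-size n zero    vs f = +-monoʳ-≤ 3 (regionF-size ℓ (Vec.map suc vs) zero)
        forestF-size n (suc k) vs f = ≤-trans
          (placeF-size {n} {S = 3 + (atomicSize (suc n) + forestSize ℓ N (suc n) k)} {P = #trees σ N n (suc k) * N} (treeF ℓ N n (suc k)) (fullTypes σ N n (suc k) f) (treeF-size n k) full≤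
             vs [] (typeList σ N n (suc k) f) types≤)
          (+-monoˡ-≤ _ (*-monoˡ-≤ (stepSize ℓ n (#trees σ N n (suc k) * N) _) types≤))
          where
          types≤ : length (typeList σ N n (suc k) f) ≤ #trees σ N n (suc k) * N
          types≤ = length-multiset (toℕ ∘ f) (λ κ → toℕ≤pred[n] (f κ))
          full≤ : length (fullTypes σ N n (suc k) f) ≤ #trees σ N n (suc k)
          full≤ = ≤-trans (length-filter _ (allFin (#trees σ N n (suc k)))) (≤-reflexive (length-tabulate id))

  -- The base case is a constant, as trees of height 1 are determined by an atomic type; each
  -- further level spends one exponential.
  #trees-EXP : ∀ k n → (λ q → #trees σ (2 ^ q) n (suc k)) ∈ k -EXP
  #trees-EXP zero    n = EXP-const 0 _
  #trees-EXP (suc k) n = EXP-* (suc k) (EXP-const (suc k) (2 ^ #atoms σ (suc n))) (EXP-suc2^^ k (#trees-EXP k (suc n)))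

  2^-EXP : ∀ k → (λ q → 2 ^ q) ∈ suc k -EXP
  2^-EXP k = EXP-2^ k (EXP-raise k EXP-id)

  module _ (d : ℕ) {S F P : ℕ → ℕ} (S∈ : S ∈ d -EXP) (F∈ : F ∈ d -EXP) (P∈ : P ∈ d -EXP) where

    placeSize-EXP : ∀ ℓ n → (λ q → placeSize ℓ n (P q) (F q) (S q)) ∈ d -EXP
    placeSize-EXP ℓ n = EXP-+ d
      (EXP-* d P∈ (c+ 5 (c+ (regionSize ℓ n) (c+ 3 (EXP-+ d (c+ 6 (EXP-* d P∈ (EXP-const d (3 + suc (connSize ℓ n))))) (c+ 3 S∈))))))
      (c+ 5 (c+ (suc (regionSize ℓ n)) (c+ 3 (EXP-+ d (c+ 6 (EXP-* d P∈ (EXP-const d (3 + connSize ℓ n))))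
        (c+ 5 (c+ (connSize ℓ n) (c+ 6 (EXP-* d F∈ (c+ 3 S∈)))))))))
      where
      c+ : ∀ a {f} → f ∈ d -EXP → (λ q → a + f q) ∈ d -EXP
      c+ a f∈ = EXP-+ d (EXP-const d a) f∈

  -- A level is polynomial in N, the number of tree types and the size one level below. The last two
  -- need only k exponentials; the threshold N = 2 ^ q already needs one when k = 0.
  forestSize-EXP : ∀ ℓ k n → (λ q → forestSize ℓ (2 ^ q) n k) ∈ k -EXP
  forestSize-EXP ℓ zero    n = EXP-const 0 _
  forestSize-EXP ℓ (suc k) n = placeSize-EXP (suc k)
    (EXP-+ (suc k) (EXP-const (suc k) 3) (EXP-+ (suc k) (EXP-const (suc k) (atomicSize (suc n)))
      (EXP-suc k (forestSize-EXP ℓ k (suc n)))))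
    (EXP-suc k (#trees-EXP k n))
    (EXP-* (suc k) (EXP-suc k (#trees-EXP k n)) (2^-EXP k)) ℓ n

-- The translation

module _ (d′ : ℕ) (σ : Signature) where

  private
    d = suc d′
    ℓ = walkBound d

  -- The truth values of the nullary symbols are recorded beside the forest type, since an empty
  -- tuple has no lowest entry whose label could be consulted.
  #types : ℕ → ℕ
  #types N = 2 ^ #atoms σ 0 * suc N ^ #trees σ N 0 d

  sentenceBound : ℕ → ℕ
  sentenceBound q = 6 + #types (2 ^ q) * (3 + (3 + (atomicSize σ 0 + forestSize σ ℓ (2 ^ q) 0 d)))

  sentenceBound-EXP : sentenceBound ∈ d -EXP
  sentenceBound-EXP = EXP-+ d (EXP-const d 6)
    (EXP-* d (EXP-* d (EXP-const d (2 ^ #atoms σ 0)) (EXP-suc2^^ d′ (#trees-EXP σ d′ 0)))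
      (EXP-+ d (EXP-const d 3) (EXP-+ d (EXP-const d 3)
        (EXP-+ d (EXP-const d (atomicSize σ 0)) (forestSize-EXP σ ℓ d 0)))))

  module _ (φ : Sentence (σ ∪≤)) where

    private
      q = qr φ
      N = 2 ^ q

    nullaryType : Fin (#types N) → AtomicType σ 0
    nullaryType p = quotient (suc N ^ #trees σ N 0 d) p

    topType : Fin (#types N) → ForestType σ N 0 d
    topType p = finToFun (remainder {2 ^ #atoms σ 0} (suc N ^ #trees σ N 0 d) p)

    types-surjective : ∀ c (f : ForestType σ N 0 d) →
      Σ[ p ∈ Fin (#types N) ] nullaryType p ≡ c × (∀ κ → topType p κ ≡ f κ)
    types-surjective c f = combine c (funToFin f) ,
      cong proj₁ (remQuot-combine c (funToFin f)) ,
      λ κ → trans (cong (λ r → finToFun (proj₂ r) κ) (remQuot-combine c (funToFin f))) (finToFun-funToFin f κ)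

    canonical : Fin (#types N) → OForest (Label {σ}) Unit
    canonical p = forest σ N 0 d (canonicalForest σ N 0 d (topType p))

    canonical-⊩? : ∀ p → Dec (_⊩_ (nullaryType p) (canonical p) [] φ)
    canonical-⊩? p = ⊩? (nullaryType p) (canonical p) [] φ

    hasType : Fin (#types N) → Sentence σ
    hasType p = atomicF (nullaryType p) [] ∧′ forestF ℓ N 0 d [] (topType p)

    goodTypes : List (Fin (#types N))
    goodTypes = filter canonical-⊩? (allFin (#types N))

    translation : Sentence σ
    translation = ⋁ (map hasType goodTypes)

    translation-size : ∥ translation ∥ ≤ sentenceBound q
    translation-size = ≤-trans
      (⋁-size hasType (λ _ → 3 + (atomicSize σ 0 + forestSize σ ℓ N 0 d))
        (λ p → +-monoʳ-≤ 3 (+-mono-≤ (atomicF-size σ (nullaryType p) []) (forestF-size σ ℓ N 0 d [] (topType p))))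
        goodTypes)
      (sum-≤ σ ℓ _ goodTypes {P = #types N}
        (≤-trans (length-filter canonical-⊩? (allFin (#types N))) (≤-reflexive (length-tabulate id))))

    translation-alternates : qad translation ≤ 3 * d
    translation-alternates = begin
      qad translation                             ≤⟨ alternations-nothing (just ex) (nnf translation) ⟩
      alternations (just ex) (nnf translation)    ≤⟨ ⋁-alternates hasType (λ p → ⊔-lub
        (≤-trans (atomicF-alternates {σ} (nullaryType p) []) (s≤s z≤n)) (forestF-alternates {σ} ℓ N 0 d [] (topType p))) goodTypes ⟩
      -- The one surplus alternation is absorbed because d ≥ 1.
      1 + d * 2                                   ≤⟨ +-monoˡ-≤ (d * 2) (s≤s z≤n) ⟩
      d + d * 2                                   ≡⟨ cong (d +_) (*-comm d 2) ⟩
      3 * d                                       ∎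
      where open ≤-Reasoning

    module _ (invariant : OrderInvariant φ) (𝔄 : Structure σ) (depth : HasDepth (gaifman 𝔄) (λ _ → Unit) d) where

      private
        short : ∀ {n} (ρ : Vec (Universe 𝔄) n) {x y} → Conn 𝔄 ρ x y → Walk≤ (gaifman 𝔄) (Outside 𝔄 ρ) ℓ x y
        short ρ = HasDepth⇒short (gaifman 𝔄) d depth (λ _ → tt)

      order : ∀ ts → GoodForest 𝔄 N [] ts → LinearOrder (Universe 𝔄)
      order ts good = forestOrder 𝔄 (forest σ N 0 d ts) (represents 𝔄 N [] ts good)

      hasType-⊨ : ∀ p → (𝔄 ⊨ hasType p) ⇔ (nullaryType p ≡ atomicTypeOf 𝔄 [] × RealForest 𝔄 N 0 d [] (topType p))
      hasType-⊨ p = atomicF-⊨ 𝔄 [] [] (nullaryType p) refl ×-⇔ forestF-⊨ 𝔄 ℓ short N 0 d [] [] (topType p) refl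

      -- The ordered structure agrees with its own forest by `⊨⇔⊩`, and that forest with the
      -- canonical one because forests of equal type with threshold 2 ^ q are indistinguishable in q
      -- rounds.
      canonical-⇔ : ∀ p ts (good : GoodForest 𝔄 N [] ts) → nullaryType p ≡ atomicTypeOf 𝔄 [] →
        (∀ κ → forestType σ N 0 d ts κ ≡ topType p κ) →
        (expand 𝔄 (order ts good) ⊨ φ) ⇔ _⊩_ (nullaryType p) (canonical p) [] φ
      canonical-⇔ p ts good c≡ type≡ rewrite c≡ = mk⇔
        (Equivalence.to canonical⇔ ∘ Equivalence.to expanded⇔) (Equivalence.from expanded⇔ ∘ Equivalence.from canonical⇔)
        where
        expanded⇔ : (expand 𝔄 (order ts good) ⊨ φ) ⇔ _⊩_ (atomicTypeOf 𝔄 []) (forest σ N 0 d ts) [] φ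
        expanded⇔ = ⊨⇔⊩ 𝔄 (forest σ N 0 d ts) (represents 𝔄 N [] ts good) [] φ
        canonical⇔ : _⊩_ (atomicTypeOf 𝔄 []) (forest σ N 0 d ts) [] φ ⇔ _⊩_ (atomicTypeOf 𝔄 []) (canonical p) [] φ
        canonical⇔ = EF⇒⊩ (atomicTypeOf 𝔄 []) q [] []
          (forest-EF σ N q ≤-refl 0 d ts (canonicalForest σ N 0 d (topType p))
            (λ κ → trans (type≡ κ) (sym (canonicalForest-type σ N 0 d (topType p) κ))))
          (λ ()) φ ≤-refl

      translation-correct : (𝔄 ⊨≤ φ) ⇔ (𝔄 ⊨ translation)
      translation-correct = mk⇔ to from
        where
        disjuncts⇔ : (𝔄 ⊨ translation) ⇔ Any (λ p → 𝔄 ⊨ hasType p) goodTypes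
        disjuncts⇔ = ⋁-⊨ 𝔄 [] hasType (λ _ → mk⇔ id id) goodTypes
        to : 𝔄 ⊨≤ φ → 𝔄 ⊨ translation
        to (≼ , sat) =
          let ts , good     = good-exists 𝔄 N d [] depth
              p , c≡ , f≡ = types-surjective (atomicTypeOf 𝔄 []) (forestType σ N 0 d ts)
              -- Order-invariance exchanges the given order for that of the forest. The converse
              -- direction may choose the order itself.
              canon = Equivalence.to (canonical-⇔ p ts good c≡ (sym ∘ f≡)) (Equivalence.to (invariant 𝔄 ≼ (order ts good)) sat)
          in Equivalence.from disjuncts⇔ (lose (∈-filter⁺ canonical-⊩? (∈-allFin p) canon)
               (Equivalence.from (hasType-⊨ p) (c≡ , good⇒realForest 𝔄 N 0 d [] (topType p) ts (sym ∘ f≡) good)))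
        from : 𝔄 ⊨ translation → 𝔄 ⊨≤ φ
        from t =
          let p , p∈ , has     = find (Equivalence.to disjuncts⇔ t)
              c≡ , real        = Equivalence.to (hasType-⊨ p) has
              ts , good , type≡ = real⇒goodForest 𝔄 N 0 d [] (topType p) real
          in order ts good , Equivalence.from (canonical-⇔ p ts good c≡ type≡)
               (proj₂ (∈-filter⁻ canonical-⊩? {xs = allFin (#types N)} p∈))

theorem4 : (d : ℕ) → 1 ≤ d → (σ : Signature) →
    Σ[ f ∈ (ℕ → ℕ) ] (f ∈ d -EXP ×
    ((φ : Sentence (σ ∪≤)) → OrderInvariant φ →
    Σ[ ψ ∈ Sentence σ ]
    (((𝔄 : Structure σ) → 𝔄 ∈Fin d → (𝔄 ⊨≤ φ) ⇔ (𝔄 ⊨ ψ))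
    × ∥ ψ ∥ ≤ f (qr φ)
    × qad ψ ≤ 3 * d)))
theorem4 (suc d) _ σ = sentenceBound d σ , sentenceBound-EXP d σ , λ φ invariant →
  translation d σ φ ,
  (λ 𝔄 (k , td , k≤d) → translation-correct d σ φ invariant 𝔄
    (HasDepth-resp (gaifman 𝔄) (suc d) (λ _ → tt) (λ _ → ∈⊤)
      (TreeDepth⇒HasDepth (gaifman 𝔄) (gaifman? 𝔄) td k≤d))) ,
  translation-size d σ φ , translation-alternates d σ φ
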